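{- Suppose that $\lambda=\lambda^{<\lambda}\ge\aleph_2$ is a regular cardinal, $\kappa$ is a cardinal with $1<\kappa<\lambda$, and $\mathsf{uDSR}^*({<}\kappa,S^\lambda_\omega)$ holds. Then there is a cofinality-preserving forcing extension in which $\mathsf{uDSR}({<}\kappa,S^\lambda_\omega)$ holds and $\mathsf{sDSR}(1,S^\lambda_\omega)$ fails.
   Context: $S^\lambda_\omega$ is the set of limit ordinals below $\lambda$ of cofinality $\omega$. A set $T$ of ordinals reflects at $\gamma$ if $\mathrm{cf}(\gamma)>\omega$ and $T\cap\gamma$ is stationary in $\gamma$. For $S\subseteq\lambda$ stationary: $\mathsf{uDSR}({<}\kappa,S)$ asserts that whenever $\langle S_{\alpha,i}\mid\alpha<\lambda,\ i<j_\alpha\rangle$ is a matrix of stationary subsets of $S$ with $j_\alpha<\kappa$ for all $\alpha$, there are $\gamma<\lambda$ of uncountable cofinality and an unbounded $F\subseteq\gamma$ such that $S_{\alpha,i}$ reflects at $\gamma$ for all $\alpha\in F$, $i<j_\alpha$. $\mathsf{sDSR}(1,S)$ asserts the same for matrices with $j_\alpha\le1$ for all $\alpha$ (i.e., single sequences $\langle S_\alpha\mid\alpha<\lambda\rangle$) but with $F\subseteq\gamma$ required to be stationary in $\gamma$. $\mathsf{uDSR}^*({<}\kappa,S)$ asserts that $\mathsf{uDSR}({<}\kappa,S)$ holds and continues to hold in every forcing extension by a $\lambda$-directed closed forcing notion of size $\lambda$. -}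

module Defs where

open import Level using (Level; suc; _⊔_; Lift)
open import Data.Empty.Polymorphic using (⊥)
open import Data.Product using (Σ; Σ-syntax; _×_; _,_; proj₁; proj₂)
open import Data.Sum using (_⊎_)
open import Function.Bundles using (Bijection; Injection)
open import Induction.WellFounded using (WellFounded)
open import Relation.Binary.Bundles using (Setoid; Preorder)
open import Relation.Binary.Core using (Rel)
open import Relation.Binary.Definitions using (Maximum)
open import Relation.Binary.PropositionalEquality using (_≡_)
open import Relation.Binary.Structures using (IsStrictTotalOrder)
open import Relation.Unary using (Pred)
import Relation.Binary.Construct.On as On

------------------------------------------------------------------------
-- The language of set theory

-- A set-theoretic notion has to be read both in the ground model and,
-- through the forcing relation, in forcing extensions.  Every such notion
-- is therefore written once, as a first-order formula over an arbitrary
-- interpretation of the language {∈, =}: D is the domain of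
-- quantification, Ω the type of truth values.

record Interpretation (a b : Level) : Set (suc (a ⊔ b)) where
  infix  8 _∈̇_ _≐_
  infixr 6 _∧̇_
  infixr 5 _∨̇_
  infixr 4 _⇒̇_
  field
    D             : Set a
    Ω             : Set b
    _∈̇_ _≐_       : D → D → Ω
    ⊥̇             : Ω
    _∧̇_ _∨̇_ _⇒̇_   : Ω → Ω → Ω
    all ex        : (D → Ω) → Ω

module Language {a b} (I : Interpretation a b) where
  open Interpretation I public

  infix  7 ¬̇_
  infix  3 _⇔̇_
  infix  2 all-syntax ex-syntax allIn exIn
  infix  8 _⊆̇_ _≤̇_

  all-syntax ex-syntax : (D → Ω) → Ω
  all-syntax = all
  ex-syntax  = ex

  allIn exIn : D → (D → Ω) → Ω
  allIn A φ = all λ x → x ∈̇ A ⇒̇ φ x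
  exIn  A φ = ex  λ x → x ∈̇ A ∧̇ φ x

  syntax all-syntax (λ x → φ) = ∀̇[ x ] φ
  syntax ex-syntax  (λ x → φ) = ∃̇[ x ] φ
  syntax allIn A (λ x → φ)    = ∀̇[ x ε A ] φ
  syntax exIn  A (λ x → φ)    = ∃̇[ x ε A ] φ

  ¬̇_ : Ω → Ω
  ¬̇ φ = φ ⇒̇ ⊥̇

  _⇔̇_ : Ω → Ω → Ω
  φ ⇔̇ ψ = (φ ⇒̇ ψ) ∧̇ (ψ ⇒̇ φ)

  _⊆̇_ : D → D → Ω
  x ⊆̇ y = ∀̇[ z ε x ] (z ∈̇ y)

  Empty : D → Ω
  Empty x = ∀̇[ y ] (¬̇ (y ∈̇ x))

  ----------------------------------------------------------------------
  -- Ordinals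

  Transitive : D → Ω
  Transitive x = ∀̇[ y ε x ] (y ⊆̇ x)

  -- Correct in the presence of the axiom of foundation.
  Ordinal : D → Ω
  Ordinal α = Transitive α ∧̇ (∀̇[ β ε α ] Transitive β)

  -- The order of ordinals; the strict order is _∈̇_.
  _≤̇_ : D → D → Ω
  α ≤̇ β = α ∈̇ β ∨̇ α ≐ β

  IsOne : D → Ω
  IsOne x = ∀̇[ y ] (y ∈̇ x ⇔̇ Empty y)

  Limit : D → Ω
  Limit α = Ordinal α ∧̇ ¬̇ Empty α ∧̇ (∀̇[ β ε α ] ∃̇[ γ ε α ] (β ∈̇ γ))

  IsOmega : D → Ω
  IsOmega w = Limit w ∧̇ (∀̇[ n ε w ] (¬̇ Limit n))

  ----------------------------------------------------------------------
  -- Functions, as sets of Kuratowski pairs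

  IsUnorderedPair : D → D → D → Ω
  IsUnorderedPair z x y = ∀̇[ u ] (u ∈̇ z ⇔̇ (u ≐ x ∨̇ u ≐ y))

  IsPair : D → D → D → Ω
  IsPair z x y = ∃̇[ u ] ∃̇[ v ]
    (IsUnorderedPair u x x ∧̇ IsUnorderedPair v x y ∧̇ IsUnorderedPair z u v)

  _maps_to_ : D → D → D → Ω
  f maps x to y = ∃̇[ z ε f ] IsPair z x y

  FunctionOn : D → D → Ω
  FunctionOn f A =
      (∀̇[ z ε f ] ∃̇[ x ε A ] ∃̇[ y ] IsPair z x y)
    ∧̇ (∀̇[ x ε A ] ∃̇[ y ] (f maps x to y))
    ∧̇ (∀̇[ x ] ∀̇[ y ] ∀̇[ y′ ] (f maps x to y ⇒̇ f maps x to y′ ⇒̇ y ≐ y′))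

  Function : D → D → D → Ω
  Function f A B =
    FunctionOn f A ∧̇ (∀̇[ x ] ∀̇[ y ] (f maps x to y ⇒̇ y ∈̇ B))

  Bijective : D → D → D → Ω
  Bijective f A B =
      Function f A B
    ∧̇ (∀̇[ x ] ∀̇[ x′ ] ∀̇[ y ] (f maps x to y ⇒̇ f maps x′ to y ⇒̇ x ≐ x′))
    ∧̇ (∀̇[ y ε B ] ∃̇[ x ] (f maps x to y))

  Equinumerous : D → D → Ω
  Equinumerous A B = ∃̇[ f ] Bijective f A B

  ----------------------------------------------------------------------
  -- Cofinality and cardinals

  -- F ∩ γ is unbounded in γ.
  Unbounded : D → D → Ω
  Unbounded F γ = ∀̇[ β ε γ ] ∃̇[ η ε F ] (η ∈̇ γ ∧̇ β ≤̇ η)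

  HasCofinalMap : D → D → Ω
  HasCofinalMap δ γ = ∃̇[ f ]
    (Function f δ γ ∧̇ (∀̇[ β ε γ ] ∃̇[ ξ ] ∃̇[ η ] (f maps ξ to η ∧̇ β ≤̇ η)))

  -- δ = cf(γ)
  IsCof : D → D → Ω
  IsCof δ γ =
      Ordinal γ ∧̇ Ordinal δ
    ∧̇ HasCofinalMap δ γ ∧̇ (∀̇[ ε′ ε δ ] (¬̇ HasCofinalMap ε′ γ))

  CountableCof : D → Ω
  CountableCof γ = ∃̇[ w ] (IsOmega w ∧̇ IsCof w γ)

  UncountableCof : D → Ω
  UncountableCof γ = ∃̇[ w ] ∃̇[ δ ] (IsOmega w ∧̇ IsCof δ γ ∧̇ w ∈̇ δ)

  Cardinal : D → Ω
  Cardinal μ = Ordinal μ ∧̇ (∀̇[ β ε μ ] (¬̇ Equinumerous β μ))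

  RegularCardinal : D → Ω
  RegularCardinal μ = Cardinal μ ∧̇ Limit μ ∧̇ IsCof μ μ

  -- ν = μ⁺
  IsSuccessorCardinal : D → D → Ω
  IsSuccessorCardinal ν μ =
    Cardinal ν ∧̇ μ ∈̇ ν ∧̇ (∀̇[ ρ ε ν ] (μ ∈̇ ρ ⇒̇ ¬̇ Cardinal ρ))

  AtLeastℵ₂ : D → Ω
  AtLeastℵ₂ μ = ∃̇[ ℵ₀ ] ∃̇[ ℵ₁ ] ∃̇[ ℵ₂ ]
    ( IsOmega ℵ₀ ∧̇ IsSuccessorCardinal ℵ₁ ℵ₀ ∧̇ IsSuccessorCardinal ℵ₂ ℵ₁
    ∧̇ ℵ₂ ≤̇ μ)

  -- μ^{<μ} = μ, where μ^{<μ} is the cardinality of the set of all functions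
  -- from some α < μ to μ.
  WeakPowerIsSelf : D → Ω
  WeakPowerIsSelf μ = ∃̇[ X ]
    ((∀̇[ f ] (f ∈̇ X ⇔̇ (∃̇[ α ε μ ] Function f α μ))) ∧̇ Equinumerous X μ)

  GreaterThanOne : D → Ω
  GreaterThanOne κ = ∃̇[ o ] (IsOne o ∧̇ o ∈̇ κ)

  AtMostOne : D → Ω
  AtMostOne j = ∃̇[ o ] (IsOne o ∧̇ j ≤̇ o)

  ----------------------------------------------------------------------
  -- Stationarity and diagonal stationary reflection

  Club : D → D → Ω
  Club C γ =
      C ⊆̇ γ ∧̇ Unbounded C γ
    ∧̇ (∀̇[ δ ε γ ] (Limit δ ⇒̇ Unbounded C δ ⇒̇ δ ∈̇ C))

  -- T ∩ γ is stationary in γ.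
  Stationary : D → D → Ω
  Stationary T γ = ∀̇[ C ] (Club C γ ⇒̇ (∃̇[ x ε C ] (x ∈̇ T)))

  _reflectsAt_ : D → D → Ω
  T reflectsAt γ = UncountableCof γ ∧̇ Stationary T γ

  -- S = S^Λ_ω
  IsSω : D → D → Ω
  IsSω S Λ = ∀̇[ x ] (x ∈̇ S ⇔̇ (x ∈̇ Λ ∧̇ Limit x ∧̇ CountableCof x))

  -- A matrix ⟨ S_{α,i} | α < Λ, i < j_α ⟩ is coded as the function M on Λ
  -- whose value at α is the sequence ⟨ S_{α,i} | i < j_α ⟩, a function
  -- with domain j_α.  The predicate J is the bound imposed on the j_α.
  Matrix : (D → Ω) → D → D → D → Ω
  Matrix J Λ S M =
      FunctionOn M Λ
    ∧̇ (∀̇[ α ] ∀̇[ N ] (M maps α to N ⇒̇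
        (∃̇[ j ] ( J j ∧̇ FunctionOn N j
                ∧̇ (∀̇[ i ] ∀̇[ T ] (N maps i to T ⇒̇
                     T ⊆̇ S ∧̇ Stationary T Λ))))))

  -- T = S_{α,i}
  Entry : D → D → D → D → Ω
  Entry M α i T = ∃̇[ N ] (M maps α to N ∧̇ N maps i to T)

  -- The common form of the reflection principles: Large F γ is the
  -- largeness required of the set F ⊆ γ of reflecting rows.
  DSR : (D → Ω) → (D → D → Ω) → D → D → Ω
  DSR J Large Λ S = ∀̇[ M ] (Matrix J Λ S M ⇒̇
    (∃̇[ γ ε Λ ]
      ( UncountableCof γ
      ∧̇ (∃̇[ F ] ( F ⊆̇ γ ∧̇ Large F γ
                ∧̇ (∀̇[ α ε F ] ∀̇[ i ] ∀̇[ T ]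
                     (Entry M α i T ⇒̇ T reflectsAt γ)))))))

  -- uDSR(<κ, S) for S ⊆ Λ
  uDSR< : D → D → D → Ω
  uDSR< κ Λ S = DSR (λ j → j ∈̇ κ) Unbounded Λ S

  -- sDSR(1, S) for S ⊆ Λ
  sDSR1 : D → D → Ω
  sDSR1 Λ S = DSR AtMostOne Stationary Λ S

------------------------------------------------------------------------
-- The ground model

-- Aczel's iterative sets, with extensional equality.  Given excluded
-- middle and well-orderings of small types, they satisfy ZFC.

data V (ℓ : Level) : Set (suc ℓ) where
  sup : (A : Set ℓ) → (A → V ℓ) → V ℓ

module _ {ℓ : Level} where

  infix 4 _≈ᵛ_ _∈ᵛ_

  _≈ᵛ_ : Rel (V ℓ) ℓ
  sup A f ≈ᵛ sup B g =
    (∀ a → Σ[ b ∈ B ] f a ≈ᵛ g b) × (∀ b → Σ[ a ∈ A ] f a ≈ᵛ g b)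

  _∈ᵛ_ : Rel (V ℓ) ℓ
  x ∈ᵛ sup A f = Σ[ a ∈ A ] x ≈ᵛ f a

  ≈ᵛ-refl : ∀ x → x ≈ᵛ x
  ≈ᵛ-refl (sup A f) = (λ a → a , ≈ᵛ-refl (f a)) , (λ a → a , ≈ᵛ-refl (f a))

  ≈ᵛ-sym : ∀ x y → x ≈ᵛ y → y ≈ᵛ x
  ≈ᵛ-sym (sup A f) (sup B g) (p , q) =
      (λ b → proj₁ (q b) , ≈ᵛ-sym (f (proj₁ (q b))) (g b) (proj₂ (q b)))
    , (λ a → proj₁ (p a) , ≈ᵛ-sym (f a) (g (proj₁ (p a))) (proj₂ (p a)))

  ≈ᵛ-trans : ∀ x y z → x ≈ᵛ y → y ≈ᵛ z → x ≈ᵛ z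
  ≈ᵛ-trans (sup A f) (sup B g) (sup C h) (p , q) (p′ , q′) =
      (λ a → let (b , e) = p a ; (c , e′) = p′ b
             in c , ≈ᵛ-trans (f a) (g b) (h c) e e′)
    , (λ c → let (b , e′) = q′ c ; (a , e) = q b
             in a , ≈ᵛ-trans (f a) (g b) (h c) e e′)

V-setoid : ∀ ℓ → Setoid (suc ℓ) ℓ
V-setoid ℓ = record
  { Carrier = V ℓ
  ; _≈_     = _≈ᵛ_
  ; isEquivalence = record
    { refl  = λ {x} → ≈ᵛ-refl x
    ; sym   = λ {x} {y} → ≈ᵛ-sym x y
    ; trans = λ {x} {y} {z} → ≈ᵛ-trans x y z
    }
  }

Elements : ∀ {ℓ} → V ℓ → Setoid ℓ ℓ
Elements {ℓ} (sup A f) = On.setoid (V-setoid ℓ) f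

ground : ∀ ℓ → Interpretation (suc ℓ) (suc (suc ℓ))
ground ℓ = record
  { D   = V ℓ
  ; Ω   = Set (suc ℓ)
  ; _∈̇_ = λ x y → Lift (suc ℓ) (x ∈ᵛ y)
  ; _≐_ = λ x y → Lift (suc ℓ) (x ≈ᵛ y)
  ; ⊥̇   = ⊥
  ; _∧̇_ = _×_
  ; _∨̇_ = _⊎_
  ; _⇒̇_ = λ φ ψ → φ → ψ
  ; all = λ φ → ∀ x → φ x
  ; ex  = λ φ → Σ (V ℓ) φ
  }

-- Zermelo's form of the axiom of choice.
WellOrderingPrinciple : ∀ ℓ → Set (suc ℓ)
WellOrderingPrinciple ℓ =
  (A : Set ℓ) → Σ[ R ∈ Rel A ℓ ] IsStrictTotalOrder _≡_ R × WellFounded R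

------------------------------------------------------------------------
-- Forcing

-- p ≲ q means that p is stronger than q.
record ForcingNotion (ℓ : Level) : Set (suc ℓ) where
  field
    preorder : Preorder ℓ ℓ ℓ
  open Preorder preorder public
  field
    𝟙         : Carrier
    𝟙-maximum : Maximum _≲_ 𝟙

module _ {ℓ : Level} (P : ForcingNotion ℓ) where
  open ForcingNotion P

  -- sup A τ r is the name {(τ a , r a) | a ∈ A}.
  data Name : Set (suc ℓ) where
    sup : (A : Set ℓ) → (A → Name) → (A → Carrier) → Name

  check : V ℓ → Name
  check (sup A f) = sup A (λ a → check (f a)) (λ _ → 𝟙)

  DenseBelow : ∀ {b} → Carrier → Pred Carrier b → Set (ℓ ⊔ b)
  DenseBelow p E = ∀ q → q ≲ p → Σ[ r ∈ Carrier ] r ≲ q × E r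

  -- p ⊩ σ = τ iff p ⊩ σ ⊆ τ and p ⊩ τ ⊆ σ; the clause for membership is
  -- inlined to make the recursion structural.
  ForcesEq : Name → Name → Pred Carrier ℓ
  ForcesEq (sup A σ s) (sup B τ t) p =
      (∀ a q → q ≲ p → q ≲ s a →
         DenseBelow q (λ r → Σ[ b ∈ B ] r ≲ t b × ForcesEq (σ a) (τ b) r))
    × (∀ b q → q ≲ p → q ≲ t b →
         DenseBelow q (λ r → Σ[ a ∈ A ] r ≲ s a × ForcesEq (σ a) (τ b) r))

  ForcesIn : Name → Name → Pred Carrier ℓ
  ForcesIn π (sup B τ t) p =
    DenseBelow p (λ r → Σ[ b ∈ B ] r ≲ t b × ForcesEq π (τ b) r)

  -- The truth value of a sentence about the extension is the set of
  -- conditions forcing it.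
  extension : Interpretation (suc ℓ) (suc (suc ℓ))
  extension = record
    { D   = Name
    ; Ω   = Pred Carrier (suc ℓ)
    ; _∈̇_ = λ σ τ p → Lift (suc ℓ) (ForcesIn σ τ p)
    ; _≐_ = λ σ τ p → Lift (suc ℓ) (ForcesEq σ τ p)
    ; ⊥̇   = λ _ → ⊥
    ; _∧̇_ = λ φ ψ p → φ p × ψ p
    ; _∨̇_ = λ φ ψ p → DenseBelow p (λ q → φ q ⊎ ψ q)
    ; _⇒̇_ = λ φ ψ p → ∀ q → q ≲ p → φ q → ψ q
    ; all = λ φ p → ∀ τ → φ τ p
    ; ex  = λ φ p → DenseBelow p (λ q → Σ[ τ ∈ Name ] φ τ q)
    }

  -- Holds in every forcing extension by P.
  Forced : Pred Carrier (suc ℓ) → Set (suc ℓ)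
  Forced φ = ∀ p → φ p

  HasSize : V ℓ → Set ℓ
  HasSize Λ = Bijection Eq.setoid (Elements Λ)

  Subsetoid : Pred Carrier ℓ → Setoid ℓ ℓ
  Subsetoid E = On.setoid {B = Σ Carrier E} Eq.setoid proj₁

  -- For a cardinal Λ: E has cardinality less than Λ.
  SmallerThan : V ℓ → Pred Carrier ℓ → Set (suc ℓ)
  SmallerThan Λ E =
    Σ[ α ∈ V ℓ ] α ∈ᵛ Λ × Injection (Subsetoid E) (Elements α)

  Directed : Pred Carrier ℓ → Set ℓ
  Directed E =
      Σ Carrier E
    × (∀ p q → E p → E q → Σ[ r ∈ Carrier ] E r × r ≲ p × r ≲ q)

  DirectedClosed : V ℓ → Set (suc ℓ)
  DirectedClosed Λ =
    ∀ E → Directed E → SmallerThan Λ E → Σ[ r ∈ Carrier ] (∀ p → E p → r ≲ p)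

  CofinalityPreserving : Set (suc ℓ)
  CofinalityPreserving = ∀ γ δ →
    Language.IsCof (ground ℓ) δ γ →
    Forced (Language.IsCof extension (check δ) (check γ))

-- uDSR*(<κ, S) for S ⊆ Λ
uDSR*< : ∀ {ℓ} → V ℓ → V ℓ → V ℓ → Set (suc ℓ)
uDSR*< {ℓ} κ Λ S =
    Language.uDSR< (ground ℓ) κ Λ S
  × ((P : ForcingNotion ℓ) → DirectedClosed P Λ → HasSize P Λ →
     Forced P (Language.uDSR< (extension P)
                 (check P κ) (check P Λ) (check P S)))

{-# OPTIONS --safe #-}
-- Conditions of ℙ are bounded regressive functions h such that every limit γ of the domain has a club C with
-- h(c) ∉ C for c ∈ C.  In the extension S_α = {β ∈ S : h(β) = α} is stationary, while at each γ the α with S_α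
-- reflecting at γ avoid a club, so sDSR(1) fails.
--
-- A thread over a condition is a bounded closed C with h(c) ∉ C for c ∈ C.  Conditions with threads form a
-- λ-directed closed forcing ℝ of size λ projecting to ℙ; hence ℙ is <λ-distributive, and having size λ it preserves
-- cofinalities.  Given a matrix in the extension by ℙ, Fodor's lemma makes every entry T stationary on {h < η} for some
-- η, and a pigeonhole over κ disjoint intervals gives unboundedly many rows all of whose entries stay stationary off
-- the h-preimage of any prescribed bounded C.  So the thread can be made to promise, between successive
-- members, that one more row survives; survival is kept for ever once the thread has passed η.  Applying uDSR* in the
-- extension by ℝ to the promised rows intersected with the thread gives γ, and reflection at γ goes down to the
-- extension by ℙ because clubs of that extension remain clubs.

module Submission where

open import Defs
open import Level using (Level; suc; Lift; lift; lower; _⊔_)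
open import Data.Bool using (Bool; true; false; T)
open import Data.Empty using (⊥; ⊥-elim)
open import Data.Nat using (ℕ; zero) renaming (suc to sucℕ)
open import Data.Product using (Σ; Σ-syntax; _×_; _,_; proj₁; proj₂)
open import Data.Sum using (_⊎_; inj₁; inj₂; [_,_]′)
open import Data.Unit using (⊤)
open import Function.Base using (case_of_)
open import Function.Bundles using (Injection)
open import Relation.Nullary using (¬_; Dec; yes; no)
open import Relation.Nullary.Decidable using (toWitness; fromWitness; ⌊_⌋; map′)
open import Relation.Binary.Bundles using (Preorder)
open import Relation.Binary.Core using (Rel)
open import Relation.Binary.Definitions using (tri<; tri≈; tri>)
open import Relation.Binary.PropositionalEquality using (_≡_; refl; sym; trans; cong; subst)
open import Relation.Binary.Structures using (IsStrictTotalOrder)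
open import Induction.WellFounded using (WellFounded; Acc; acc)
open import Axiom.ExcludedMiddle using (ExcludedMiddle)

-- The obstacle is that ℝ is not harmless. Once c is on the thread, every member of the thread
-- avoids h⁻¹(c), so S_c becomes nonstationary, and a matrix entry concentrated on such sets would
-- be destroyed. Yet uDSR* speaks only about sets that are stationary in the extension by ℝ. This is
-- why rows have to be chosen along with the members of the thread. The carrier of both forcings is
-- the set of ordinals below λ. Hence "the conditions below b" makes sense and there are fewer than
-- λ of them; closing off under tasks indexed by such conditions takes the place of elementary
-- submodels and of mixing names. The points of S have cofinality ω. At a closure point in S an
-- ω-chain of threads can therefore be assembled, all of them compatible with one condition of ℙ
-- that already decides h at that point.

record Setting {ℓ : Level} (Λ κ S : V ℓ) : Set (suc ℓ) where
  private module G = Language (ground ℓ)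
  field
    regular    : G.RegularCardinal Λ
    weakPower  : G.WeakPowerIsSelf Λ
    atLeastℵ₂  : G.AtLeastℵ₂ Λ
    cardinal-κ : G.Cardinal κ
    1<κ        : G.GreaterThanOne κ
    κ∈Λ        : κ ∈ᵛ Λ
    isSω       : G.IsSω S Λ

module Development {ℓ : Level} (em : ExcludedMiddle (suc ℓ)) (wop : WellOrderingPrinciple ℓ)
  {Λ κ S : V ℓ} (setting : Setting Λ κ S) where
  open Setting setting
  module G = Language (ground ℓ)

  -- Classical logic and least elements

  dec : (A : Set (suc ℓ)) → Dec A
  dec A = em

  decℓ : (A : Set ℓ) → Dec A
  decℓ A = map′ lower lift (em {Lift (suc ℓ) A})

  by-contradiction : {A : Set (suc ℓ)} → ¬ ¬ A → A
  by-contradiction {A} h with dec A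
  ... | yes a = a
  ... | no ¬a = ⊥-elim (h ¬a)

  by-contradictionℓ : {A : Set ℓ} → ¬ ¬ A → A
  by-contradictionℓ {A} h with decℓ A
  ... | yes a = a
  ... | no ¬a = ⊥-elim (h ¬a)

  ¬∀⇒∃ℓ : {A : Set ℓ} {B : A → Set (suc ℓ)} → ¬ (∀ x → B x) → Σ[ x ∈ A ] ¬ B x
  ¬∀⇒∃ℓ h = by-contradiction λ k → h λ x → by-contradiction λ n → k (x , n)

  -- Propositional resizing: excluded middle turns every proposition into a truth value.
  Small : Set (suc ℓ) → Set ℓ
  Small A = Lift ℓ (T ⌊ dec A ⌋)

  small : {A : Set (suc ℓ)} → A → Small A
  small {A} a = lift (fromWitness {a? = dec A} a)

  large : {A : Set (suc ℓ)} → Small A → A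
  large {A} (lift t) = toWitness {a? = dec A} t

  T-irrelevant : ∀ {b} (x y : T b) → x ≡ y
  T-irrelevant {true} _ _ = refl

  least : {A : Set ℓ} {_<_ : Rel A ℓ} → WellFounded _<_ → {B : A → Set (suc ℓ)} →
          Σ A B → Σ[ x ∈ A ] B x × (∀ y → B y → ¬ (y < x))
  least {A} {_<_} wf {B} (x , b) = go x (wf x) b
    where
    go : ∀ x → Acc _<_ x → B x → Σ[ x ∈ A ] B x × (∀ y → B y → ¬ (y < x))
    go x (acc rs) b with dec (Σ[ y ∈ A ] B y × y < x)
    ... | yes (y , b′ , l) = go y (rs l) b′
    ... | no n = x , b , λ y b′ l → n (y , b′ , l)

  -- Selection by least element gives the same result for equivalent predicates, whatever proofs it
  -- is given; `Chains` relies on this to make its recursion coherent.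
  least-unique : {A : Set ℓ} {_<_ : Rel A ℓ} → IsStrictTotalOrder _≡_ _<_ →
    {B B′ : A → Set (suc ℓ)} → (∀ x → B x → B′ x) → (∀ x → B′ x → B x) →
    (u : Σ[ x ∈ A ] B x × (∀ y → B y → ¬ (y < x)))
    (v : Σ[ x ∈ A ] B′ x × (∀ y → B′ y → ¬ (y < x))) → proj₁ u ≡ proj₁ v
  least-unique sto f g (x , b , m) (y , b′ , m′) with IsStrictTotalOrder.compare sto x y
  ... | tri< l _ _ = ⊥-elim (m′ x (f x b) l)
  ... | tri≈ _ e _ = e
  ... | tri> _ _ l = ⊥-elim (m y (g y b′) l)

  -- Extensionality and foundation in the ground model

  ≈-refl : ∀ {x : V ℓ} → x ≈ᵛ x
  ≈-refl {x} = ≈ᵛ-refl x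

  ≈-sym : ∀ {x y : V ℓ} → x ≈ᵛ y → y ≈ᵛ x
  ≈-sym {x} {y} = ≈ᵛ-sym x y

  ≈-trans : ∀ {x y z : V ℓ} → x ≈ᵛ y → y ≈ᵛ z → x ≈ᵛ z
  ≈-trans {x} {y} {z} = ≈ᵛ-trans x y z

  ∈ᵛ-respˡ : ∀ {x x′ y : V ℓ} → x ≈ᵛ x′ → x ∈ᵛ y → x′ ∈ᵛ y
  ∈ᵛ-respˡ {y = sup B g} e (b , e′) = b , ≈-trans (≈-sym e) e′

  ∈ᵛ-respʳ : ∀ {x y y′ : V ℓ} → y ≈ᵛ y′ → x ∈ᵛ y → x ∈ᵛ y′
  ∈ᵛ-respʳ {y = sup B g} {sup C h} (p , q) (b , e) = proj₁ (p b) , ≈-trans e (proj₂ (p b))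

  ext : ∀ {x y : V ℓ} → (∀ z → z ∈ᵛ x → z ∈ᵛ y) → (∀ z → z ∈ᵛ y → z ∈ᵛ x) → x ≈ᵛ y
  ext {sup A f} {sup B g} p q =
    (λ a → p (f a) (a , ≈-refl)) ,
    (λ b → let a , e = q (g b) (b , ≈-refl) in a , ≈-sym e)

  ∈-acc-resp : ∀ {x y : V ℓ} → x ≈ᵛ y → Acc _∈ᵛ_ x → Acc _∈ᵛ_ y
  ∈-acc-resp e (acc rs) = acc λ l → rs (∈ᵛ-respʳ (≈-sym e) l)

  ∈-wf : WellFounded (_∈ᵛ_ {ℓ})
  ∈-wf (sup A f) = acc λ { {y} (a , e) → ∈-acc-resp (≈-sym e) (∈-wf (f a)) }

  ∈-irrefl : ∀ {x : V ℓ} → ¬ (x ∈ᵛ x)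
  ∈-irrefl {x} = go x (∈-wf x)
    where
    go : ∀ x → Acc _∈ᵛ_ x → ¬ (x ∈ᵛ x)
    go x (acc rs) l = go x (rs l) l

  -- Ix x has exactly one index for each element of x, so that on indices equality of elements is _≡_.
  Canonical : {A : Set ℓ} → (A → V ℓ) → A → Set ℓ
  Canonical {A} f a = ¬ (Σ[ b ∈ A ] proj₁ (wop A) b a × f b ≈ᵛ f a)

  opaque
    Ix : V ℓ → Set ℓ
    Ix (sup A f) = Σ[ a ∈ A ] T ⌊ decℓ (Canonical f a) ⌋

    el : ∀ {x} → Ix x → V ℓ
    el {sup A f} (a , _) = f a

    el∈ : ∀ {x} (i : Ix x) → el i ∈ᵛ x
    el∈ {sup A f} (a , _) = a , ≈-refl

    el-injective : ∀ {x} {i j : Ix x} → el {x} i ≈ᵛ el {x} j → i ≡ j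
    el-injective {sup A f} {a , c} {b , d} e
      with IsStrictTotalOrder.compare (proj₁ (proj₂ (wop A))) a b
    ... | tri< l _ _ = ⊥-elim (toWitness {a? = decℓ (Canonical f b)} d (a , l , e))
    ... | tri≈ _ refl _ = cong (a ,_) (T-irrelevant c d)
    ... | tri> _ _ l = ⊥-elim (toWitness {a? = decℓ (Canonical f a)} c (b , l , ≈-sym e))

    idx : ∀ {x y} → y ∈ᵛ x → Σ[ i ∈ Ix x ] el i ≈ᵛ y
    idx {sup A f} {y} (a , e)
      with least (proj₂ (proj₂ (wop A))) {λ a → Lift (suc ℓ) (y ≈ᵛ f a)} (a , lift e)
    ... | b , lift e′ , m = (b , fromWitness {a? = decℓ (Canonical f b)}
          λ { (c , l , e″) → m c (lift (≈-trans e′ (≈-sym e″))) l }) , ≈-sym e′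

  -- Ordinals

  Trans : V ℓ → Set (suc ℓ)
  Trans x = ∀ y → y ∈ᵛ x → ∀ z → z ∈ᵛ y → z ∈ᵛ x

  Ord : V ℓ → Set (suc ℓ)
  Ord x = Trans x × (∀ y → y ∈ᵛ x → Trans y)

  Ord-∈ : ∀ {x y} → Ord x → y ∈ᵛ x → Ord y
  Ord-∈ (t , u) l = u _ l , λ z m → u z (t _ l z m)

  Ord-trans : ∀ {x y z} → Ord z → x ∈ᵛ y → y ∈ᵛ z → x ∈ᵛ z
  Ord-trans (t , _) l m = t _ m _ l

  Trichotomy : V ℓ → V ℓ → Set ℓ
  Trichotomy x y = (x ∈ᵛ y) ⊎ (x ≈ᵛ y) ⊎ (y ∈ᵛ x)

  -- Double ∈-induction. If neither ordinal is at or below an element of the other, the induction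
  -- hypotheses place every element of each in the other, and extensionality makes them equal.
  trichotomy : ∀ {x y} → Ord x → Ord y → Trichotomy x y
  trichotomy {x} {y} = go x y (∈-wf x) (∈-wf y)
    where
    go : ∀ x y → Acc _∈ᵛ_ x → Acc _∈ᵛ_ y → Ord x → Ord y → Trichotomy x y
    go x y ax@(acc rx) ay@(acc ry) ox oy
      with dec (Σ[ z ∈ V ℓ ] z ∈ᵛ y × ((x ∈ᵛ z) ⊎ (x ≈ᵛ z)))
    ... | yes (z , l , inj₁ m) = inj₁ (Ord-trans oy m l)
    ... | yes (z , l , inj₂ e) = inj₁ (∈ᵛ-respˡ (≈-sym e) l)
    ... | no n with dec (Σ[ z ∈ V ℓ ] z ∈ᵛ x × ((y ∈ᵛ z) ⊎ (z ≈ᵛ y)))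
    ...   | yes (z , l , inj₁ m) = inj₂ (inj₂ (Ord-trans ox m l))
    ...   | yes (z , l , inj₂ e) = inj₂ (inj₂ (∈ᵛ-respˡ e l))
    ...   | no n′ = inj₂ (inj₁ (ext left right))
      where
      left : ∀ z → z ∈ᵛ x → z ∈ᵛ y
      left z l with go z y (rx l) ay (Ord-∈ ox l) oy
      ... | inj₁ m = m
      ... | inj₂ (inj₁ e) = ⊥-elim (n′ (z , l , inj₂ e))
      ... | inj₂ (inj₂ m) = ⊥-elim (n′ (z , l , inj₁ m))
      right : ∀ z → z ∈ᵛ y → z ∈ᵛ x
      right z l with go x z ax (ry l) ox (Ord-∈ oy l)
      ... | inj₁ m = ⊥-elim (n (z , l , inj₁ m))
      ... | inj₂ (inj₁ e) = ⊥-elim (n (z , l , inj₂ e))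
      ... | inj₂ (inj₂ m) = m

  ordinal : ∀ {x} → Language.Ordinal (ground ℓ) x → Ord x
  ordinal (t , u) =
    (λ y l z m → lower (t y (lift l) z (lift m))) ,
    (λ y l z m w k → lower (u y (lift l) z (lift m) w (lift k)))

  ordinal⁻¹ : ∀ {x} → Ord x → Language.Ordinal (ground ℓ) x
  ordinal⁻¹ (t , u) =
    (λ y l z m → lift (t y (lower l) z (lower m))) ,
    (λ y l z m w k → lift (u y (lower l) z (lower m) w (lower k)))

  -- Kuratowski pairs

  data Two : Set ℓ where
    one two : Two

  upairᵛ opairᵛ : V ℓ → V ℓ → V ℓ
  upairᵛ x y = sup Two λ { one → x ; two → y }
  opairᵛ x y = upairᵛ (upairᵛ x x) (upairᵛ x y)

  upairᵛ-cong : ∀ {x y x′ y′} → x ≈ᵛ x′ → y ≈ᵛ y′ → upairᵛ x y ≈ᵛ upairᵛ x′ y′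
  upairᵛ-cong e e′ = (λ { one → one , e ; two → two , e′ }) , (λ { one → one , e ; two → two , e′ })

  opairᵛ-cong : ∀ {x y x′ y′} → x ≈ᵛ x′ → y ≈ᵛ y′ → opairᵛ x y ≈ᵛ opairᵛ x′ y′
  opairᵛ-cong e e′ = upairᵛ-cong (upairᵛ-cong e e) (upairᵛ-cong e e′)

  singletonᵛ-injective : ∀ {x a b} → upairᵛ x x ≈ᵛ upairᵛ a b → (x ≈ᵛ a) × (x ≈ᵛ b)
  singletonᵛ-injective (p , q) with q one | q two
  ... | one , e | one , e′ = e , e′
  ... | one , e | two , e′ = e , e′
  ... | two , e | one , e′ = e , e′
  ... | two , e | two , e′ = e , e′

  opairᵛ-injective : ∀ {x y x′ y′} → opairᵛ x y ≈ᵛ opairᵛ x′ y′ → (x ≈ᵛ x′) × (y ≈ᵛ y′)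
  opairᵛ-injective {x} {y} {x′} {y′} (p , q) = ex , ey
    where
    ex : x ≈ᵛ x′
    ex with p one
    ... | one , e = proj₁ (singletonᵛ-injective e)
    ... | two , e = proj₁ (singletonᵛ-injective e)
    ey : y ≈ᵛ y′
    ey with p two
    ... | two , (u , v) with u two
    ...   | two , e = e
    ...   | one , e with v two
    ...     | two , e′ = e′
    ...     | one , e′ = ≈-trans e (≈-trans (≈-sym ex) e′)
    ey | one , e₀ with singletonᵛ-injective (≈-sym e₀)
    ... | _ , x′≈y with q two
    ...   | one , e = ≈-trans (≈-sym x′≈y) (≈-trans (≈-sym ex) (proj₂ (singletonᵛ-injective e)))
    ...   | two , (u , v) with v two
    ...     | one , e′ = ≈-trans (≈-sym x′≈y) (≈-trans (≈-sym ex) e′)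
    ...     | two , e′ = e′

  isUPairᵛ : ∀ {z x y} → G.IsUnorderedPair z x y → z ≈ᵛ upairᵛ x y
  isUPairᵛ {z} {x} {y} h = ext
    (λ u l → case₁ (proj₁ (h u) (lift l)))
    (λ { u (one , e) → lower (proj₂ (h u) (inj₁ (lift e)))
       ; u (two , e) → lower (proj₂ (h u) (inj₂ (lift e))) })
    where
    case₁ : ∀ {u} → (u G.≐ x) ⊎ (u G.≐ y) → u ∈ᵛ upairᵛ x y
    case₁ (inj₁ (lift e)) = one , e
    case₁ (inj₂ (lift e)) = two , e

  isUPairᵛ⁻¹ : ∀ {z x y} → z ≈ᵛ upairᵛ x y → G.IsUnorderedPair z x y
  isUPairᵛ⁻¹ {z} {x} {y} e u =
    (λ l → f (∈ᵛ-respʳ e (lower l))) ,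
    (λ { (inj₁ (lift k)) → lift (∈ᵛ-respʳ (≈-sym e) (one , k))
       ; (inj₂ (lift k)) → lift (∈ᵛ-respʳ (≈-sym e) (two , k)) })
    where
    f : u ∈ᵛ upairᵛ x y → (u G.≐ x) ⊎ (u G.≐ y)
    f (one , k) = inj₁ (lift k)
    f (two , k) = inj₂ (lift k)

  isPairᵛ : ∀ {z x y} → G.IsPair z x y → z ≈ᵛ opairᵛ x y
  isPairᵛ (u , v , hu , hv , hz) = ≈-trans (isUPairᵛ hz) (upairᵛ-cong (isUPairᵛ hu) (isUPairᵛ hv))

  isPairᵛ⁻¹ : ∀ {z x y} → z ≈ᵛ opairᵛ x y → G.IsPair z x y
  isPairᵛ⁻¹ {z} {x} {y} e = upairᵛ x x , upairᵛ x y , isUPairᵛ⁻¹ ≈-refl , isUPairᵛ⁻¹ ≈-refl , isUPairᵛ⁻¹ e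

  maps-cong : ∀ {f x y x′ y′} → x ≈ᵛ x′ → y ≈ᵛ y′ → f G.maps x to y → f G.maps x′ to y′
  maps-cong e e′ (z , l , p) = z , l , isPairᵛ⁻¹ (≈-trans (isPairᵛ p) (opairᵛ-cong e e′))

  graph : ∀ {a} → (Ix a → V ℓ) → V ℓ
  graph {a} F = sup (Ix a) λ i → opairᵛ (el i) (F i)

  graph-maps : ∀ {a} (F : Ix a → V ℓ) i → graph {a} F G.maps el i to F i
  graph-maps F i = opairᵛ (el i) (F i) , lift (i , ≈-refl) , isPairᵛ⁻¹ ≈-refl

  graph-maps⁻¹ : ∀ {a} {F : Ix a → V ℓ} {x y} → graph {a} F G.maps x to y →
    Σ[ i ∈ Ix a ] (x ≈ᵛ el i) × (y ≈ᵛ F i)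
  graph-maps⁻¹ (z , lift (i , e) , p) = i , opairᵛ-injective (≈-trans (≈-sym (isPairᵛ p)) e)

  graph-functionOn : ∀ {a} (F : Ix a → V ℓ) → G.FunctionOn (graph {a} F) a
  graph-functionOn {a} F =
    (λ { z (lift (i , e)) → el i , lift (el∈ i) , F i , isPairᵛ⁻¹ e }) ,
    (λ x l → let i , e = idx (lower l) in F i , maps-cong {x′ = x} e ≈-refl (graph-maps F i)) ,
    λ x y y′ m m′ → let i , e , k = graph-maps⁻¹ {a} m ; i′ , e′ , k′ = graph-maps⁻¹ {a} m′ in
      lift (≈-trans k (≈-sym (subst (λ j → y′ ≈ᵛ F j) (el-injective {a} (≈-trans (≈-sym e′) e)) k′)))

  value : ∀ {f a b} → G.Function f a b → (i : Ix a) → Σ[ j ∈ Ix b ] f G.maps el i to el j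
  value ((_ , t , _) , c) i =
    let y , m = t (el i) (lift (el∈ i)) ; j , e = idx (lower (c _ _ m)) in j , maps-cong ≈-refl (≈-sym e) m

  dom : ∀ {f a x y} → G.FunctionOn f a → f G.maps x to y → x ∈ᵛ a
  dom (h , _) (z , l , p) = let x′ , l′ , y′ , p′ = h z l in
    ∈ᵛ-respˡ (proj₁ (opairᵛ-injective (≈-trans (≈-sym (isPairᵛ p′)) (isPairᵛ p)))) (lower l′)

  graph-function : ∀ {a b} (F : Ix a → Ix b) → G.Function (graph {a} (λ i → el (F i))) a b
  graph-function {a} F = graph-functionOn _ , λ x y m →
    let i , _ , e = graph-maps⁻¹ {a} m in lift (∈ᵛ-respˡ (≈-sym e) (el∈ (F i)))

  infix 4 _≤ᵛ_
  _≤ᵛ_ : V ℓ → V ℓ → Set ℓ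
  x ≤ᵛ y = (x ∈ᵛ y) ⊎ (x ≈ᵛ y)

  ≤ᵛ-in : ∀ {x y} → x ≤ᵛ y → x G.≤̇ y
  ≤ᵛ-in (inj₁ l) = inj₁ (lift l)
  ≤ᵛ-in (inj₂ l) = inj₂ (lift l)

  ≤ᵛ-out : ∀ {x y} → x G.≤̇ y → x ≤ᵛ y
  ≤ᵛ-out (inj₁ l) = inj₁ (lower l)
  ≤ᵛ-out (inj₂ l) = inj₂ (lower l)

  ≤ᵛ-resp : ∀ {x y x′ y′} → x ≈ᵛ x′ → y ≈ᵛ y′ → x ≤ᵛ y → x′ ≤ᵛ y′
  ≤ᵛ-resp e e′ (inj₁ l) = inj₁ (∈ᵛ-respˡ e (∈ᵛ-respʳ e′ l))
  ≤ᵛ-resp e e′ (inj₂ l) = inj₂ (≈-trans (≈-sym e) (≈-trans l e′))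

  equinumerous : ∀ {a b} (F : Ix a → Ix b) → (∀ i j → F i ≡ F j → i ≡ j) →
    (∀ j → Σ[ i ∈ Ix a ] F i ≡ j) → G.Equinumerous a b
  equinumerous {a} {b} F inj surj = graph {a} (λ i → el (F i)) , graph-function F ,
    (λ x x′ y m m′ → let i , e , k = graph-maps⁻¹ {a} m ; i′ , e′ , k′ = graph-maps⁻¹ {a} m′ in
      lift (≈-trans e (≈-trans (subst (λ j → el i ≈ᵛ el j) (inj i i′ (el-injective {b} (≈-trans (≈-sym k) k′))) ≈-refl)
        (≈-sym e′)))) ,
    λ y l → let j , e = idx (lower l) ; i , k = surj j in
      el i , maps-cong ≈-refl (subst (λ j → el j ≈ᵛ y) (sym k) e) (graph-maps _ i)

  CofinalMap : V ℓ → V ℓ → Set ℓ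
  CofinalMap a b = Σ[ F ∈ (Ix a → Ix b) ] (∀ (β : Ix b) → Σ[ i ∈ Ix a ] el β ≤ᵛ el (F i))

  cofinalMap : ∀ {a b} → G.HasCofinalMap a b → CofinalMap a b
  cofinalMap {a} {b} (f , h@((_ , _ , u) , _) , c) = (λ i → proj₁ (value h i)) , λ β →
    let ξ , η , m , l = c (el β) (lift (el∈ β)) ; i , e = idx (dom (proj₁ h) m) in
    i , ≤ᵛ-resp ≈-refl (lower (u _ _ _ (maps-cong (≈-sym e) ≈-refl m) (proj₂ (value h i)))) (≤ᵛ-out l)

  cofinalMap⁻¹ : ∀ {a b} → CofinalMap a b → G.HasCofinalMap a b
  cofinalMap⁻¹ {a} {b} (F , c) = graph {a} (λ i → el (F i)) , graph-function F , λ β l →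
    let β′ , e = idx (lower l) ; i , k = c β′ in
    el i , el (F i) , graph-maps _ i , ≤ᵛ-in (≤ᵛ-resp e ≈-refl k)

  CofinalMap-resp : ∀ {a b a′ b′} → a ≈ᵛ a′ → b ≈ᵛ b′ → CofinalMap a b → CofinalMap a′ b′
  CofinalMap-resp {a} {b} {a′} {b′} e e′ (F , c) =
    (λ i → tr (F (back i))) , λ β →
      let β₀ , k = idx (∈ᵛ-respʳ (≈-sym e′) (el∈ β)) ; i , l = c β₀
          i′ , m = idx (∈ᵛ-respʳ e (el∈ i))
          back-i = el-injective {a} {back i′} {i} (≈-trans (proj₂ (idx (∈ᵛ-respʳ (≈-sym e) (el∈ i′)))) m)
      in i′ , ≤ᵛ-resp k (≈-sym (≈-trans (proj₂ (tr′ (F (back i′)))) (subst (λ j → el (F (back i′)) ≈ᵛ el (F j)) back-i ≈-refl))) l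
    where
    back : Ix a′ → Ix a
    back i = proj₁ (idx (∈ᵛ-respʳ (≈-sym e) (el∈ i)))
    tr′ : (j : Ix b) → Σ[ i ∈ Ix b′ ] el i ≈ᵛ el j
    tr′ j = idx (∈ᵛ-respʳ e′ (el∈ j))
    tr : Ix b → Ix b′
    tr j = proj₁ (tr′ j)

  -- The ordinals below λ

  Λ-ord : Ord Λ
  Λ-ord = ordinal (proj₁ (proj₁ regular))

  J : Set ℓ
  J = Ix Λ

  infix 4 _<_ _≤_
  -- A record rather than an abbreviation, so that i and j can be inferred from a proof.
  record _<_ (i j : J) : Set ℓ where
    constructor lt
    field un< : el i ∈ᵛ el j
  open _<_ public

  _≤_ : J → J → Set ℓ
  i ≤ j = i < j ⊎ i ≡ j

  el-ord : ∀ (i : J) → Ord (el i)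
  el-ord i = Ord-∈ Λ-ord (el∈ i)

  el-cong : ∀ {a} {i j : Ix a} → i ≡ j → el i ≈ᵛ el j
  el-cong refl = ≈-refl

  <-irrefl : ∀ {i} → ¬ (i < i)
  <-irrefl (lt l) = ∈-irrefl l

  <-trans : ∀ {i j k} → i < j → j < k → i < k
  <-trans {k = k} (lt l) (lt m) = lt (Ord-trans (el-ord k) l m)

  <-≤-trans : ∀ {i j k} → i < j → j ≤ k → i < k
  <-≤-trans l (inj₁ m) = <-trans l m
  <-≤-trans l (inj₂ refl) = l

  ≤-<-trans : ∀ {i j k} → i ≤ j → j < k → i < k
  ≤-<-trans (inj₁ m) l = <-trans m l
  ≤-<-trans (inj₂ refl) l = l

  ≤-trans : ∀ {i j k} → i ≤ j → j ≤ k → i ≤ k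
  ≤-trans (inj₁ m) l = inj₁ (<-≤-trans m l)
  ≤-trans (inj₂ refl) l = l

  ≤-refl : ∀ {i} → i ≤ i
  ≤-refl = inj₂ refl

  cmp : ∀ i j → i < j ⊎ i ≡ j ⊎ j < i
  cmp i j with trichotomy (el-ord i) (el-ord j)
  ... | inj₁ l = inj₁ (lt l)
  ... | inj₂ (inj₁ e) = inj₂ (inj₁ (el-injective {Λ} e))
  ... | inj₂ (inj₂ l) = inj₂ (inj₂ (lt l))

  <⊎≥ : ∀ i j → i < j ⊎ j ≤ i
  <⊎≥ i j with cmp i j
  ... | inj₁ l = inj₁ l
  ... | inj₂ (inj₁ e) = inj₂ (inj₂ (sym e))
  ... | inj₂ (inj₂ l) = inj₂ (inj₁ l)

  ≤⇒≯ : ∀ {i j} → i ≤ j → ¬ (j < i)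
  ≤⇒≯ l m = <-irrefl (≤-<-trans l m)

  ≮⇒≥ : ∀ {i j} → ¬ (i < j) → j ≤ i
  ≮⇒≥ {i} {j} n with <⊎≥ i j
  ... | inj₁ l = ⊥-elim (n l)
  ... | inj₂ l = l

  ≤-antisym : ∀ {i j} → i ≤ j → j ≤ i → i ≡ j
  ≤-antisym (inj₁ l) m = ⊥-elim (≤⇒≯ m l)
  ≤-antisym (inj₂ e) m = e

  <-wf : WellFounded _<_
  <-wf i = go i (∈-wf (el i))
    where
    go : ∀ i → Acc _∈ᵛ_ (el i) → Acc _<_ i
    go i (acc rs) = acc λ { {j} (lt l) → go j (rs l) }

  <-induction : ∀ {b} (B : J → Set b) → (∀ i → (∀ j → j < i → B j) → B i) → ∀ i → B i
  <-induction B f i = go i (<-wf i)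
    where
    go : ∀ i → Acc _<_ i → B i
    go i (acc rs) = f i λ j l → go j (rs l)

  opaque
    leastJ : {B : J → Set (suc ℓ)} → Σ J B → Σ[ x ∈ J ] B x × (∀ y → B y → x ≤ y)
    leastJ s with least <-wf s
    ... | x , b , m = x , b , λ y b′ → ≮⇒≥ (m y b′)

    leastℓ : {B : J → Set ℓ} → Σ J B → Σ[ x ∈ J ] B x × (∀ y → B y → x ≤ y)
    leastℓ {B} (x , b) = let y , b′ , m = leastJ {λ x → Lift (suc ℓ) (B x)} (x , lift b) in
      y , lower b′ , λ z c → m z (lift c)

  private
    Λ-limit : G.Limit Λ
    Λ-limit = proj₁ (proj₂ regular)

    someJ : J
    someJ = by-contradictionℓ λ n → lower (proj₁ (proj₂ Λ-limit) λ y l → ⊥-elim (n (proj₁ (idx (lower l)))))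

    least-element : Σ[ x ∈ J ] Lift ℓ ⊤ × (∀ y → Lift ℓ ⊤ → x ≤ y)
    least-element = leastℓ (someJ , _)

  opaque
    0J : J
    0J = proj₁ least-element

    0≤ : ∀ i → 0J ≤ i
    0≤ i = proj₂ (proj₂ least-element) i _

  ≮0 : ∀ {i} → ¬ (i < 0J)
  ≮0 {i} = ≤⇒≯ (0≤ i)

  private
    above : ∀ i → Σ[ j ∈ J ] i < j
    above i = let γ , l , m = proj₂ (proj₂ Λ-limit) (el i) (lift (el∈ i)) ; j , e = idx (lower l) in
      j , lt (∈ᵛ-respʳ (≈-sym e) (lower m))

  opaque
    sucJ : J → J
    sucJ i = proj₁ (leastℓ (above i))

    <suc : ∀ i → i < sucJ i
    <suc i = proj₁ (proj₂ (leastℓ (above i)))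

    suc≤ : ∀ {i j} → i < j → sucJ i ≤ j
    suc≤ {i} {j} l = proj₂ (proj₂ (leastℓ (above i))) j l

  <suc⇒≤ : ∀ {i j} → i < sucJ j → i ≤ j
  <suc⇒≤ l = ≮⇒≥ λ m → ≤⇒≯ (suc≤ m) l

  ≤⇒<suc : ∀ {i j} → i ≤ j → i < sucJ j
  ≤⇒<suc {j = j} l = ≤-<-trans l (<suc j)

  max : ∀ i j → Σ[ k ∈ J ] i ≤ k × j ≤ k
  max i j with <⊎≥ i j
  ... | inj₁ l = j , inj₁ l , ≤-refl
  ... | inj₂ l = i , ≤-refl , l

  maxBelow : ∀ {a b γ} → a < γ → b < γ → Σ[ c ∈ J ] a ≤ c × b ≤ c × c < γ
  maxBelow {a} {b} l m with <⊎≥ a b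
  ... | inj₁ k = b , inj₁ k , ≤-refl , m
  ... | inj₂ k = a , ≤-refl , k , l

  idxΛ : ∀ {y} → y ∈ᵛ Λ → Σ[ j ∈ J ] el j ≈ᵛ y
  idxΛ = idx

  lift-ix : ∀ {j : J} (i : Ix (el j)) → Σ[ k ∈ J ] (el k ≈ᵛ el i) × k < j
  lift-ix {j} i = let k , e = idxΛ (proj₁ Λ-ord (el j) (el∈ j) (el i) (el∈ i)) in
    k , e , lt (∈ᵛ-respˡ (≈-sym e) (el∈ i))

  lower-ix : ∀ {j k : J} → k < j → Σ[ i ∈ Ix (el j) ] el i ≈ᵛ el k
  lower-ix (lt l) = idx l

  el≈⇒≡ : ∀ {i j : J} → el i ≈ᵛ el j → i ≡ j
  el≈⇒≡ = el-injective {Λ}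

  ≤⇒≤ᵛ : ∀ {i j : J} → i ≤ j → el i ≤ᵛ el j
  ≤⇒≤ᵛ (inj₁ (lt l)) = inj₁ l
  ≤⇒≤ᵛ (inj₂ refl) = inj₂ ≈-refl

  ≤ᵛ⇒≤ : ∀ {i j : J} → el i ≤ᵛ el j → i ≤ j
  ≤ᵛ⇒≤ (inj₁ l) = inj₁ (lt l)
  ≤ᵛ⇒≤ (inj₂ e) = inj₂ (el≈⇒≡ e)

  opaque
    -- Regularity of λ: if the values on a were unbounded, F restricted to a would be a cofinal map
    -- from a into λ.
    bounded : ∀ a (F : J → J) → Σ[ b ∈ J ] (∀ j → j < a → F j < b)
    bounded a F = by-contradictionℓ λ n → lower (
      proj₂ (proj₂ (proj₂ (proj₂ (proj₂ regular)))) (el a) (lift (el∈ a))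
        (cofinalMap⁻¹ ((λ i → F (proj₁ (lift-ix {a} i))) , λ β → by-contradictionℓ λ m → n (β , λ j l →
          by-contradictionℓ λ o → let i , e = lower-ix l in
            m (i , ≤⇒≤ᵛ (subst (λ k → β ≤ F k) (el≈⇒≡ (≈-trans (≈-sym e) (≈-sym (proj₁ (proj₂ (lift-ix {a} i)))))) (≮⇒≥ o)))))))

  -- Numerals

  num : ℕ → J
  num zero = 0J
  num (sucℕ n) = sucJ (num n)

  data _<ℕ_ (m : ℕ) : ℕ → Set where
    here  : m <ℕ sucℕ m
    there : ∀ {n} → m <ℕ n → m <ℕ sucℕ n

  num-< : ∀ {m n} → m <ℕ n → num m < num n
  num-< here = <suc _
  num-< (there l) = <-trans (num-< l) (<suc _)

  cmpℕ : ∀ m n → m <ℕ n ⊎ m ≡ n ⊎ n <ℕ m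
  cmpℕ zero zero = inj₂ (inj₁ refl)
  cmpℕ zero (sucℕ n) = inj₁ (pos n)
    where
    pos : ∀ n → zero <ℕ sucℕ n
    pos zero = here
    pos (sucℕ n) = there (pos n)
  cmpℕ (sucℕ m) n with cmpℕ m n
  ... | inj₂ (inj₁ refl) = inj₂ (inj₂ here)
  ... | inj₂ (inj₂ l) = inj₂ (inj₂ (there l))
  ... | inj₁ here = inj₂ (inj₁ refl)
  ... | inj₁ (there l) = inj₁ (up l)
    where
    up : ∀ {m n} → m <ℕ n → sucℕ m <ℕ sucℕ n
    up here = here
    up (there l) = there (up l)

  num-injective : ∀ {m n} → num m ≡ num n → m ≡ n
  num-injective {m} {n} e with cmpℕ m n
  ... | inj₁ l = ⊥-elim (<-irrefl (subst (_< num n) e (num-< l)))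
  ... | inj₂ (inj₁ e′) = e′
  ... | inj₂ (inj₂ l) = ⊥-elim (<-irrefl (subst (num n <_) e (num-< l)))

  private
    ω : V ℓ
    ω = proj₁ atLeastℵ₂

  ω-isOmega : G.IsOmega ω
  ω-isOmega = proj₁ (proj₂ (proj₂ (proj₂ atLeastℵ₂)))

  private
    ω∈ : (h : G.AtLeastℵ₂ Λ) → proj₁ h ∈ᵛ Λ
    ω∈ (ℵ₀ , ℵ₁ , ℵ₂ , _ , (_ , lift l , _) , (_ , lift m , _) , inj₁ (lift k)) =
      proj₁ Λ-ord _ (proj₁ Λ-ord _ k _ m) _ l
    ω∈ (ℵ₀ , ℵ₁ , ℵ₂ , _ , (_ , lift l , _) , (_ , lift m , _) , inj₂ (lift e)) =
      proj₁ Λ-ord _ (∈ᵛ-respʳ e m) _ l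

    ω∈Λ : ω ∈ᵛ Λ
    ω∈Λ = ω∈ atLeastℵ₂

  ωJ : J
  ωJ = proj₁ (idxΛ ω∈Λ)

  ωJ≈ω : el ωJ ≈ᵛ ω
  ωJ≈ω = proj₂ (idxΛ ω∈Λ)

  LimJ : J → Set ℓ
  LimJ x = 0J < x × (∀ y → y < x → sucJ y < x)

  limit⇒ : ∀ {x : J} → LimJ x → G.Limit (el x)
  limit⇒ {x} (p , s) = ordinal⁻¹ (el-ord x) , (λ e → e (el 0J) (lift (un< p))) , λ β l →
    let i , e = idx (lower l) ; k , e′ , m = lift-ix {x} i in
    el (sucJ k) , lift (un< (s k m)) , lift (∈ᵛ-respˡ (≈-trans e′ e) (un< (<suc k)))

  ⇒limit : ∀ {x : J} → G.Limit (el x) → LimJ x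
  ⇒limit {x} (_ , ne , s) = positive , λ y l →
    let γ , m , k = s (el y) (lift (un< l)) ; i , e = idx (lower m) ; z , e′ , o = lift-ix {x} i in
    ≤-<-trans (suc≤ (lt (∈ᵛ-respʳ (≈-sym (≈-trans e′ e)) (lower k)))) o
    where
    positive : 0J < x
    positive with 0≤ x
    ... | inj₁ l = l
    ... | inj₂ e = ⊥-elim (lower (ne λ y l → lift (¬l e (lower l))))
      where
      ¬l : ∀ {y} → 0J ≡ x → ¬ (y ∈ᵛ el x)
      ¬l refl l = let i , e = idx l in ≮0 (proj₂ (proj₂ (lift-ix {x} i)))

  zero-or-suc : ∀ x → ¬ LimJ x → x ≡ 0J ⊎ (Σ[ y ∈ J ] x ≡ sucJ y)
  zero-or-suc x n with 0≤ x
  ... | inj₂ e = inj₁ (sym e)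
  ... | inj₁ p with decℓ (Σ[ y ∈ J ] x ≡ sucJ y)
  ...   | yes q = inj₂ q
  ...   | no ¬q = ⊥-elim (n (p , λ y l → [ (λ z → z) , (λ e → ⊥-elim (¬q (y , sym e))) ]′ (suc≤ l)))

  n<ω⇒¬limit : ∀ {n} → n < ωJ → ¬ LimJ n
  n<ω⇒¬limit l m = lower (proj₂ ω-isOmega _ (lift (∈ᵛ-respʳ ωJ≈ω (un< l))) (limit⇒ m))

  Limit-resp : ∀ {x y} → x ≈ᵛ y → G.Limit x → G.Limit y
  Limit-resp e (o , ne , s) =
    ordinal⁻¹ ((λ y l z m → ∈ᵛ-respʳ e (proj₁ (ordinal o) y (∈ᵛ-respʳ (≈-sym e) l) z m)) ,
               λ y l → proj₂ (ordinal o) y (∈ᵛ-respʳ (≈-sym e) l)) ,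
    (λ h → ne λ y l → h y (lift (∈ᵛ-respʳ e (lower l)))) ,
    λ β l → let γ , m , k = s β (lift (∈ᵛ-respʳ (≈-sym e) (lower l))) in γ , lift (∈ᵛ-respʳ e (lower m)) , k

  ω-limit : LimJ ωJ
  ω-limit = ⇒limit (Limit-resp (≈-sym ωJ≈ω) (proj₁ ω-isOmega))

  num<ω : ∀ n → num n < ωJ
  num<ω zero = proj₁ ω-limit
  num<ω (sucℕ n) = proj₂ ω-limit _ (num<ω n)

  <ω⇒num : ∀ j → j < ωJ → Σ[ n ∈ ℕ ] num n ≡ j
  <ω⇒num = <-induction _ λ j ih l → [ (λ e → 0 , sym e) ,
    (λ { (y , refl) → let n , e = ih y (<suc y) (<-trans (<suc y) l) in sucℕ n , cong sucJ e }) ]′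
    (zero-or-suc j (n<ω⇒¬limit l))

  -- The value off the numerals is junk.
  opaque
    onNum : (ℕ → J) → J → J
    onNum s j with decℓ (Lift ℓ (Σ[ n ∈ ℕ ] num n ≡ j))
    ... | yes (lift (n , _)) = s n
    ... | no _ = 0J

    onNum-num : ∀ s n → onNum s (num n) ≡ s n
    onNum-num s n with decℓ (Lift ℓ (Σ[ m ∈ ℕ ] num m ≡ num n))
    ... | yes (lift (m , e)) = cong s (num-injective e)
    ... | no k = ⊥-elim (k (lift (n , refl)))

  InS : J → Set ℓ
  InS x = el x ∈ᵛ S

  opaque
    -- Excludes finite cofinalities, so that a cofinal map from ω makes ω the exact cofinality of a
    -- limit.
    finite-bounded : ∀ {x} → LimJ x → ∀ n → n < ωJ → (F : J → J) → (∀ j → j < n → F j < x) →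
      Σ[ y ∈ J ] y < x × (∀ j → j < n → F j < y)
    finite-bounded {x} lim = <-induction Bounded λ n ih l → cases n ih l (zero-or-suc n (n<ω⇒¬limit l))
      where
      Bounded : J → Set ℓ
      Bounded n = n < ωJ → (F : J → J) → (∀ j → j < n → F j < x) → Σ[ y ∈ J ] y < x × (∀ j → j < n → F j < y)
      max< : ∀ {a b} → a < x → b < x → Σ[ c ∈ J ] c < x × a ≤ c × b ≤ c
      max< {a} {b} p q with <⊎≥ a b
      ... | inj₁ r = b , q , inj₁ r , ≤-refl
      ... | inj₂ r = a , p , ≤-refl , r
      cases : ∀ n → (∀ m → m < n → Bounded m) → n < ωJ → n ≡ 0J ⊎ (Σ[ m ∈ J ] n ≡ sucJ m) →
        (F : J → J) → (∀ j → j < n → F j < x) → Σ[ y ∈ J ] y < x × (∀ j → j < n → F j < y)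
      cases _ ih l (inj₁ refl) F h = 0J , proj₁ lim , λ j k → ⊥-elim (≮0 k)
      cases _ ih l (inj₂ (m , refl)) F h
        with ih m (<suc m) (<-trans (<suc m) l) F (λ j q → h j (<-trans q (<suc m)))
      ... | y , yx , k with max< yx (h m (<suc m))
      ...   | z , zx , a , b = sucJ z , proj₂ lim z zx , λ j q → last j (<suc⇒≤ q)
        where
        last : ∀ j → j ≤ m → F j < sucJ z
        last j (inj₁ q) = <-trans (<-≤-trans (k j q) a) (<suc z)
        last j (inj₂ refl) = ≤⇒<suc b

  -- The decision is an argument, so that equations can be proved by cases on it whichever decision
  -- the caller supplies.
  ifBelow : ∀ {j a} {B : Set ℓ} → Dec (j < a) → (j < a → B) → B → B
  ifBelow (yes l) f _ = f l
  ifBelow (no _) _ b = b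

  ifBelow-yes : ∀ {j a} {B : Set ℓ} {x y : B} (d : Dec (j < a)) → j < a → ifBelow d (λ _ → x) y ≡ x
  ifBelow-yes (yes _) _ = refl
  ifBelow-yes (no n) l = ⊥-elim (n l)

  ifBelow-no : ∀ {j a} {B : Set ℓ} {f : j < a → B} {y : B} (d : Dec (j < a)) → ¬ (j < a) → ifBelow d f y ≡ y
  ifBelow-no (yes l) n = ⊥-elim (n l)
  ifBelow-no (no _) _ = refl

  CofJ : J → J → Set ℓ
  CofJ a b = Σ[ F ∈ (J → J) ] (∀ j → j < a → F j < b) × (∀ y → y < b → Σ[ j ∈ J ] j < a × y ≤ F j)

  <-irrelevant-ix : ∀ {j a} (l m : j < a) → proj₁ (lower-ix l) ≡ proj₁ (lower-ix m)
  <-irrelevant-ix {j} {a} l m = el-injective {el a} (≈-trans (proj₂ (lower-ix l)) (≈-sym (proj₂ (lower-ix m))))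

  opaque
    cofJ : ∀ {a b} → CofinalMap (el a) (el b) → CofJ a b
    cofJ {a} {b} (F , c) = F′ , below , cofinal
      where
      F″ : ∀ {j} → j < a → J
      F″ l = proj₁ (lift-ix {b} (F (proj₁ (lower-ix l))))
      F′ : J → J
      F′ j = ifBelow (decℓ (j < a)) F″ 0J
      F′-eq : ∀ {j} (l : j < a) → F′ j ≡ F″ l
      F′-eq {j} l with decℓ (j < a)
      ... | yes m = cong (λ i → proj₁ (lift-ix {b} (F i))) (<-irrelevant-ix m l)
      ... | no n = ⊥-elim (n l)
      below : ∀ j → j < a → F′ j < b
      below j l = subst (_< b) (sym (F′-eq l)) (proj₂ (proj₂ (lift-ix {b} (F (proj₁ (lower-ix l))))))
      cofinal : ∀ y → y < b → Σ[ j ∈ J ] j < a × y ≤ F′ j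
      cofinal y l = let β , e = lower-ix l ; i , k = c β ; j , e′ , m = lift-ix {a} i in
        j , m , subst (y ≤_) (sym (F′-eq m)) (≤ᵛ⇒≤ (≤ᵛ-resp e (≈-trans
          (subst (λ i′ → el (F i) ≈ᵛ el (F i′)) (el-injective {el a} (≈-trans (≈-sym e′) (≈-sym (proj₂ (lower-ix m))))) ≈-refl)
          (≈-sym (proj₁ (proj₂ (lift-ix {b} (F (proj₁ (lower-ix m)))))))) k))

  cofJ⁻¹ : ∀ {a b} → CofJ a b → CofinalMap (el a) (el b)
  cofJ⁻¹ {a} {b} (F , h , c) =
    (λ i → let j , e , l = lift-ix {a} i in proj₁ (lower-ix (h j l))) ,
    λ β → let y , e , l = lift-ix {b} β ; j , m , k = c y l ; i , e′ = lower-ix m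
              j′ , e″ , l′ = lift-ix {a} i in
      i , ≤ᵛ-resp e (≈-trans (el-cong (cong F (el≈⇒≡ (≈-trans (≈-sym e′) (≈-sym e″))))) (≈-sym (proj₂ (lower-ix (h j′ l′))))) (≤⇒≤ᵛ k)

  ⊥-lift : ∀ {a} → ⊥ → Lift a ⊥
  ⊥-lift ()

  limit-isCof : ∀ {x} → LimJ x → CofJ ωJ x → G.IsCof (el ωJ) (el x)
  limit-isCof {x} lim c = ordinal⁻¹ (el-ord x) , ordinal⁻¹ (el-ord ωJ) , cofinalMap⁻¹ (cofJ⁻¹ c) ,
      λ n l h → ⊥-lift (no-finite n (lower l) (cofinalMap h))
    where
    no-finite : ∀ n → n ∈ᵛ el ωJ → ¬ CofinalMap n (el x)
    no-finite n l h =
      let i , e = idx l ; m , e′ , l′ = lift-ix {ωJ} i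
          F , b , c = cofJ (CofinalMap-resp (≈-sym (≈-trans e′ e)) ≈-refl h)
          y , yx , k = finite-bounded lim m l′ F b
          j , jm , p = c y yx
      in ≤⇒≯ p (k j jm)

  InS⇐ : ∀ {x} → LimJ x → CofJ ωJ x → InS x
  InS⇐ {x} lim c = lower (proj₂ (isSω (el x)) (lift (el∈ x) , limit⇒ lim , el ωJ , el-ωJ-isOmega , limit-isCof lim c))
    where
    el-ωJ-isOmega : G.IsOmega (el ωJ)
    el-ωJ-isOmega = limit⇒ ω-limit , λ n l h → proj₂ ω-isOmega n (lift (∈ᵛ-respʳ ωJ≈ω (lower l))) h

  S⊆Λ : ∀ {y} → y ∈ᵛ S → Σ[ x ∈ J ] el x ≈ᵛ y × InS x
  S⊆Λ {y} l = let x , e = idxΛ (lower (proj₁ (proj₁ (isSω y) (lift l)))) in x , e , ∈ᵛ-respˡ (≈-sym e) l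

  InS⇒ : ∀ {x} → InS x → LimJ x × CofJ ωJ x
  InS⇒ {x} l = let _ , lim , w , ow , (_ , _ , h , _) = proj₁ (isSω (el x)) (lift l) in
    ⇒limit lim , cofJ (CofinalMap-resp (omega-unique ow) ≈-refl (cofinalMap h))
    where
    omega-unique : ∀ {w} → G.IsOmega w → w ≈ᵛ el ωJ
    omega-unique {w} ow with trichotomy (ordinal (proj₁ (proj₁ ow))) (el-ord ωJ)
    ... | inj₁ l = ⊥-elim (lower (proj₂ ω-isOmega w (lift (∈ᵛ-respʳ ωJ≈ω l)) (proj₁ ow)))
    ... | inj₂ (inj₁ e) = e
    ... | inj₂ (inj₂ l) = ⊥-elim (lower (proj₂ ow (el ωJ) (lift l) (limit⇒ ω-limit)))

  -- The source of points of S: suprema of strictly increasing sequences of lengths.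
  ω-sup-InS : (s : ℕ → J) → (∀ n → s n < s (sucℕ n)) →
    (x : J) → (∀ n → s n < x) → (∀ y → y < x → Σ[ n ∈ ℕ ] y ≤ s n) → LimJ x × InS x
  ω-sup-InS s inc x h c = lim , InS⇐ lim (onNum s ,
      (λ j l → let n , e = <ω⇒num j l in subst (λ j → onNum s j < x) e (subst (_< x) (sym (onNum-num s n)) (h n))) ,
      λ y l → let n , k = c y l in num n , num<ω n , subst (y ≤_) (sym (onNum-num s n)) k)
    where
    lim : LimJ x
    lim = ≤-<-trans (0≤ (s 0)) (h 0) , λ y l → let n , k = c y l in
      ≤-<-trans (suc≤ (≤-<-trans k (inc n))) (h (sucℕ n))

  -- Coding of the short sequences by ordinals

  private
    X χ : V ℓ
    X = proj₁ weakPower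
    χ = proj₁ (proj₂ (proj₂ weakPower))
    X-spec : ∀ f → (f G.∈̇ X) G.⇔̇ (G.exIn Λ λ α → G.Function f α Λ)
    X-spec = proj₁ (proj₂ weakPower)
    g-bij : G.Bijective χ X Λ
    g-bij = proj₂ (proj₂ (proj₂ weakPower))

    src : ∀ x → Σ[ f ∈ V ℓ ] χ G.maps f to el {Λ} x × (Σ[ α ∈ J ] Σ[ a ∈ V ℓ ] el α ≈ᵛ a × G.Function f a Λ)
    src x = let f , m = proj₂ (proj₂ g-bij) (el x) (lift (el∈ x))
                a , l , h = proj₁ (X-spec f) (lift (dom (proj₁ (proj₁ g-bij)) m))
                α , e = idxΛ (lower l) in f , m , α , a , e , h

  private
   Value : J → J → J → Set (suc ℓ)
   Value x β y = proj₁ (src x) G.maps el β to el y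

   valueAt : ∀ x β → Dec (Σ[ y ∈ J ] Value x β y) → J
   valueAt x β (yes (y , _)) = y
   valueAt x β (no _) = 0J

  opaque
    length : J → J
    length x = proj₁ (proj₂ (proj₂ (src x)))

    entry : J → J → J
    entry x β = valueAt x β (dec _)

    -- Here λ^{<λ} = λ is used: the bijection with λ assigns to every function from δ to λ an
    -- ordinal that decodes to it. This is what allows conditions to be ordinals.
    encode : ∀ δ (F : J → J) → Σ[ x ∈ J ] length x ≡ δ × (∀ β → β < δ → entry x β ≡ F β)
    encode δ F = x , lengths , entries
      where
      f : V ℓ
      f = graph {el δ} λ i → el (F (proj₁ (lift-ix {δ} i)))
      f-fun : G.Function f (el δ) Λ
      f-fun = graph-functionOn _ , λ u y m → let i , _ , e = graph-maps⁻¹ {el δ} m in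
        lift (∈ᵛ-respˡ (≈-sym e) (el∈ (F (proj₁ (lift-ix {δ} i)))))
      f∈X : f ∈ᵛ X
      f∈X = lower (proj₂ (X-spec f) (el δ , lift (el∈ δ) , f-fun))
      gf : Σ[ j ∈ Ix Λ ] χ G.maps f to el j
      gf = let i , e = idx f∈X ; j , m = value (proj₁ g-bij) i in j , maps-cong e ≈-refl m
      x : J
      x = proj₁ gf
      f≈ : proj₁ (src x) ≈ᵛ f
      f≈ = lower (proj₁ (proj₂ g-bij) _ _ _ (proj₁ (proj₂ (src x))) (proj₂ gf))
      a≈ : el (length x) ≈ᵛ proj₁ (proj₂ (proj₂ (proj₂ (src x))))
      a≈ = proj₁ (proj₂ (proj₂ (proj₂ (proj₂ (src x)))))
      fun : G.Function (proj₁ (src x)) (proj₁ (proj₂ (proj₂ (proj₂ (src x))))) Λ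
      fun = proj₂ (proj₂ (proj₂ (proj₂ (proj₂ (src x)))))
      maps-f : ∀ {h h′ u v} → h ≈ᵛ h′ → h G.maps u to v → h′ G.maps u to v
      maps-f e (z , l , p) = z , lift (∈ᵛ-respʳ e (lower l)) , p
      lengths : length x ≡ δ
      lengths = el≈⇒≡ (≈-trans a≈ (ext
        (λ z l → let i , e = idx l ; j , m = value fun i in
          ∈ᵛ-respˡ e (dom (proj₁ f-fun) (maps-f f≈ m)))
        λ z l → let i , e = idx l ; j , m = value f-fun i in
          ∈ᵛ-respˡ e (dom (proj₁ fun) (maps-f (≈-sym f≈) m))))
      f-value : ∀ {β} → β < δ → f G.maps el β to el (F β)
      f-value {β} l = let i , e = lower-ix l ; k , e′ , _ = lift-ix {δ} i in
        maps-cong e (el-cong (cong F (el≈⇒≡ (≈-trans e′ e)))) (graph-maps _ i)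
      entries : ∀ β → β < δ → entry x β ≡ F β
      entries β l = go (dec _)
        where
        v : Value x β (F β)
        v = maps-f (≈-sym f≈) (f-value l)
        go : (d : Dec (Σ[ y ∈ J ] Value x β y)) → valueAt x β d ≡ F β
        go (yes (y , m)) = el≈⇒≡ (lower (proj₂ (proj₂ (proj₁ fun)) _ _ _ m v))
        go (no n) = ⊥-elim (n (F β , v))

  fst snd : J → J
  fst x = entry x 0J
  snd x = entry x (sucJ 0J)

  opaque
    pair : ∀ a b → Σ[ x ∈ J ] fst x ≡ a × snd x ≡ b
    pair a b = let x , _ , e = encode (sucJ (sucJ 0J)) F in
        x , trans (e 0J (<-trans (<suc _) (<suc _))) F0 , trans (e (sucJ 0J) (<suc _)) F1
      where
      F : J → J
      F j = ifBelow (decℓ (j < sucJ 0J)) (λ _ → a) b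
      F0 : F 0J ≡ a
      F0 = ifBelow-yes (decℓ _) (<suc _)
      F1 : F (sucJ 0J) ≡ b
      F1 = ifBelow-no (decℓ _) <-irrefl

  firsts seconds : J → J → J
  firsts x β = fst (entry x β)
  seconds x β = snd (entry x β)

  encode₂ : ∀ δ (F F′ : J → J) → Σ[ x ∈ J ] length x ≡ δ ×
    (∀ β → β < δ → firsts x β ≡ F β) × (∀ β → β < δ → seconds x β ≡ F′ β)
  encode₂ δ F F′ = let x , l , e = encode δ (λ β → proj₁ (pair (F β) (F′ β))) in x , l ,
    (λ β k → trans (cong fst (e β k)) (proj₁ (proj₂ (pair (F β) (F′ β))))) ,
    (λ β k → trans (cong snd (e β k)) (proj₂ (proj₂ (pair (F β) (F′ β)))))

  -- The cardinal κ

  κJ : J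
  κJ = proj₁ (idxΛ κ∈Λ)

  κJ≈κ : el κJ ≈ᵛ κ
  κJ≈κ = proj₂ (idxΛ κ∈Λ)

  1J : J
  1J = sucJ 0J

  isOne : ∀ {o} → G.IsOne o → o ≈ᵛ el 1J
  isOne {o} h = ext
    (λ z l → ∈ᵛ-respˡ (≈-sym (empty≈ z (proj₁ (h z) (lift l)))) (un< (<suc 0J)))
    λ z l → lower (proj₂ (h z) λ y m → let i , e = idx l ; k , e′ , k<1 = lift-ix {1J} i in
      ⊥-lift (no-member (subst (λ j → z ≈ᵛ el j) (k≡0 (<suc⇒≤ k<1)) (≈-sym (≈-trans e′ e))) (lower m)))
    where
    no-member : ∀ {z y} → z ≈ᵛ el 0J → ¬ (y ∈ᵛ z)
    no-member e m = let i , _ = idx (∈ᵛ-respʳ e m) in ≮0 (proj₂ (proj₂ (lift-ix {0J} i)))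
    empty≈ : ∀ z → G.Empty z → z ≈ᵛ el 0J
    empty≈ z n = ext (λ y l → ⊥-elim (lower (n y (lift l)))) λ y l → ⊥-elim (no-member ≈-refl l)
    k≡0 : ∀ {k} → k ≤ 0J → k ≡ 0J
    k≡0 (inj₁ l) = ⊥-elim (≮0 l)
    k≡0 (inj₂ e) = e

  1<κJ : 1J < κJ
  1<κJ = lt (∈ᵛ-respˡ (isOne (proj₁ (proj₂ 1<κ))) (∈ᵛ-respʳ (≈-sym κJ≈κ) (lower (proj₂ (proj₂ 1<κ)))))

  -- The Cantor–Bernstein bijection of κ with j₀ is the identity off the forward orbits of κ ∖ j₀.
  private
   module CantorBernstein {j₀} (j₀<κ : j₀ < κJ) (F : J → J) (F<j₀ : ∀ ξ → ξ < κJ → F ξ < j₀)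
      (n : ¬ (Σ[ ξ ∈ J ] Σ[ ξ′ ∈ J ] ξ < ξ′ × ξ′ < κJ × F ξ ≡ F ξ′)) where
    inj : ∀ {x y} → x < κJ → y < κJ → F x ≡ F y → x ≡ y
    inj {x} {y} p q e with cmp x y
    ... | inj₁ l = ⊥-elim (n (x , y , l , q , e))
    ... | inj₂ (inj₁ e′) = e′
    ... | inj₂ (inj₂ l) = ⊥-elim (n (y , x , l , p , sym e))
    data Orbit : J → Set ℓ where
      start : ∀ {x} → j₀ ≤ x → x < κJ → Orbit x
      step  : ∀ {x} → Orbit x → Orbit (F x)
    orbit<κ : ∀ {x} → Orbit x → x < κJ
    orbit<κ (start _ l) = l
    orbit<κ (step o) = <-trans (F<j₀ _ (orbit<κ o)) j₀<κ
    orbit⁻¹ : ∀ {y} → Orbit y → y < j₀ → Σ[ x ∈ J ] Orbit x × F x ≡ y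
    orbit⁻¹ (start l _) m = ⊥-elim (≤⇒≯ l m)
    orbit⁻¹ (step {x} o) m = x , o , refl
    C : J → J → Set ℓ
    C x y = (Orbit x × F x ≡ y) ⊎ (¬ Orbit x × x ≡ y)
    target : ∀ y → y < j₀ → Σ[ x ∈ J ] x < κJ × C x y
    target y l with decℓ (Orbit y)
    ... | yes o = let x , o′ , e = orbit⁻¹ o l in x , orbit<κ o′ , inj₁ (o′ , e)
    ... | no ¬o = y , <-trans l j₀<κ , inj₂ (¬o , refl)
    C-functional : ∀ {x y y′} → C x y → C x y′ → y ≡ y′
    C-functional (inj₁ (_ , e)) (inj₁ (_ , e′)) = trans (sym e) e′
    C-functional (inj₁ (o , _)) (inj₂ (¬o , _)) = ⊥-elim (¬o o)
    C-functional (inj₂ (¬o , _)) (inj₁ (o , _)) = ⊥-elim (¬o o)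
    C-functional (inj₂ (_ , e)) (inj₂ (_ , e′)) = trans (sym e) e′
    C-total : ∀ x → x < κJ → Σ[ y ∈ J ] y < j₀ × C x y
    C-total x l with decℓ (Orbit x)
    ... | yes o = F x , F<j₀ x l , inj₁ (o , refl)
    ... | no ¬o with <⊎≥ x j₀
    ...   | inj₁ m = x , m , inj₂ (¬o , refl)
    ...   | inj₂ m = ⊥-elim (¬o (start m l))
    C-injective : ∀ {x x′ y} → x < κJ → x′ < κJ → C x y → C x′ y → x ≡ x′
    C-injective l l′ (inj₁ (_ , e)) (inj₁ (_ , e′)) = inj l l′ (trans e (sym e′))
    C-injective l l′ (inj₁ (o , refl)) (inj₂ (¬o , refl)) = ⊥-elim (¬o (step o))
    C-injective l l′ (inj₂ (¬o , refl)) (inj₁ (o , refl)) = ⊥-elim (¬o (step o))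
    C-injective l l′ (inj₂ (_ , e)) (inj₂ (_ , e′)) = trans e (sym e′)
    H : Ix (el j₀) → Ix (el κJ)
    H i = let y , _ , l = lift-ix {j₀} i in proj₁ (lower-ix (proj₁ (proj₂ (target y l))))
    HJ : ∀ i → let y , _ , l = lift-ix {j₀} i in el (H i) ≈ᵛ el (proj₁ (target y l))
    HJ i = let y , _ , l = lift-ix {j₀} i in proj₂ (lower-ix (proj₁ (proj₂ (target y l))))
    equi : G.Equinumerous (el j₀) (el κJ)
    equi = equinumerous H
      (λ i i′ e → let y , ey , l = lift-ix {j₀} i ; y′ , ey′ , l′ = lift-ix {j₀} i′
                      x , k , c = target y l ; x′ , k′ , c′ = target y′ l′
                      xx = el≈⇒≡ (≈-trans (≈-sym (HJ i)) (≈-trans (el-cong e) (HJ i′))) in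
        el-injective {el j₀} (≈-trans (≈-sym ey) (≈-trans (el-cong (C-functional (subst (λ z → C z y) xx c) c′)) ey′)))
      λ i → let x , ex , l = lift-ix {κJ} i ; y , m , c = C-total x l ; j , e = lower-ix m
                y′ , ey′ , l′ = lift-ix {j₀} j ; x′ , k′ , c′ = target y′ l′
                yy = el≈⇒≡ (≈-trans ey′ e) in
        j , el-injective {el κJ} (≈-trans (HJ j) (≈-trans (el-cong (C-injective k′ l (subst (C x′) yy c′) c)) ex))
    contra : ⊥
    contra = lower (proj₂ (subst-cardinal) (el j₀) (lift (un< j₀<κ)) equi)
      where
      subst-cardinal : G.Ordinal (el κJ) × (∀ β → Lift (suc ℓ) (β ∈ᵛ el κJ) → G.Equinumerous β (el κJ) → Lift (suc ℓ) ⊥)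
      subst-cardinal = ordinal⁻¹ (el-ord κJ) , λ β l (f , (f-on , f-into) , f-inj , f-surj) →
        proj₂ cardinal-κ β (lift (∈ᵛ-respʳ κJ≈κ (lower l)))
          (f , (f-on , λ x y m → lift (∈ᵛ-respʳ κJ≈κ (lower (f-into x y m)))) , f-inj ,
            λ y k → f-surj y (lift (∈ᵛ-respʳ (≈-sym κJ≈κ) (lower k))))

  opaque
    -- An injection of κ into j₀ would give a bijection of j₀ with κ, against κ being a cardinal.
    -- The argument covers finite κ as well.
    pigeonhole : ∀ {j₀} → j₀ < κJ → (F : J → J) → (∀ ξ → ξ < κJ → F ξ < j₀) →
      Σ[ ξ ∈ J ] Σ[ ξ′ ∈ J ] ξ < ξ′ × ξ′ < κJ × F ξ ≡ F ξ′
    pigeonhole l F h = by-contradictionℓ (CantorBernstein.contra l F h)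

  -- Uncountable cofinality, phrased without naming the cofinality.
  Uncountable : J → Set ℓ
  Uncountable g = ∀ a → a ≤ ωJ → ¬ CofinalMap (el a) (el g)

  uncountable-limit : ∀ {g} → Uncountable g → LimJ g
  uncountable-limit {g} u = by-contradictionℓ λ n → [
    (λ { refl → u 0J (0≤ _) (cofJ⁻¹ ((λ j → j) , (λ j l → l) , λ y l → y , l , ≤-refl)) }) ,
    (λ { (y , refl) → u 1J (inj₁ (num<ω 1)) (cofJ⁻¹ ((λ _ → y) , (λ _ _ → <suc y) , λ z l → 0J , <suc 0J , <suc⇒≤ l)) }) ]′
    (zero-or-suc g n)

  -- The forcing relation of an arbitrary forcing notion

  module Semantics (P : ForcingNotion ℓ) where
    open ForcingNotion P public using (Carrier; _≲_; 𝟙; 𝟙-maximum) renaming (refl to ≲-refl; trans to ≲-trans)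
    module E = Language (extension P)

    Dense : ∀ {b} → Carrier → (Carrier → Set b) → Set (ℓ ⊔ b)
    Dense = DenseBelow P

    infix 4 _⊩_≐_ _⊩_∈_
    -- Wrapped in records so that the names can be inferred.
    record _⊩_≐_ (p : Carrier) (σ τ : Name P) : Set ℓ where
      constructor eq
      field un-eq : ForcesEq P σ τ p
    record _⊩_∈_ (p : Carrier) (σ τ : Name P) : Set ℓ where
      constructor mem
      field un-mem : ForcesIn P σ τ p
    open _⊩_≐_ public
    open _⊩_∈_ public

    ⌜_⌝ : V ℓ → Name P
    ⌜_⌝ = check P

    dense : ∀ {a b} {p} {A : Carrier → Set a} {B : Carrier → Set b} →
      Dense p A → (∀ r → r ≲ p → A r → Dense r B) → Dense p B
    dense d f q l = let r , m , a = d q l ; s , n , b = f r (≲-trans m l) a r ≲-refl in s , ≲-trans n m , b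

    dense-map : ∀ {a b} {p} {A : Carrier → Set a} {B : Carrier → Set b} →
      Dense p A → (∀ r → r ≲ p → A r → B r) → Dense p B
    dense-map d f q l = let r , m , a = d q l in r , m , f r (≲-trans m l) a

    dense-mono : ∀ {a} {p q} {A : Carrier → Set a} → q ≲ p → Dense p A → Dense q A
    dense-mono m d r l = d r (≲-trans l m)

    now : ∀ {a} {p} {A : Carrier → Set a} → (∀ q → q ≲ p → A q) → Dense p A
    now f q l = q , ≲-refl , f q l

    ≐-mono : ∀ {σ τ p q} → q ≲ p → p ⊩ σ ≐ τ → q ⊩ σ ≐ τ
    ≐-mono {sup _ _ _} {sup _ _ _} l (eq (f , g)) =
      eq ((λ a r m → f a r (≲-trans m l)) , (λ b r m → g b r (≲-trans m l)))

    private
      refl′ : ∀ σ p → ForcesEq P σ σ p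
      refl′ (sup A σ s) p =
        (λ a q _ m → λ r l → r , ≲-refl , a , ≲-trans l m , refl′ (σ a) r) ,
        (λ a q _ m → λ r l → r , ≲-refl , a , ≲-trans l m , refl′ (σ a) r)

      sym′ : ∀ σ τ p → ForcesEq P σ τ p → ForcesEq P τ σ p
      sym′ (sup A σ s) (sup B τ t) p (f , g) =
        (λ b q l m r n → let u , k , a , h , e = g b q l m r n in u , k , a , h , sym′ (σ a) (τ b) u e) ,
        (λ a q l m r n → let u , k , b , h , e = f a q l m r n in u , k , b , h , sym′ (σ a) (τ b) u e)

      trans′ : ∀ σ τ υ p → ForcesEq P σ τ p → ForcesEq P τ υ p → ForcesEq P σ υ p
      trans′ (sup A σ s) (sup B τ t) (sup C υ u) p (f , g) (f′ , g′) =
        (λ a q l m r n → let r₁ , k₁ , b , h₁ , e₁ = f a q l m r n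
                             r₂ , k₂ , c , h₂ , e₂ = f′ b r₁ (≲-trans k₁ (≲-trans n l)) h₁ r₁ ≲-refl in
          r₂ , ≲-trans k₂ k₁ , c , h₂ , trans′ (σ a) (τ b) (υ c) r₂ (un-eq (≐-mono k₂ (eq e₁))) e₂) ,
        (λ c q l m r n → let r₁ , k₁ , b , h₁ , e₁ = g′ c q l m r n
                             r₂ , k₂ , a , h₂ , e₂ = g b r₁ (≲-trans k₁ (≲-trans n l)) h₁ r₁ ≲-refl in
          r₂ , ≲-trans k₂ k₁ , a , h₂ , trans′ (σ a) (τ b) (υ c) r₂ e₂ (un-eq (≐-mono k₂ (eq e₁))))

    ≐-refl : ∀ {σ p} → p ⊩ σ ≐ σ
    ≐-refl {σ} {p} = eq (refl′ σ p)

    ≐-sym : ∀ {σ τ p} → p ⊩ σ ≐ τ → p ⊩ τ ≐ σ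
    ≐-sym {σ} {τ} {p} (eq e) = eq (sym′ σ τ p e)

    ≐-trans : ∀ {σ τ υ p} → p ⊩ σ ≐ τ → p ⊩ τ ≐ υ → p ⊩ σ ≐ υ
    ≐-trans {σ} {τ} {υ} {p} (eq e) (eq e′) = eq (trans′ σ τ υ p e e′)

    ≐-local : ∀ {σ τ p} → Dense p (λ q → q ⊩ σ ≐ τ) → p ⊩ σ ≐ τ
    ≐-local {sup _ _ _} {sup _ _ _} d = eq
      ( (λ a q l m r n → let u , k , eq (f , _) = d r (≲-trans n l)
                             v , k′ , h = f a u ≲-refl (≲-trans k (≲-trans n m)) u ≲-refl in v , ≲-trans k′ k , h)
      , (λ a q l m r n → let u , k , eq (_ , g) = d r (≲-trans n l)
                             v , k′ , h = g a u ≲-refl (≲-trans k (≲-trans n m)) u ≲-refl in v , ≲-trans k′ k , h))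

    ∈-mono : ∀ {σ τ p q} → q ≲ p → p ⊩ σ ∈ τ → q ⊩ σ ∈ τ
    ∈-mono {τ = sup _ _ _} l (mem d) = mem λ r m → d r (≲-trans m l)

    ∈-local : ∀ {σ τ p} → Dense p (λ q → q ⊩ σ ∈ τ) → p ⊩ σ ∈ τ
    ∈-local {τ = sup _ _ _} d = mem (dense d λ { r _ (mem h) → h })

    ∈-respˡ : ∀ {σ σ′ τ p} → p ⊩ σ ≐ σ′ → p ⊩ σ ∈ τ → p ⊩ σ′ ∈ τ
    ∈-respˡ {τ = sup _ _ _} e (mem d) = mem (dense-map d λ { r l (b , m , e′) →
      b , m , un-eq (≐-trans (≐-sym (≐-mono l e)) (eq e′)) })

    ∈-respʳ : ∀ {σ τ τ′ p} → p ⊩ τ ≐ τ′ → p ⊩ σ ∈ τ → p ⊩ σ ∈ τ′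
    ∈-respʳ {τ = sup _ _ _} {sup _ _ _} (eq (f , _)) (mem d) = mem (dense d λ { r l (b , m , e) →
      dense-map (f b r l m) λ { s k (c , n , e′) → c , n , un-eq (≐-trans (≐-mono k (eq e)) (eq e′)) } })

    member : ∀ {A σ s} a {p} → p ≲ s a → p ⊩ σ a ∈ sup A σ s
    member a l = mem λ q m → q , ≲-refl , a , ≲-trans m l , un-eq ≐-refl

    member⁻¹ : ∀ {A σ s x p} → p ⊩ x ∈ sup A σ s → Dense p (λ q → Σ[ a ∈ A ] q ≲ s a × q ⊩ x ≐ σ a)
    member⁻¹ (mem d) = dense-map d λ { r l (a , m , e) → a , m , eq e }

    extensionality : ∀ {σ τ p} → (∀ x q → q ≲ p → q ⊩ x ∈ σ → q ⊩ x ∈ τ) →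
      (∀ x q → q ≲ p → q ⊩ x ∈ τ → q ⊩ x ∈ σ) → p ⊩ σ ≐ τ
    extensionality {sup A σ s} {sup B τ t} f g = eq
      ((λ a q l m → un-mem (f (σ a) q l (member a m))) ,
       (λ b q l m → dense-map (un-mem (g (τ b) q l (member b m))) λ { r k (a , n , e) →
         a , n , un-eq (≐-sym (eq e)) }))

    ⌜⌝-≈ : ∀ {x y} → x ≈ᵛ y → ∀ {p} → p ⊩ ⌜ x ⌝ ≐ ⌜ y ⌝
    ⌜⌝-≈ {sup A f} {sup B g} (h , k) = eq
      ( (λ a q _ _ r _ → let b , e = h a in r , ≲-refl , b , 𝟙-maximum r , un-eq (⌜⌝-≈ {f a} {g b} e))
      , (λ b q _ _ r _ → let a , e = k b in r , ≲-refl , a , 𝟙-maximum r , un-eq (⌜⌝-≈ {f a} {g b} e)))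

    ⌜⌝-∈ : ∀ {x y} → x ∈ᵛ y → ∀ {p} → p ⊩ ⌜ x ⌝ ∈ ⌜ y ⌝
    ⌜⌝-∈ {y = sup B g} (b , e) {p} = ∈-respˡ (≐-sym (⌜⌝-≈ e)) (member b (𝟙-maximum p))

    ⌜⌝-≈⁻¹ : ∀ {x y p} → p ⊩ ⌜ x ⌝ ≐ ⌜ y ⌝ → x ≈ᵛ y
    ⌜⌝-≈⁻¹ {sup A f} {sup B g} {p} (eq (h , k)) =
      (λ a → let r , _ , b , _ , e = h a p ≲-refl (𝟙-maximum p) p ≲-refl in b , ⌜⌝-≈⁻¹ {f a} {g b} (eq e)) ,
      (λ b → let r , _ , a , _ , e = k b p ≲-refl (𝟙-maximum p) p ≲-refl in a , ⌜⌝-≈⁻¹ {f a} {g b} (eq e))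

    ∈-⌜⌝ : ∀ {σ y p} → p ⊩ σ ∈ ⌜ y ⌝ → Dense p (λ q → Σ[ x ∈ V ℓ ] x ∈ᵛ y × q ⊩ σ ≐ ⌜ x ⌝)
    ∈-⌜⌝ {y = sup B g} h = dense-map (member⁻¹ h) λ { r l (b , _ , e) → g b , (b , ≈ᵛ-refl (g b)) , e }

    ⌜⌝-∈⁻¹ : ∀ {x y p} → p ⊩ ⌜ x ⌝ ∈ ⌜ y ⌝ → x ∈ᵛ y
    ⌜⌝-∈⁻¹ {x} {sup B g} {p} h = let r , _ , b , _ , e = member⁻¹ h p ≲-refl in b , ⌜⌝-≈⁻¹ e

    -- Kuratowski pairs

    opaque
      upair opair : Name P → Name P → Name P
      upair x y = sup (Lift ℓ Bool) (λ { (lift false) → x ; (lift true) → y }) (λ _ → 𝟙)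
      opair x y = upair (upair x x) (upair x y)

      ∈-upair : ∀ {u x y p} → p ⊩ u ∈ upair x y → Dense p (λ q → q ⊩ u ≐ x ⊎ q ⊩ u ≐ y)
      ∈-upair h = dense-map (member⁻¹ h) λ { _ _ (lift false , _ , e) → inj₁ e ; _ _ (lift true , _ , e) → inj₂ e }

      upairˡ : ∀ {u x y p} → p ⊩ u ≐ x → p ⊩ u ∈ upair x y
      upairˡ e = ∈-respˡ (≐-sym e) (member (lift false) (𝟙-maximum _))

      upairʳ : ∀ {u x y p} → p ⊩ u ≐ y → p ⊩ u ∈ upair x y
      upairʳ e = ∈-respˡ (≐-sym e) (member (lift true) (𝟙-maximum _))

      upair-cong : ∀ {x y x′ y′ p} → p ⊩ x ≐ x′ → p ⊩ y ≐ y′ → p ⊩ upair x y ≐ upair x′ y′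
      upair-cong {x} {y} {x′} {y′} {p} e e′ = extensionality (half e e′) (half (≐-sym e) (≐-sym e′))
        where
        half : ∀ {x y x′ y′} → p ⊩ x ≐ x′ → p ⊩ y ≐ y′ →
          ∀ u q → q ≲ p → q ⊩ u ∈ upair x y → q ⊩ u ∈ upair x′ y′
        half e e′ u q l h = ∈-local (dense-map (∈-upair h) λ
          { r m (inj₁ k) → upairˡ (≐-trans k (≐-mono (≲-trans m l) e))
          ; r m (inj₂ k) → upairʳ (≐-trans k (≐-mono (≲-trans m l) e′)) })

      opair-cong : ∀ {x y x′ y′ p} → p ⊩ x ≐ x′ → p ⊩ y ≐ y′ → p ⊩ opair x y ≐ opair x′ y′
      opair-cong e e′ = upair-cong (upair-cong e e) (upair-cong e e′)

      ∈-singleton : ∀ {u x p} → p ⊩ u ∈ upair x x → p ⊩ u ≐ x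
      ∈-singleton h = ≐-local (dense-map (∈-upair h) λ { _ _ (inj₁ e) → e ; _ _ (inj₂ e) → e })

      singleton-injective : ∀ {x a b p} → p ⊩ upair x x ≐ upair a b → p ⊩ x ≐ a × p ⊩ x ≐ b
      singleton-injective e =
        ≐-sym (∈-singleton (∈-respʳ (≐-sym e) (upairˡ ≐-refl))) ,
        ≐-sym (∈-singleton (∈-respʳ (≐-sym e) (upairʳ ≐-refl)))

      opair-injectiveˡ : ∀ {x y x′ y′ p} → p ⊩ opair x y ≐ opair x′ y′ → p ⊩ x ≐ x′
      opair-injectiveˡ e = ≐-local (dense-map (∈-upair (∈-respʳ e (upairˡ ≐-refl))) λ
        { r l (inj₁ k) → proj₁ (singleton-injective k) ; r l (inj₂ k) → proj₁ (singleton-injective k) })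

      -- A condition need not decide which element of one pair is matched with which of the other.
      -- The usual case analysis is made on dense sets and the results are glued by `≐-local`.
      opair-injectiveʳ : ∀ {x y x′ y′ p} → p ⊩ opair x y ≐ opair x′ y′ → p ⊩ y ≐ y′
      opair-injectiveʳ {x} {y} {x′} {y′} {p} e = ≐-local (dense (∈-upair (∈-respʳ e (upairʳ ≐-refl))) λ
        { r l (inj₁ k) → dense-map (∈-upair (∈-respʳ (≐-sym (≐-mono l e)) (upairʳ ≐-refl))) λ
            { s m (inj₁ h) → ≐-trans (y≐x (≐-mono m k)) (proj₂ (singleton-injective (≐-sym h)))
            ; s m (inj₂ h) → ≐-trans (y≐x (≐-mono m k)) (≐-trans (≐-sym (y≐x (≐-mono m k)))
                (≐-sym (y′≐ h (≐-mono m k)))) }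
        ; r l (inj₂ k) → dense (∈-upair (∈-respʳ k (upairʳ ≐-refl))) λ
            { s m (inj₂ h) → now λ t n → ≐-mono n h
            ; s m (inj₁ h) → dense-map (∈-upair (∈-respʳ (≐-sym (≐-mono m k)) (upairʳ ≐-refl))) λ
                { t n (inj₂ h′) → ≐-sym h′
                ; t n (inj₁ h′) → ≐-trans (≐-mono n h) (≐-trans (≐-sym (≐-mono (≲-trans n (≲-trans m l)) x≐x′)) (≐-sym h′)) } } })
        where
        x≐x′ : p ⊩ x ≐ x′
        x≐x′ = opair-injectiveˡ e
        y≐x : ∀ {q} → q ⊩ upair x y ≐ upair x′ x′ → q ⊩ y ≐ x
        y≐x k = let x′≐x , x′≐y = singleton-injective (≐-sym k) in ≐-trans (≐-sym x′≐y) x′≐x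
        y′≐ : ∀ {q} → q ⊩ upair x′ y′ ≐ upair x y → q ⊩ upair x y ≐ upair x′ x′ → q ⊩ y′ ≐ y
        y′≐ h k = ≐-trans (∈-singleton (∈-respʳ k (∈-respʳ h (upairʳ ≐-refl)))) (proj₂ (singleton-injective (≐-sym k)))

      isUPair : ∀ {z x y p} → E.IsUnorderedPair z x y p → p ⊩ z ≐ upair x y
      isUPair {z} {x} {y} {p} h = extensionality
        (λ u q l k → ∈-local (dense-map (proj₁ (h u) q l (lift (un-mem k))) λ
          { r m (inj₁ e) → upairˡ (eq (lower e)) ; r m (inj₂ e) → upairʳ (eq (lower e)) }))
        λ u q l k → mem (lower (proj₂ (h u) q l (dense-map (∈-upair k) λ
          { r m (inj₁ (eq e)) → inj₁ (lift e) ; r m (inj₂ (eq e)) → inj₂ (lift e) })))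

      isUPair⁻¹ : ∀ {z x y p} → p ⊩ z ≐ upair x y → E.IsUnorderedPair z x y p
      isUPair⁻¹ {z} {x} {y} {p} e u =
        (λ q l k → dense-map (∈-upair (∈-respʳ (≐-mono l e) (mem (lower k)))) λ
          { r m (inj₁ (eq h)) → inj₁ (lift h) ; r m (inj₂ (eq h)) → inj₂ (lift h) }) ,
        λ q l k → lift (un-mem (∈-respʳ (≐-sym (≐-mono l e)) (∈-local (dense-map k λ
          { r m (inj₁ h) → upairˡ (eq (lower h)) ; r m (inj₂ h) → upairʳ (eq (lower h)) }))))

      isPair : ∀ {z x y p} → E.IsPair z x y p → p ⊩ z ≐ opair x y
      isPair h = ≐-local (dense h λ { q l (u , h′) → dense-map h′ λ { r m (v , a , b , c) →
        ≐-trans (isUPair c) (upair-cong (isUPair a) (isUPair b)) } })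

      isPair⁻¹ : ∀ {z x y p} → p ⊩ z ≐ opair x y → E.IsPair z x y p
      isPair⁻¹ {x = x} {y} e = now λ q l → upair x x , now λ r m → upair x y ,
        isUPair⁻¹ ≐-refl , isUPair⁻¹ ≐-refl , isUPair⁻¹ (≐-mono (≲-trans m l) e)

    maps⇒ : ∀ {f x y p} → (f E.maps x to y) p → p ⊩ opair x y ∈ f
    maps⇒ h = ∈-local (dense-map h λ { q l (z , k , e) → ∈-respˡ (isPair e) (mem (lower k)) })

    maps⇐ : ∀ {f x y p} → p ⊩ opair x y ∈ f → (f E.maps x to y) p
    maps⇐ {x = x} {y} h = now λ q l → opair x y , lift (un-mem (∈-mono l h)) , isPair⁻¹ ≐-refl

    record FunOn (f a : Name P) (p : Carrier) : Set (suc ℓ) where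
      constructor funOn
      field un-funOn : E.FunctionOn f a p
    open FunOn public

    functional : ∀ {f a x y y′ p} → FunOn f a p → p ⊩ opair x y ∈ f → p ⊩ opair x y′ ∈ f → p ⊩ y ≐ y′
    functional (funOn (_ , _ , u)) h k = eq (lower (u _ _ _ _ ≲-refl (maps⇐ h) _ ≲-refl (maps⇐ k)))

    functionOn-mono : ∀ {f a p q} → q ≲ p → FunOn f a p → FunOn f a q
    functionOn-mono l (funOn (h , k , u)) = funOn (
      (λ z r m → h z r (≲-trans m l)) , (λ z r m → k z r (≲-trans m l)) , λ x y y′ r m → u x y y′ r (≲-trans m l))

    functionOn-dom : ∀ {f a x y p} → FunOn f a p → p ⊩ opair x y ∈ f → p ⊩ x ∈ a
    functionOn-dom {f} {a} {x} {y} (funOn (h , _)) k = ∈-local (dense (h (opair x y) _ ≲-refl (lift (un-mem k))) λ { q l (x′ , k′ , d) →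
      dense-map d λ { r m (y′ , e) → ∈-respˡ (≐-sym (opair-injectiveˡ (isPair e))) (∈-mono m (mem (lower k′))) } })

    functionOn-total : ∀ {f a x p} → FunOn f a p → p ⊩ x ∈ a → Dense p (λ q → Σ[ y ∈ Name P ] q ⊩ opair x y ∈ f)
    functionOn-total {x = x} (funOn (_ , t , _)) k = dense-map (t x _ ≲-refl (lift (un-mem k))) λ { q l (y , h) → y , maps⇒ h }

    functionOn-elim : ∀ {f a z p} → FunOn f a p → p ⊩ z ∈ f →
      Dense p (λ r → Σ[ x ∈ Name P ] Σ[ y ∈ Name P ] r ⊩ x ∈ a × r ⊩ z ≐ opair x y)
    functionOn-elim {z = z} (funOn (h , _)) k = dense (h z _ ≲-refl (lift (un-mem k))) λ { r m (x , k′ , d) →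
      dense-map d λ { s n (y , p) → x , y , ∈-mono n (mem (lower k′)) , isPair p } }

    functionOn-intro : ∀ {f a p} →
      (∀ z q → q ≲ p → q ⊩ z ∈ f → Dense q (λ r → Σ[ x ∈ Name P ] Σ[ y ∈ Name P ] r ⊩ x ∈ a × r ⊩ z ≐ opair x y)) →
      (∀ x q → q ≲ p → q ⊩ x ∈ a → Dense q (λ r → Σ[ y ∈ Name P ] r ⊩ opair x y ∈ f)) →
      (∀ x y y′ q → q ≲ p → q ⊩ opair x y ∈ f → q ⊩ opair x y′ ∈ f → q ⊩ y ≐ y′) →
      FunOn f a p
    functionOn-intro h t u = funOn (
      (λ z q l k → dense-map (h z q l (mem (lower k))) λ { r m (x , y , k′ , e) →
        x , lift (un-mem k′) , now λ s n → y , isPair⁻¹ (≐-mono n e) }) ,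
      (λ x q l k → dense-map (t x q l (mem (lower k))) λ { r m (y , h) → y , maps⇐ h }) ,
      λ x y y′ q l k q′ l′ k′ → lift (un-eq (u x y y′ q′ (≲-trans l′ l) (∈-mono l′ (maps⇒ k)) (maps⇒ k′))))

    functionOn-resp : ∀ {f f′ a a′ p} → p ⊩ f ≐ f′ → p ⊩ a ≐ a′ → FunOn f a p → FunOn f′ a′ p
    functionOn-resp e e′ h = functionOn-intro
      (λ z q l k → dense-map (functionOn-elim (functionOn-mono l h) (∈-respʳ (≐-sym (≐-mono l e)) k)) λ { r m (x , y , k′ , d) →
        x , y , ∈-respʳ (≐-mono (≲-trans m l) e′) k′ , d })
      (λ x q l k → dense-map (functionOn-total (functionOn-mono l h) (∈-respʳ (≐-sym (≐-mono l e′)) k)) λ { r m (y , d) →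
        y , ∈-respʳ (≐-mono (≲-trans m l) e) d })
      λ x y y′ q l k k′ → functional (functionOn-mono l h)
        (∈-respʳ (≐-sym (≐-mono l e)) k) (∈-respʳ (≐-sym (≐-mono l e)) k′)

    record _⊩_≤̌_ (p : Carrier) (x y : Name P) : Set (suc ℓ) where
      constructor le
      field un-le : (x E.≤̇ y) p
    open _⊩_≤̌_ public
    infix 4 _⊩_≤̌_

    ≤-respʳ : ∀ {x y y′ p} → p ⊩ y ≐ y′ → p ⊩ x ≤̌ y → p ⊩ x ≤̌ y′
    ≤-respʳ e (le h) = le (dense-map h λ
      { r l (inj₁ k) → inj₁ (lift (un-mem (∈-respʳ (≐-mono l e) (mem (lower k)))))
      ; r l (inj₂ k) → inj₂ (lift (un-eq (≐-trans (eq (lower k)) (≐-mono l e)))) })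

    ≤-respˡ : ∀ {x x′ y p} → p ⊩ x ≐ x′ → p ⊩ x ≤̌ y → p ⊩ x′ ≤̌ y
    ≤-respˡ e (le h) = le (dense-map h λ
      { r l (inj₁ k) → inj₁ (lift (un-mem (∈-respˡ (≐-mono l e) (mem (lower k)))))
      ; r l (inj₂ k) → inj₂ (lift (un-eq (≐-trans (≐-sym (≐-mono l e)) (eq (lower k))))) })

    ≤-mono : ∀ {x y p q} → q ≲ p → p ⊩ x ≤̌ y → q ⊩ x ≤̌ y
    ≤-mono l (le h) = le (dense-mono l h)

    ord : J → Name P
    ord j = ⌜ el j ⌝

    ord-< : ∀ {i j p} → i < j → p ⊩ ord i ∈ ord j
    ord-< (lt l) = ⌜⌝-∈ l

    ord-<⁻¹ : ∀ {i j p} → p ⊩ ord i ∈ ord j → i < j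
    ord-<⁻¹ h = lt (⌜⌝-∈⁻¹ h)

    ord-≡ : ∀ {i j p} → p ⊩ ord i ≐ ord j → i ≡ j
    ord-≡ h = el≈⇒≡ (⌜⌝-≈⁻¹ h)

    ∈-ord : ∀ {x j p} → p ⊩ x ∈ ord j → Dense p (λ q → Σ[ i ∈ J ] i < j × q ⊩ x ≐ ord i)
    ∈-ord {j = j} h = dense-map (∈-⌜⌝ h) λ { q l (y , k , e) →
      let i , e₁ = idx k ; i′ , e₂ , m = lift-ix {j} i in i′ , m , ≐-trans e (⌜⌝-≈ (≈-sym (≈-trans e₂ e₁))) }

    ord∈Λ : ∀ {j p} → p ⊩ ord j ∈ ⌜ Λ ⌝
    ord∈Λ {j} = ⌜⌝-∈ (el∈ j)

    ∈-Λ : ∀ {x p} → p ⊩ x ∈ ⌜ Λ ⌝ → Dense p (λ q → Σ[ i ∈ J ] q ⊩ x ≐ ord i)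
    ∈-Λ h = dense-map (∈-⌜⌝ h) λ { q l (y , k , e) → let i , e₁ = idxΛ k in i , ≐-trans e (⌜⌝-≈ (≈-sym e₁)) }

    ⌜⌝-≤ : ∀ {x y p} → x ≤ᵛ y → p ⊩ ⌜ x ⌝ ≤̌ ⌜ y ⌝
    ⌜⌝-≤ (inj₁ l) = le (now λ q _ → inj₁ (lift (un-mem (⌜⌝-∈ l))))
    ⌜⌝-≤ (inj₂ e) = le (now λ q _ → inj₂ (lift (un-eq (⌜⌝-≈ e))))

    ⌜⌝-≤⁻¹ : ∀ {x y p} → p ⊩ ⌜ x ⌝ ≤̌ ⌜ y ⌝ → x ≤ᵛ y
    ⌜⌝-≤⁻¹ {p = p} (le h) with h p ≲-refl
    ... | _ , _ , inj₁ (lift l) = inj₁ (⌜⌝-∈⁻¹ (mem l))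
    ... | _ , _ , inj₂ (lift e) = inj₂ (⌜⌝-≈⁻¹ (eq e))

    ord-≤ : ∀ {i j p} → i ≤ j → p ⊩ ord i ≤̌ ord j
    ord-≤ l = ⌜⌝-≤ (≤⇒≤ᵛ l)

    ord-≤⁻¹ : ∀ {i j p} → p ⊩ ord i ≤̌ ord j → i ≤ j
    ord-≤⁻¹ h = ≤ᵛ⇒≤ (⌜⌝-≤⁻¹ h)

    transitive⌜⌝ : ∀ {x p} → Trans x → E.Transitive ⌜ x ⌝ p
    transitive⌜⌝ t y q l h z r m k = lift (un-mem (∈-local (dense (∈-⌜⌝ (∈-mono m (mem (lower h)))) λ { s n (y′ , l′ , e) →
      dense-map (∈-⌜⌝ (∈-respʳ e (∈-mono n (mem (lower k))))) λ { u o (z′ , m′ , e′) →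
        ∈-respˡ (≐-sym e′) (⌜⌝-∈ (t y′ l′ z′ m′)) } })))

    transitive-resp : ∀ {x y p} → p ⊩ x ≐ y → E.Transitive x p → E.Transitive y p
    transitive-resp e t u q l h z r m k = lift (un-mem (∈-respʳ (≐-mono (≲-trans m l) e)
      (mem (lower (t u q l (lift (un-mem (∈-respʳ (≐-sym (≐-mono l e)) (mem (lower h))))) z r m k)))))

    transitive-local : ∀ {x p} → Dense p (E.Transitive x) → E.Transitive x p
    transitive-local d y q l h z r m k = lift (un-mem (∈-local λ s n →
      let u , o , t = d s (≲-trans n (≲-trans m l))
      in u , o , mem (lower (t y u ≲-refl (lift (un-mem (∈-mono (≲-trans o (≲-trans n m)) (mem (lower h)))))
           z u ≲-refl (lift (un-mem (∈-mono (≲-trans o n) (mem (lower k)))))))))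

    ordinal⌜⌝ : ∀ {x p} → Ord x → E.Ordinal ⌜ x ⌝ p
    ordinal⌜⌝ {x} (t , u) = transitive⌜⌝ t , λ y q l h → transitive-local (dense-map (∈-⌜⌝ {y = x} (mem (lower h))) λ
      { r m (y′ , k , e) → transitive-resp (≐-sym e) (transitive⌜⌝ (u y′ k)) })

    ordinal-trans : ∀ {α x y p} → E.Ordinal α p → p ⊩ y ∈ α → p ⊩ x ∈ y → p ⊩ x ∈ α
    ordinal-trans (t , _) h k = mem (lower (t _ _ ≲-refl (lift (un-mem h)) _ _ ≲-refl (lift (un-mem k))))

    -- Limit ordinals and ω

    limit-ord : ∀ {x p} → LimJ x → E.Limit (ord x) p
    limit-ord {x} (pos , s) = ordinal⌜⌝ (el-ord x) , (λ q _ h → h (ord 0J) q ≲-refl (lift (un-mem (ord-< pos)))) ,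
      λ β q l h → dense-map (∈-ord (mem (lower h))) λ { r m (b , k , e) →
        ord (sucJ b) , lift (un-mem (ord-< (s b k))) , lift (un-mem (∈-respˡ (≐-sym e) (ord-< (<suc b)))) }

    limit-ord⁻¹ : ∀ {δ x p} → p ⊩ δ ≐ ord x → E.Limit δ p → LimJ x
    limit-ord⁻¹ {δ} {x} {p} e (_ , ne , s) = positive , λ y l →
      let q , m , γ , h , k = s (ord y) p ≲-refl (lift (un-mem (∈-respʳ (≐-sym e) (ord-< l)))) p ≲-refl
          r , n , g , o , e′ = ∈-ord (∈-respʳ (≐-mono m e) (mem (lower h))) q ≲-refl
      in ≤-<-trans (suc≤ (ord-<⁻¹ (∈-respʳ e′ (∈-mono n (mem (lower k)))))) o
      where
      positive : 0J < x
      positive with 0≤ x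
      ... | inj₁ l = l
      ... | inj₂ z = ⊥-elim (lower (ne p ≲-refl λ y q l h → ⊥-lift (
        let r , m , i , k , _ = ∈-ord (∈-respʳ (≐-mono l e) (mem (lower h))) q ≲-refl
        in ≮0 (subst (i <_) (sym z) k))))

    limit-mono : ∀ {δ p q} → q ≲ p → E.Limit δ p → E.Limit δ q
    limit-mono l ((t , u) , ne , s) =
      ((λ y r m → t y r (≲-trans m l)) , λ y r m → u y r (≲-trans m l)) ,
      (λ r m → ne r (≲-trans m l)) , λ β r m → s β r (≲-trans m l)

    limit-local : ∀ {δ p} → Dense p (E.Limit δ) → E.Limit δ p
    limit-local {δ} {p} d =
      ( transitive-local (λ q l → let r , m , (t , _) , _ = d q l in r , m , t)
      , λ y q l h → transitive-local λ r m → let s , n , (_ , u) , _ = d r (≲-trans m l) in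
          s , n , u y s ≲-refl (lift (un-mem (∈-mono (≲-trans n m) (mem (lower h))))))
      , (λ q l e → let r , m , _ , ne , _ = d q l in ne r ≲-refl λ y s n → e y s (≲-trans n m))
      , λ β q l h r m → let s , n , _ , _ , f = d r (≲-trans m l)
                            t , o , w = f β s ≲-refl (lift (un-mem (∈-mono (≲-trans n m) (mem (lower h))))) s ≲-refl in
          t , ≲-trans o n , w

    limit-resp : ∀ {δ δ′ p} → p ⊩ δ ≐ δ′ → E.Limit δ p → E.Limit δ′ p
    limit-resp {δ} {δ′} {p} e ((t , u) , ne , s) =
      (transitive-resp e t , λ y q l h → u y q l (back l h)) ,
      (λ q l h → ne q l λ y r m k → h y r m (lift (un-mem (∈-respʳ (≐-mono (≲-trans m l) e) (mem (lower k)))))) ,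
      λ β q l h → dense-map (s β q l (back l h)) λ { r m (γ , k , k′) →
        γ , lift (un-mem (∈-respʳ (≐-mono (≲-trans m l) e) (mem (lower k)))) , k′ }
      where
      back : ∀ {y q} → q ≲ p → (y E.∈̇ δ′) q → (y E.∈̇ δ) q
      back l h = lift (un-mem (∈-respʳ (≐-sym (≐-mono l e)) (mem (lower h))))

    omega-forced : ∀ {p} → E.IsOmega (ord ωJ) p
    omega-forced = limit-ord ω-limit , λ n q l h r m lim → ⊥-lift (
      let s , o , i , k , e = ∈-ord (mem (lower h)) r m
      in n<ω⇒¬limit k (limit-ord⁻¹ e (limit-mono o lim)))

    private
      ⊩-decide : ∀ p (A : Carrier → Set (suc ℓ)) → Dense p (λ q → A q ⊎ (∀ r → r ≲ q → ¬ A r))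
      ⊩-decide p A q l with dec (Σ[ r ∈ Carrier ] r ≲ q × A r)
      ... | yes (r , m , a) = r , m , inj₁ a
      ... | no n = q , ≲-refl , inj₂ λ r m a → n (r , m , a)

    omega⊆ω : ∀ {w p} → E.IsOmega w p → ∀ x q → q ≲ p → q ⊩ x ∈ w → Dense q (λ r → Σ[ n ∈ J ] n < ωJ × r ⊩ x ≐ ord n)
    omega⊆ω {w} {p} (((t , u) , _) , nl) = go
      where
      -- An element x of w is not a limit, so it is empty or has a maximal element β; by induction β and
      -- the other elements of x are numerals.
      go : ∀ x q → q ≲ p → q ⊩ x ∈ w → Dense q (λ r → Σ[ n ∈ J ] n < ωJ × r ⊩ x ≐ ord n)
      go x@(sup A σ s) q l h = dense (⊩-decide q (λ r → Lift (suc ℓ) (Σ[ a ∈ A ] r ≲ s a))) λ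
        { r m (inj₂ none) → now λ r′ m′ → 0J , proj₁ ω-limit , extensionality
            (λ y v n k → ⊥-elim (let v′ , o , a , o′ , _ = member⁻¹ k v ≲-refl in
              none v′ (≲-trans o (≲-trans n m′)) (lift (a , o′))))
            (λ y v n k → ⊥-elim (let _ , _ , _ , o , _ = ∈-ord k v ≲-refl in ≮0 o))
        ; r m (inj₁ (lift (a₀ , m₀))) → dense (max-exists r m a₀ m₀) λ { v n (β , β∈x , β-max) →
            dense (member⁻¹ β∈x) λ { v₁ n₁ (b , kb , eb) →
            let in-w : ∀ {v′} → v′ ≲ v₁ → v′ ⊩ σ b ∈ w
                in-w m′ = x⊆w (≲-trans m′ (≲-trans n₁ (≲-trans n m))) (member b (≲-trans m′ kb)) in
            dense-map (go (σ b) v₁ (≲-trans n₁ (≲-trans n (≲-trans m l))) (in-w ≲-refl)) λ { v₂ n₂ (k , k<ω , ek) →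
              sucJ k , proj₂ ω-limit k k<ω , extensionality
                (λ y v₃ n₃ hy → ∈-local (dense (member⁻¹ hy) λ { v₄ n₄ (c , kc , ec) →
                  let down = ≲-trans n₄ (≲-trans n₃ (≲-trans n₂ (≲-trans n₁ (≲-trans n m)))) in
                  dense-map (go (σ c) v₄ (≲-trans down l) (x⊆w down (member c kc))) λ { v₅ n₅ (j , _ , ej) →
                    ∈-respˡ (≐-sym (≐-trans (≐-mono n₅ ec) ej)) (ord-< (≤⇒<suc (≮⇒≥ λ k<j →
                      let e₅ = ≲-trans n₅ (≲-trans n₄ n₃) in
                      β-max (σ c) v₅ (≲-trans e₅ (≲-trans n₂ n₁)) (member c (≲-trans n₅ kc))
                        (∈-respˡ (≐-sym (≐-trans (≐-mono (≲-trans e₅ n₂) eb) (≐-mono e₅ ek)))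
                          (∈-respʳ (≐-sym ej) (ord-< k<j)))))) } }))
                (λ y v₃ n₃ hy → ∈-local (dense-map (∈-ord hy) λ { v₄ n₄ (j , j<sk , ej) →
                  let d = ≲-trans n₄ n₃
                      b∈x : v₄ ⊩ ord k ∈ x
                      b∈x = ∈-respˡ (≐-mono d ek) (member b (≲-trans d (≲-trans n₂ kb))) in
                  ∈-respˡ (≐-sym ej) ([ (λ j<k → x-trans (≲-trans d (≲-trans n₂ (≲-trans n₁ (≲-trans n m)))) b∈x (ord-< j<k)) ,
                    (λ { refl → b∈x }) ]′ (<suc⇒≤ j<sk)) })) } } } }
        where
        x⊆w : ∀ {v y} → v ≲ q → v ⊩ y ∈ x → v ⊩ y ∈ w
        x⊆w m k = mem (lower (t _ _ (≲-trans m l) (lift (un-mem (∈-mono m h))) _ _ ≲-refl (lift (un-mem k))))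
        x-transitive : E.Transitive x q
        x-transitive = u x q l (lift (un-mem h))
        x-trans : ∀ {v y z} → v ≲ q → v ⊩ y ∈ x → v ⊩ z ∈ y → v ⊩ z ∈ x
        x-trans m k k′ = mem (lower (x-transitive _ _ m (lift (un-mem k)) _ _ ≲-refl (lift (un-mem k′))))
        Max : Carrier → Set (suc ℓ)
        Max v = Σ[ β ∈ Name P ] v ⊩ β ∈ x × (∀ y v′ → v′ ≲ v → v′ ⊩ y ∈ x → ¬ (v′ ⊩ β ∈ y))
        max-exists : ∀ r → r ≲ q → ∀ a → r ≲ s a → Dense r Max
        max-exists r m a ka = dense (⊩-decide r Max) λ
          { r′ m′ (inj₁ mx) → now λ v n → let β , k , f = mx in β , ∈-mono n k , λ y v′ n′ → f y v′ (≲-trans n′ n)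
          ; r′ m′ (inj₂ none) → ⊥-elim (lower (nl x q l (lift (un-mem h)) r′ (≲-trans m′ m)
              ( (x-transitive-at (≲-trans m′ m) , λ y v n k → u y v (≲-trans n (≲-trans m′ (≲-trans m l)))
                  (lift (un-mem (x⊆w (≲-trans n (≲-trans m′ m)) (mem (lower k))))))
              , (λ v n e → e (σ a) v ≲-refl (lift (un-mem (member a (≲-trans n (≲-trans m′ ka))))))
              , λ β v n k v₁ n₁ → lower (by-contradiction {Lift (suc ℓ) _} λ no → none v₁ (≲-trans n₁ n)
                  (β , ∈-mono n₁ (mem (lower k)) , λ y v₂ n₂ k₂ k₃ →
                    no (lift (v₂ , n₂ , y , lift (un-mem k₂) , lift (un-mem k₃))))) ))) }
          where
          x-transitive-at : ∀ {v} → v ≲ q → E.Transitive x v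
          x-transitive-at m y v n = x-transitive y v (≲-trans n m)

    -- The cofinality formulas speak of some set that is ω; this identifies it with the ω of the
    -- ground model. All its elements are numerals by `omega⊆ω`. Being a nonempty limit it has
    -- elements above each numeral, and by transitivity it contains them all.
    omega-unique : ∀ {w p} → E.IsOmega w p → p ⊩ w ≐ ord ωJ
    omega-unique {w} {p} ow@((o , ne , s) , nl) = extensionality
      (λ x q l h → ∈-local (dense-map (omega⊆ω ow x q l h) λ { r m (n , k , e) → ∈-respˡ (≐-sym e) (ord-< k) }))
      λ x q l h → ∈-local (dense (∈-ord h) λ { r m (n , k , e) →
        let n′ , e′ = <ω⇒num n k in
        dense-map (unbounded n′ r (≲-trans m l)) λ { v i (b , n≤b , b∈w) → ∈-respˡ (≐-sym (≐-mono i e))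
          ([ (λ n<b → ordinal-trans (ord-mono (≲-trans i (≲-trans m l))) b∈w (ord-< n<b)) , (λ { refl → b∈w }) ]′
            (subst (_≤ b) e′ n≤b)) } })
      where
      ord-mono : ∀ {q} → q ≲ p → E.Ordinal w q
      ord-mono l = proj₁ (limit-mono l (o , ne , s))
      unbounded : ∀ n q → q ≲ p → Dense q (λ r → Σ[ b ∈ J ] num n ≤ b × r ⊩ ord b ∈ w)
      unbounded zero q l q₁ l₁ = by-contradictionℓ λ none → lower (ne q₁ (≲-trans l₁ l) λ y v n k → ⊥-lift (
        let v′ , n′ , b , _ , e = omega⊆ω ow y v (≲-trans n (≲-trans l₁ l)) (mem (lower k)) v ≲-refl in
        none (v′ , ≲-trans n′ n , b , 0≤ b , ∈-respˡ e (∈-mono n′ (mem (lower k))))))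
      unbounded (sucℕ n) q l = dense (unbounded n q l) λ { r m (b , n≤b , k) →
        dense (s (ord b) r (≲-trans m l) (lift (un-mem k))) λ { v i (γ , γ∈w , b∈γ) →
          dense-map (omega⊆ω ow γ v (≲-trans i (≲-trans m l)) (mem (lower γ∈w))) λ { v′ i′ (c , _ , e) →
            c , suc≤ (≤-<-trans n≤b (ord-<⁻¹ (∈-respʳ e (∈-mono i′ (mem (lower b∈γ)))))) ,
            ∈-respˡ e (∈-mono i′ (mem (lower γ∈w))) } } }

    opaque
      -- The pair indexed by a enters the function only under the condition `c a`. Thus a function
      -- can be named whose domain is not decided in advance.
      graphN : {A : Set ℓ} → (A → Name P) → (A → Name P) → (A → Carrier) → Name P
      graphN {A} k v c = sup A (λ a → opair (k a) (v a)) c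

      graphN-intro : ∀ {A : Set ℓ} {k v : A → Name P} {c : A → Carrier} {x y p} a → p ≲ c a → p ⊩ x ≐ k a → p ⊩ y ≐ v a → p ⊩ opair x y ∈ graphN k v c
      graphN-intro {k = k} {v} a l e e′ = ∈-respˡ (≐-sym (opair-cong e e′)) (member a l)

      graphN-elim : ∀ {A : Set ℓ} {k v : A → Name P} {c : A → Carrier} {x y p} → p ⊩ opair x y ∈ graphN k v c →
        Dense p (λ q → Σ[ a ∈ A ] q ≲ c a × q ⊩ x ≐ k a × q ⊩ y ≐ v a)
      graphN-elim h = dense-map (member⁻¹ h) λ { q l (a , m , e) →
        a , m , opair-injectiveˡ e , opair-injectiveʳ e }

      graphN-functionOn : ∀ {A : Set ℓ} {k v : A → Name P} {c : A → Carrier} {d p} → (∀ a q → q ≲ p → q ≲ c a → q ⊩ k a ∈ d) →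
        (∀ x q → q ≲ p → q ⊩ x ∈ d → Dense q (λ r → Σ[ a ∈ A ] r ≲ c a × r ⊩ x ≐ k a)) →
        (∀ a a′ q → q ≲ p → q ≲ c a → q ≲ c a′ → q ⊩ k a ≐ k a′ → q ⊩ v a ≐ v a′) →
        FunOn (graphN k v c) d p
      graphN-functionOn {k = k} {v} h t u = functionOn-intro
        (λ z q l m → dense-map (member⁻¹ m) λ { r n (a , o , e) → k a , v a , h a r (≲-trans n l) o , e })
        (λ x q l m → dense-map (t x q l m) λ { r n (a , o , e) → v a , graphN-intro a o e ≐-refl })
        λ x y y′ q l m m′ → ≐-local (dense (graphN-elim m) λ { r n (a , o , e₁ , e₂) →
          dense-map (graphN-elim (∈-mono n m′)) λ { s i (a′ , o′ , e₁′ , e₂′) →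
            ≐-trans (≐-mono i e₂) (≐-trans (u a a′ s (≲-trans i (≲-trans n l)) (≲-trans i o) o′
              (≐-trans (≐-sym (≐-mono i e₁)) e₁′)) (≐-sym e₂′)) } })

    -- Cofinal maps

    module _ {a b : V ℓ} (F : Ix a → Ix b) where

      mapN : Name P
      mapN = graphN {Ix a} (λ i → ⌜ el i ⌝) (λ i → ⌜ el (F i) ⌝) (λ _ → 𝟙)

      mapN-on : ∀ {q} → FunOn mapN ⌜ a ⌝ q
      mapN-on = graphN-functionOn (λ i _ _ _ → ⌜⌝-∈ (el∈ i))
        (λ x q l h → dense-map (∈-⌜⌝ h) λ { r m (y , k , e) → let i , e₁ = idx k in
          i , 𝟙-maximum r , ≐-trans e (⌜⌝-≈ (≈-sym e₁)) })
        λ i i′ q l _ _ e → ⌜⌝-≈ (el-cong (cong F (el-injective {a} (⌜⌝-≈⁻¹ e))))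

      mapN-into : ∀ {γ x y q} → q ⊩ γ ≐ ⌜ b ⌝ → q ⊩ opair x y ∈ mapN → q ⊩ y ∈ γ
      mapN-into e h = ∈-local (dense-map (graphN-elim h) λ { s n (i , _ , _ , e′) →
        ∈-respˡ (≐-sym e′) (∈-respʳ (≐-sym (≐-mono n e)) (⌜⌝-∈ (el∈ (F i)))) })

      mapN-maps : ∀ {p} i → p ⊩ opair ⌜ el i ⌝ ⌜ el (F i) ⌝ ∈ mapN
      mapN-maps i = graphN-intro i (𝟙-maximum _) ≐-refl ≐-refl

      mapN-cofinal : ∀ {γ q} → (∀ (β : Ix b) → Σ[ i ∈ Ix a ] el β ≤ᵛ el (F i)) → q ⊩ γ ≐ ⌜ b ⌝ → ∀ β → q ⊩ β ∈ γ →
         Dense q (λ r → Σ[ i ∈ Ix a ] r ⊩ β ≤̌ ⌜ el (F i) ⌝)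
      mapN-cofinal c e β h = dense-map (∈-⌜⌝ (∈-respʳ e h)) λ { s n (y , k , e) →
        let j , e₁ = idx k ; i , o = c j in i , ≤-respˡ (≐-sym e) (⌜⌝-≤ (≤ᵛ-resp e₁ ≈-refl o)) }

    hcm-intro : ∀ {a b α γ p} → CofinalMap a b → p ⊩ α ≐ ⌜ a ⌝ → p ⊩ γ ≐ ⌜ b ⌝ → E.HasCofinalMap α γ p
    hcm-intro {α = α} (F , c) eα eγ q l = q , ≲-refl , mapN F ,
      ( un-funOn {mapN F} {α} {q} (functionOn-resp ≐-refl (≐-sym (≐-mono l eα)) (mapN-on F))
      , λ x y r m h → lift (un-mem (mapN-into F (≐-mono (≲-trans m l) eγ) (maps⇒ {mapN F} {x} {y} h))) ) ,
      λ β r m h r₁ m₁ → let s , n , i , k = mapN-cofinal F c (≐-mono (≲-trans m l) eγ) β (mem (lower h)) r₁ m₁ in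
        s , n , ⌜ el i ⌝ , λ t n′ → t , ≲-refl , ⌜ el (F i) ⌝ ,
          maps⇐ {mapN F} {⌜ el i ⌝} {⌜ el (F i) ⌝} {t} (mapN-maps F i) , un-le {t} {β} {⌜ el (F i) ⌝} (≤-mono n′ k)

    hcm-resp : ∀ {α γ γ′ p} → p ⊩ γ ≐ γ′ → E.HasCofinalMap α γ p → E.HasCofinalMap α γ′ p
    hcm-resp e h q₀ l₀ = let q , l , f , (on , into) , c = h q₀ l₀ ; l′ = ≲-trans l l₀ in q , l , f ,
      (on , λ x y r m k → lift (un-mem (∈-respʳ (≐-mono (≲-trans m l′) e) (mem (lower (into x y r m k)))))) ,
      λ β r m k → c β r m (lift (un-mem (∈-respʳ (≐-sym (≐-mono (≲-trans m l′) e)) (mem (lower k)))))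

    -- What is left of a forced cofinal map between check names once arguments and values are read
    -- as ground-model indices; the preservation arguments work with these alone.
    record CofinalGraph (f : Name P) (a b : V ℓ) (p : Carrier) : Set (suc ℓ) where
      field
        total      : ∀ (i : Ix a) q → q ≲ p → Dense q (λ r → Σ[ j ∈ Ix b ] r ⊩ opair ⌜ el i ⌝ ⌜ el j ⌝ ∈ f)
        single     : ∀ (i : Ix a) (j j′ : Ix b) q → q ≲ p →
          q ⊩ opair ⌜ el i ⌝ ⌜ el j ⌝ ∈ f → q ⊩ opair ⌜ el i ⌝ ⌜ el j′ ⌝ ∈ f → j ≡ j′
        cofinal    : ∀ (β : Ix b) q → q ≲ p →
          Dense q (λ r → Σ[ i ∈ Ix a ] Σ[ j ∈ Ix b ] r ⊩ opair ⌜ el i ⌝ ⌜ el j ⌝ ∈ f × el β ≤ᵛ el j)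

    ∈-⌜⌝-ix : ∀ {y b p} → p ⊩ y ∈ ⌜ b ⌝ → Dense p (λ s → Σ[ j ∈ Ix b ] s ⊩ y ≐ ⌜ el j ⌝)
    ∈-⌜⌝-ix h = dense-map (∈-⌜⌝ h) λ { s n (y′ , l , e) →
        let j , e₁ = idx l in j , ≐-trans e (⌜⌝-≈ (≈-sym e₁)) }

    cofinalGraph : ∀ {f a b p} → FunOn f ⌜ a ⌝ p →
      (∀ {q x y} → q ≲ p → q ⊩ opair x y ∈ f → q ⊩ y ∈ ⌜ b ⌝) →
      (∀ β q → q ≲ p → q ⊩ β ∈ ⌜ b ⌝ → Dense q (λ r → Σ[ ξ ∈ Name P ] Σ[ η ∈ Name P ] r ⊩ opair ξ η ∈ f × r ⊩ β ≤̌ η)) →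
      CofinalGraph f a b p
    cofinalGraph {f} {a} {b} {p} on into c = record
      { total = λ i r m → dense (functionOn-total (functionOn-mono m on) (⌜⌝-∈ (el∈ i))) λ { s n (y , k) →
          dense-map (∈-⌜⌝-ix (into (≲-trans n m) k)) λ { t o (j , e) → j , ∈-respˡ (opair-cong ≐-refl e) (∈-mono o k) } }
      ; single = λ i j j′ r m k k′ → el-injective {b} (⌜⌝-≈⁻¹ (functional (functionOn-mono m on) k k′))
      ; cofinal = λ β r m → dense (c ⌜ el β ⌝ r m (⌜⌝-∈ (el∈ β))) λ { s n (ξ , η , k , o) →
          dense (∈-⌜⌝-ix (functionOn-dom (functionOn-mono (≲-trans n m) on) k)) λ { t n₁ (i , e) →
            dense-map (∈-⌜⌝-ix (into (≲-trans n₁ (≲-trans n m)) (∈-mono n₁ k))) λ { v n₂ (j , e′) →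
              i , j , ∈-respˡ (opair-cong (≐-mono n₂ e) e′) (∈-mono (≲-trans n₂ n₁) k) ,
              ⌜⌝-≤⁻¹ (≤-respʳ e′ (≤-mono (≲-trans n₂ n₁) o)) } } } }

    hcm-elim : ∀ {a b p} → E.HasCofinalMap ⌜ a ⌝ ⌜ b ⌝ p → Dense p (λ q → Σ[ f ∈ Name P ] CofinalGraph f a b q)
    hcm-elim {a} {b} h q₀ l₀ = let q , l , f , (on , into) , c = h q₀ l₀ in q , l , f , cofinalGraph (funOn on)
      (λ {r} {x} {y} m k → mem (lower (into x y r m (maps⇐ {f} {x} {y} k))))
      λ β r m k → dense (c β r m (lift (un-mem k))) λ { s n (ξ , d) → dense-map d λ { t o (η , k′ , o′) →
        ξ , η , maps⇒ {f} {ξ} {η} k′ , le o′ } }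

    -- Bounded predicates on the ordinals as names of subsets

    Predicate : Set (suc ℓ)
    Predicate = J → Carrier → Set ℓ

    Mono : ∀ {a} → (J → Carrier → Set a) → Set (ℓ ⊔ a)
    Mono U = ∀ x {q r} → r ≲ q → U x q → U x r

    ⟦_⟧ : Name P → Predicate
    ⟦ C ⟧ x q = q ⊩ ord x ∈ C

    ⟦⟧-mono : ∀ {C} → Mono ⟦ C ⟧
    ⟦⟧-mono x l = ∈-mono l

    opaque
      sub : Predicate → Name P
      sub U = sup (Σ[ j ∈ J ] Σ[ q ∈ Carrier ] U j q) (λ a → ord (proj₁ a)) (λ a → proj₁ (proj₂ a))

      sub-intro : ∀ {U x p} → U x p → p ⊩ ord x ∈ sub U
      sub-intro {x = x} {p} u = member (x , p , u) ≲-refl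

      sub-elim : ∀ {U x p} → Mono U → p ⊩ x ∈ sub U → Dense p (λ q → Σ[ j ∈ J ] U j q × q ⊩ x ≐ ord j)
      sub-elim m h = dense-map (member⁻¹ h) λ { q l ((j , r , u) , n , e) → j , m j n u , e }

    sub-elim′ : ∀ {U x p} → Mono U → p ⊩ ord x ∈ sub U → Dense p (U x)
    sub-elim′ {U} m h = dense-map (sub-elim m h) λ { q l (j , u , e) → subst (λ j → U j q) (sym (ord-≡ e)) u }

    -- Presents γ as a set of ground-model ordinals, so that the lemmas on clubs and stationary sets
    -- serve both λ (`AllJ`) and ordinals below λ (`_< g`).
    record IsBound (γ : Name P) (B : J → Set ℓ) (p : Carrier) : Set (suc ℓ) where
      constructor bound
      field
        b-in  : ∀ j → B j → p ⊩ ord j ∈ γ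
        b-out : ∀ x q → q ≲ p → q ⊩ x ∈ γ → Dense q (λ r → Σ[ j ∈ J ] B j × r ⊩ x ≐ ord j)
    open IsBound

    bound-mono : ∀ {γ B p q} → q ≲ p → IsBound γ B p → IsBound γ B q
    bound-mono l (bound i o) = bound (λ j b → ∈-mono l (i j b)) λ x r m → o x r (≲-trans m l)

    AllJ : J → Set ℓ
    AllJ _ = Lift ℓ ⊤

    bound-Λ : ∀ {p} → IsBound ⌜ Λ ⌝ AllJ p
    bound-Λ = bound (λ j _ → ord∈Λ) λ x q l h → dense-map (∈-Λ h) λ { r m (j , e) → j , _ , e }

    bound-ord : ∀ {γ g p} → p ⊩ γ ≐ ord g → IsBound γ (_< g) p
    bound-ord e = bound (λ j l → ∈-respʳ (≐-sym e) (ord-< l)) λ x q l h → ∈-ord (∈-respʳ (≐-mono l e) h)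

    unbounded-elim : ∀ {C γ B p} → IsBound γ B p → E.Unbounded C γ p → ∀ β → B β → ∀ q → q ≲ p →
      Dense q (λ r → Σ[ η ∈ J ] B η × β ≤ η × r ⊩ ord η ∈ C)
    unbounded-elim bd h β b q l = dense (h (ord β) q l (lift (un-mem (∈-mono l (b-in bd β b))))) λ
      { r m (η , k , k′ , le′) → dense-map (b-out bd η r (≲-trans m l) (mem (lower k′))) λ
        { s n (j , bj , e) → j , bj , ord-≤⁻¹ (≤-respʳ e (≤-mono n (le le′))) , ∈-respˡ e (∈-mono n (mem (lower k))) } }

    unbounded-intro : ∀ {C γ B p} → IsBound γ B p →
      (∀ β → B β → ∀ q → q ≲ p → Dense q (λ r → Σ[ η ∈ J ] B η × β ≤ η × r ⊩ ord η ∈ C)) → E.Unbounded C γ p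
    unbounded-intro bd h β q l k = dense (b-out bd β q l (mem (lower k))) λ { r m (b , Bb , e) →
      dense-map (h b Bb r (≲-trans m l)) λ { s n (η , Bη , le′ , k′) →
        ord η , lift (un-mem k′) , lift (un-mem (∈-mono (≲-trans n (≲-trans m l)) (b-in bd η Bη))) ,
        un-le (≤-respˡ (≐-sym (≐-mono n e)) (ord-≤ le′)) } }

    -- Closure asks for U at δ outright and not just densely. For the predicate of a name this costs
    -- nothing, as forced membership is a local property.
    record Clubˢ (U : Predicate) (B : J → Set ℓ) (p : Carrier) : Set ℓ where
      constructor club
      field
        unb : ∀ β → B β → ∀ q → q ≲ p → Σ[ r ∈ Carrier ] r ≲ q × (Σ[ η ∈ J ] B η × β ≤ η × U η r)
        cls : ∀ δ → B δ → LimJ δ → ∀ q → q ≲ p →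
          (∀ β → β < δ → ∀ r → r ≲ q → Σ[ s ∈ Carrier ] s ≲ r × (Σ[ η ∈ J ] η < δ × β ≤ η × U η s)) → U δ q
    open Clubˢ public

    club-mono : ∀ {U B p q} → q ≲ p → Clubˢ U B p → Clubˢ U B q
    club-mono l (club u c) = club (λ β b r m → u β b r (≲-trans m l)) λ δ b lim r m → c δ b lim r (≲-trans m l)

    Statˢ : (J → Carrier → Set ℓ) → (J → Set ℓ) → Carrier → Set (suc ℓ)
    Statˢ T B p = ∀ U → Mono U → ∀ q → q ≲ p → Clubˢ U B q →
      Σ[ r ∈ Carrier ] r ≲ q × (Σ[ x ∈ J ] B x × U x r × T x r)

    stat-mono : ∀ {T B p q} → q ≲ p → Statˢ T B p → Statˢ T B q
    stat-mono l st U m r n = st U m r (≲-trans n l)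

    stat-weaken : ∀ {T T′ B p} → (∀ x q → q ≲ p → T x q → T′ x q) → Statˢ T B p → Statˢ T′ B p
    stat-weaken f st U m q l c = let r , n , x , b , u , t = st U m q l c in r , n , x , b , u , f x r (≲-trans n l) t

    stat-dense : ∀ {T T′ B p} → (∀ x q → q ≲ p → T x q → Dense q (T′ x)) → Statˢ T B p → Statˢ T′ B p
    stat-dense f st U m q l c = let r , n , x , b , u , t = st U m q l c ; s , o , t′ = f x r (≲-trans n l) t r ≲-refl in
      s , ≲-trans o n , x , b , m x o u , t′

    clubˢ : ∀ {C γ B p} → IsBound γ B p → E.Club C γ p → Clubˢ ⟦ C ⟧ B p
    clubˢ bd (_ , u , c) = club
      (λ β b q l → unbounded-elim bd u β b q l q ≲-refl)
      λ δ b lim q l h → mem (lower (c (ord δ) q l (lift (un-mem (∈-mono l (b-in bd δ b)))) q ≲-refl (limit-ord lim)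
        q ≲-refl (unbounded-intro (bound-ord ≐-refl) λ β k r m s n → h β k s (≲-trans n m))))

    clubˢ⁻¹ : ∀ {U γ B p} → IsBound γ B p → Mono U → (∀ x q → U x q → B x) → Clubˢ U B p → E.Club (sub U) γ p
    clubˢ⁻¹ {U} {γ} {B} {p} bd m in-B (club u c) =
      (λ z q l h → lift (un-mem (∈-local (dense-map (sub-elim m (mem (lower h))) λ { r n (j , k , e) →
        ∈-respˡ (≐-sym e) (∈-mono (≲-trans n l) (b-in bd j (in-B j r k))) })))) ,
      unbounded-intro bd (λ β b q l r n → let s , o , η , b′ , lq , k = u β b r (≲-trans n l) in
        s , o , η , b′ , lq , sub-intro k) ,
      λ δ q l h r n lim s o unb → lift (un-mem (∈-local (dense-map
        (b-out bd δ s (≲-trans o (≲-trans n l)) (∈-mono (≲-trans o n) (mem (lower h)))) λ { t i (d , b , e) →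
        ∈-respˡ (≐-sym e) (sub-intro (c d b (limit-ord⁻¹ e (limit-mono (≲-trans i o) lim)) t
          (≲-trans i (≲-trans o (≲-trans n l))) λ β k t′ i′ →
            let t₁ , i₁ , η , η<d , lq , k′ = unbounded-elim (bound-ord (≐-mono i′ e))
                  (λ β q l → unb β q (≲-trans l (≲-trans i′ i))) β k t′ ≲-refl t′ ≲-refl
                t₂ , i₂ , k″ = sub-elim′ m k′ t₁ ≲-refl
            in t₂ , ≲-trans i₂ i₁ , η , η<d , lq , k″)) })))

    statˢ : ∀ {T γ B p} → IsBound γ B p → E.Stationary T γ p → Statˢ ⟦ T ⟧ B p
    statˢ {T} {γ} {B} {p} bd st U m q l (club u c) =
      -- `U` is cut down to `B` first, because a club in γ has to be a subset of γ.
      let r , n , x , h , k = st (sub U′) q l (clubˢ⁻¹ (bound-mono l bd) m′ (λ _ _ → proj₁)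
            (club (λ β b r o → let s , i , η , b′ , lq , k = u β b r o in s , i , η , b′ , lq , b′ , k)
              λ δ b lim r o f → b , c δ b lim r o λ β k s i → let t , j , η , η<δ , lq , _ , k′ = f β k s i in
                t , j , η , η<δ , lq , k′)) q ≲-refl
          s , o , j , (b , u′) , e = sub-elim m′ (mem (lower h)) r ≲-refl
      in s , ≲-trans o n , j , b , u′ , ∈-respˡ e (∈-mono o (mem (lower k)))
      where
      U′ : Predicate
      U′ x q = B x × U x q
      m′ : Mono U′
      m′ x l (b , k) = b , m x l k

    statˢ⁻¹ : ∀ {T γ B p} → IsBound γ B p → Statˢ ⟦ T ⟧ B p → E.Stationary T γ p
    statˢ⁻¹ bd st C q l (C⊆γ , u , c) r m =
      let s , n , x , b , k , t = st ⟦ C ⟧ (⟦⟧-mono {C}) r (≲-trans m l)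
            (club-mono m (clubˢ (bound-mono l bd) (C⊆γ , u , c)))
      in s , n , ord x , lift (un-mem k) , lift (un-mem t)

    -- Uncountable cofinality

    -- A ground-model cofinal map from some a ≤ ω is still cofinal in the extension, where it
    -- contradicts the minimality of a cofinality above ω.
    uncountable-elim : ∀ {γ g p} → p ⊩ γ ≐ ord g → E.UncountableCof γ p → Uncountable g
    uncountable-elim {γ} {g} {p} e h a a≤ω c =
      let q , l , w , d = h p ≲-refl
          r , m , δ , ow , (_ , oδ , _ , none) , w∈δ = d q ≲-refl
          ω∈δ = ∈-respˡ (omega-unique ow) (mem (lower w∈δ))
          a∈δ = [ (λ a<ω → ordinal-trans oδ ω∈δ (ord-< a<ω)) , (λ { refl → ω∈δ }) ]′ a≤ω
      in lower (none (ord a) r ≲-refl (lift (un-mem a∈δ)) r ≲-refl (hcm-intro c ≐-refl (≐-mono (≲-trans m l) e)))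

    -- The least δ with a cofinal map into g is its ground-model cofinality, exceeds ω, and is
    -- preserved.
    uncountable-intro : CofinalityPreserving P → ∀ {g p} → Uncountable g → E.UncountableCof (ord g) p
    uncountable-intro cp {g} {p} u with leastℓ {λ δ → CofinalMap (el δ) (el g)} (g , cofJ⁻¹ ((λ j → j) , (λ j l → l) , λ y l → y , l , ≤-refl))
    ... | δ , c , m = λ q _ → q , ≲-refl , ord ωJ , λ r _ → r , ≲-refl , ord δ , omega-forced {r} , cof r ,
        lift (un-mem (ord-< ω<δ))
      where
      ω<δ : ωJ < δ
      ω<δ with <⊎≥ ωJ δ
      ... | inj₁ l = l
      ... | inj₂ l = ⊥-elim (u δ l c)
      cof : ∀ r → E.IsCof (ord δ) (ord g) r
      cof = cp (el g) (el δ) (ordinal⁻¹ (el-ord g) , ordinal⁻¹ (el-ord δ) , cofinalMap⁻¹ c ,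
          λ ε l h → ⊥-lift (let i , e = idx (lower l) ; ε′ , e′ , l′ = lift-ix {δ} i in
            ≤⇒≯ (m ε′ (CofinalMap-resp (≈-sym (≈-trans e′ e)) ≈-refl (cofinalMap h))) l′))

  -- Descending sequences of length λ

  module Chains (X : Set ℓ) (_⊑_ : X → X → Set ℓ) (⊑-refl : ∀ {x} → x ⊑ x)
    (⊑-trans : ∀ {x y z} → x ⊑ y → y ⊑ z → x ⊑ z) where
    ShortClosed : Set ℓ
    ShortClosed = ∀ (i : J) (f : J → X) → (Σ[ j ∈ J ] j < i) → (∀ j k → j < k → k < i → f k ⊑ f j) →
      Σ[ x ∈ X ] (∀ j → j < i → x ⊑ f j)

    -- At stage i the step leads from `L i`, a bound of all earlier results, to `G i`. A user with a
    -- < λ many tasks takes `L a`, which lies below the results of all of them.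
    record Tower (x₀ : X) (Step : J → X → X → Set (suc ℓ)) : Set (suc ℓ) where
      field
        L G   : J → X
        L⊑x₀  : ∀ i → L i ⊑ x₀
        G⊑L   : ∀ i → G i ⊑ L i
        L⊑G   : ∀ {j i} → j < i → L i ⊑ G j
        stepᵗ : ∀ i → Step i (L i) (G i)

    module _ (closed : ShortClosed) (x₀ : X) (Step : J → X → X → Set (suc ℓ))
      (total : ∀ i x → Σ[ y ∈ X ] y ⊑ x × Step i x y) where

      private
        Below : ∀ i → (∀ j → j < i → X) → X → Set ℓ
        Below i f x = x ⊑ x₀ × (∀ j l → x ⊑ f j l)

        -- The least lower bound in a well-order of X depends on f only up to pointwise equality, which
        -- makes the recursion independent of the accessibility proofs.
        pick : ∀ i (f : ∀ j → j < i → X) → Dec (Σ[ x ∈ X ] Lift (suc ℓ) (Below i f x)) → X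
        pick i f (yes s) = proj₁ (least (proj₂ (proj₂ (wop X))) s)
        pick i f (no _) = x₀

        pick-cong : ∀ i f g → (∀ j l m → f j l ≡ g j m) → ∀ d e → pick i f d ≡ pick i g e
        pick-cong i f g h (yes s) (yes t) = least-unique (proj₁ (proj₂ (wop X)))
          (λ { x (lift (b , k)) → lift (b , λ j l → subst (x ⊑_) (h j l l) (k j l)) })
          (λ { x (lift (b , k)) → lift (b , λ j l → subst (x ⊑_) (sym (h j l l)) (k j l)) })
          (least (proj₂ (proj₂ (wop X))) s) (least (proj₂ (proj₂ (wop X))) t)
        pick-cong i f g h (yes (x , lift (b , k))) (no n) =
          ⊥-elim (n (x , lift (b , λ j l → subst (x ⊑_) (h j l l) (k j l))))
        pick-cong i f g h (no n) (yes (x , lift (b , k))) =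
          ⊥-elim (n (x , lift (b , λ j l → subst (x ⊑_) (sym (h j l l)) (k j l))))
        pick-cong i f g h (no _) (no _) = refl

        L′ : ∀ i → (∀ j → j < i → X) → X
        L′ i f = pick i f (dec _)

        G′ : ∀ i → Acc _<_ i → X
        G′ i (acc rs) = proj₁ (total i (L′ i λ j l → G′ j (rs l)))

        irrelevant : ∀ i (a b : Acc _<_ i) → G′ i a ≡ G′ i b
        irrelevant i (acc rs) (acc rs′) = cong (λ x → proj₁ (total i x))
          (pick-cong i _ _ (λ j l m → irrelevant j (rs l) (rs′ m)) (dec _) (dec _))

        G₀ L₀ : J → X
        G₀ i = G′ i (<-wf i)
        L₀ i = L′ i λ j _ → G₀ j

        G-unfold : ∀ i → proj₁ (total i (L₀ i)) ≡ G₀ i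
        G-unfold i = irrelevant i (acc λ {j} _ → <-wf j) (<-wf i)

        G⊑L₀ : ∀ i → G₀ i ⊑ L₀ i
        G⊑L₀ i = subst (_⊑ L₀ i) (G-unfold i) (proj₁ (proj₂ (total i (L₀ i))))

        pick-below : ∀ i f (d : Dec (Σ[ x ∈ X ] Lift (suc ℓ) (Below i f x))) → Σ X (Below i f) → Below i f (pick i f d)
        pick-below i f (yes s) _ = lower (proj₁ (proj₂ (least (proj₂ (proj₂ (wop X))) s)))
        pick-below i f (no n) (x , b) = ⊥-elim (n (x , lift b))

        L-below : ∀ i → Below i (λ j _ → G₀ j) (L₀ i)
        L-below = <-induction _ λ i ih → pick-below i (λ j _ → G₀ j) (dec _) (bound-exists i ih (decℓ (Σ[ j ∈ J ] j < i)))
          where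
          bound-exists : ∀ i → (∀ j → j < i → Below j (λ k _ → G₀ k) (L₀ j)) → Dec (Σ[ j ∈ J ] j < i) →
            Σ X (Below i (λ j _ → G₀ j))
          bound-exists i ih (no n) = x₀ , ⊑-refl , λ j l → ⊥-elim (n (j , l))
          bound-exists i ih (yes (k , l)) =
            let x , b = closed i G₀ (k , l) λ j k j<k k<i → ⊑-trans (G⊑L₀ k) (proj₂ (ih k k<i) j j<k) in
            x , ⊑-trans (b k l) (⊑-trans (G⊑L₀ k) (proj₁ (ih k l))) , b

      tower : Tower x₀ Step
      tower = record
        { L = L₀ ; G = G₀
        ; L⊑x₀ = λ i → proj₁ (L-below i)
        ; G⊑L = G⊑L₀
        ; L⊑G = λ {j} {i} l → proj₂ (L-below i) j l
        ; stepᵗ = λ i → subst (Step i (L₀ i)) (G-unfold i) (proj₂ (proj₂ (total i (L₀ i))))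
        }

  -- The forcing ℙ

  -- No S_c = h⁻¹(c) with c ∈ C meets the club C.
  Good : (J → J) → J → Set (suc ℓ)
  Good h γ = Σ[ C ∈ (J → Set ℓ) ]
      (∀ β → β < γ → Σ[ c ∈ J ] β ≤ c × c < γ × C c)
    × (∀ δ → δ < γ → LimJ δ → (∀ β → β < δ → Σ[ c ∈ J ] β ≤ c × c < δ × C c) → C δ)
    × (∀ c c′ → c < γ → c′ < γ → C c → C c′ → ¬ (h c ≡ c′))

  -- Goodness is demanded at δ itself too. So the union of a chain of conditions may fail to be a
  -- condition, for lack of a club at its length; threads are there to supply that club.
  record ValidP (δ : J) (h : J → J) : Set (suc ℓ) where
    field
      regressive : ∀ β → β < δ → 0J < β → h β < β
      good       : ∀ γ → γ ≤ δ → LimJ γ → Good h γ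
  open ValidP public

  good-resp : ∀ {h h′ γ} → (∀ β → β < γ → h β ≡ h′ β) → Good h γ → Good h′ γ
  good-resp e (C , u , c , a) = C , u , c , λ x y l m k k′ q → a x y l m k k′ (trans (e x l) q)

  validP-resp : ∀ {δ h h′} → (∀ β → β < δ → h β ≡ h′ β) → ValidP δ h → ValidP δ h′
  validP-resp e v = record
    { regressive = λ β l p → subst (_< β) (e β l) (regressive v β l p)
    ; good = λ γ l lim → good-resp (λ β m → e β (<-≤-trans m l)) (good v γ l lim) }

  validP-0 : ∀ h → ValidP 0J h
  validP-0 h = record { regressive = λ β l → ⊥-elim (≮0 l) ; good = λ γ l lim → ⊥-elim (≤⇒≯ l (proj₁ lim)) }

  limit≤suc : ∀ {γ δ} → LimJ γ → γ ≤ sucJ δ → γ ≤ δ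
  limit≤suc lim (inj₁ l) = <suc⇒≤ l
  limit≤suc {δ = δ} lim (inj₂ refl) = ⊥-elim (<-irrefl (proj₂ lim δ (<suc δ)))

  private
    -- An ordinal that codes no valid function stands for the empty condition, so that the carrier
    -- can be all of `J`.
    decodeP : ∀ x → Dec (ValidP (length x) (firsts x)) → J
    decodeP x (yes _) = length x
    decodeP x (no _) = 0J

    decodeP-valid : ∀ x d → ValidP (decodeP x d) (firsts x)
    decodeP-valid x (yes v) = v
    decodeP-valid x (no _) = validP-0 _

    decodeP-yes : ∀ x d → ValidP (length x) (firsts x) → decodeP x d ≡ length x
    decodeP-yes x (yes _) _ = refl
    decodeP-yes x (no n) v = ⊥-elim (n v)

  opaque
    lenP : J → J
    lenP x = decodeP x (dec _)

    hP : J → J → J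
    hP = firsts

    validP : ∀ x → ValidP (lenP x) (hP x)
    validP x = decodeP-valid x (dec _)

    mkP : ∀ δ h → ValidP δ h → Σ[ x ∈ J ] lenP x ≡ δ × (∀ β → β < δ → hP x β ≡ h β)
    mkP δ h v = let x , e , e₁ , _ = encode₂ δ h h in
      x , trans (decodeP-yes x (dec _) (subst (λ δ → ValidP δ (firsts x)) (sym e)
        (validP-resp (λ β l → sym (e₁ β l)) v))) e , e₁

  infix 4 _≲ₚ_
  record _≲ₚ_ (p q : J) : Set ℓ where
    constructor extends
    field
      len≤  : lenP q ≤ lenP p
      agree : ∀ β → β < lenP q → hP p β ≡ hP q β
  open _≲ₚ_ public

  ≲ₚ-refl : ∀ {p} → p ≲ₚ p
  ≲ₚ-refl = extends ≤-refl λ _ _ → refl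

  ≲ₚ-trans : ∀ {p q r} → p ≲ₚ q → q ≲ₚ r → p ≲ₚ r
  ≲ₚ-trans (extends l e) (extends l′ e′) =
    extends (≤-trans l′ l) λ β m → trans (e β (<-≤-trans m l′)) (e′ β m)

  preorder-on-J : ∀ {R : J → J → Set ℓ} → (∀ {x} → R x x) → (∀ {x y z} → R x y → R y z → R x z) → Preorder ℓ ℓ ℓ
  preorder-on-J {R} r t = record { Carrier = J ; _≈_ = _≡_ ; _≲_ = R ; isPreorder = record
    { isEquivalence = record { refl = refl ; sym = sym ; trans = trans } ; reflexive = λ { refl → r } ; trans = t } }

  emptyP : Σ[ x ∈ J ] lenP x ≡ 0J × (∀ β → β < 0J → hP x β ≡ 0J)
  emptyP = mkP 0J (λ _ → 0J) (validP-0 _)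

  ℙ : ForcingNotion ℓ
  ℙ = record
    { preorder = preorder-on-J ≲ₚ-refl ≲ₚ-trans
    ; 𝟙 = proj₁ emptyP
    ; 𝟙-maximum = λ p → extends (subst (_≤ lenP p) (sym (proj₁ (proj₂ emptyP))) (0≤ _))
        λ β l → ⊥-elim (≮0 (subst (β <_) (proj₁ (proj₂ emptyP)) l)) }

  opaque
    patch : J → (J → J) → (J → J) → J → J
    patch δ h h′ β = ifBelow (decℓ (β < δ)) (λ _ → h β) (h′ β)

    patch-below : ∀ {δ h h′ β} → β < δ → patch δ h h′ β ≡ h β
    patch-below l = ifBelow-yes (decℓ _) l

    patch-above : ∀ {δ h h′ β} → δ ≤ β → patch δ h h′ β ≡ h′ β
    patch-above {δ} {h} {h′} {β} l = ifBelow-no (decℓ (β < δ)) (≤⇒≯ l)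

  -- A successor length brings no new limit ordinal at which goodness has to be checked, so any
  -- regressive value may be appended.
  append : ∀ q v → (0J < lenP q → v < lenP q) →
    Σ[ q′ ∈ J ] q′ ≲ₚ q × lenP q′ ≡ sucJ (lenP q) × hP q′ (lenP q) ≡ v
  append q v v< = q′ , extends (subst (lenP q ≤_) (sym e) (inj₁ (<suc _)))
      (λ β l → trans (e₁ β (<-trans l (<suc _))) (patch-below l)) , e , trans (e₁ _ (<suc _)) (patch-above ≤-refl)
    where
    h : J → J
    h = patch (lenP q) (hP q) (λ _ → v)
    valid : ValidP (sucJ (lenP q)) h
    valid = record
      { regressive = λ β l p → [ (λ m → subst (_< β) (sym (patch-below m)) (regressive (validP q) β m p)) ,
          (λ { refl → subst (_< β) (sym (patch-above ≤-refl)) (v< p) }) ]′ (<suc⇒≤ l)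
      ; good = λ γ l lim → good-resp (λ β m → sym (patch-below (<-≤-trans m (limit≤suc lim l))))
          (good (validP q) γ (limit≤suc lim l) lim) }
    q′ : J
    q′ = proj₁ (mkP _ h valid)
    e : lenP q′ ≡ sucJ (lenP q)
    e = proj₁ (proj₂ (mkP _ h valid))
    e₁ : ∀ β → β < sucJ (lenP q) → hP q′ β ≡ h β
    e₁ = proj₂ (proj₂ (mkP _ h valid))

  -- Pad with the value 0. At a limit above the old length, the nonzero ordinals from the old length
  -- on are a club all of whose members are sent to 0, hence out of the club.
  lengthen : ∀ q b → Σ[ q′ ∈ J ] q′ ≲ₚ q × b ≤ lenP q′
  lengthen q b with <⊎≥ b (lenP q)
  ... | inj₁ l = q , ≲ₚ-refl , inj₁ l
  ... | inj₂ l = let q′ , e , e₁ = mkP b h valid in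
      q′ , extends (subst (lenP q ≤_) (sym e) l) (λ β m → trans (e₁ β (<-≤-trans m l)) (patch-below m)) ,
      inj₂ (sym e)
    where
    h : J → J
    h = patch (lenP q) (hP q) (λ _ → 0J)
    valid : ValidP b h
    valid = record
      { regressive = λ β m p → [ (λ k → subst (_< β) (sym (patch-below k)) (regressive (validP q) β k p)) ,
          (λ k → subst (_< β) (sym (patch-above k)) p) ]′ (<⊎≥ β (lenP q))
      ; good = λ γ m lim → [ far γ lim ,
          (λ k → good-resp (λ β n → sym (patch-below (<-≤-trans n k))) (good (validP q) γ k lim)) ]′
          (<⊎≥ (lenP q) γ) }
      where
      far : ∀ γ → LimJ γ → lenP q < γ → Good h γ
      far γ lim k = (λ β → (lenP q ≤ β) × (0J < β)) ,
        (λ β n → let c , a , a′ , cγ = maxBelow k (proj₂ lim β n) in c ,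
          ≤-trans (inj₁ (<suc β)) a′ , cγ , a , <-≤-trans (≤-<-trans (0≤ β) (<suc β)) a′) ,
        (λ δ n limδ f → let c , _ , c<δ , a , _ = f 0J (proj₁ limδ) in ≤-trans a (inj₁ c<δ) , proj₁ limδ) ,
        λ c c′ n n′ (a , _) (_ , p′) e → <-irrefl (subst (0J <_) (trans (sym e) (patch-above a)) p′)

  module SP = Semantics ℙ

  -- The forcing ℝ of conditions with threads

  module Threading where
    -- `Prom α c C q` is what a thread with member set C promises about row α at its member c, seen
    -- from the condition q. It is abstract because threads are used twice: with a trivial promise
    -- for the distributivity of ℙ, and then with one that depends on a matrix and on that
    -- distributivity.
    record Promise : Set (suc (suc ℓ)) where
      field
        Prom      : J → J → (J → Set ℓ) → J → Set (suc ℓ)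
        prom-mono : ∀ {α c C q q′} → q′ ≲ₚ q → Prom α c C q → Prom α c C q′
        prom-resp : ∀ {α c q} {C C′ : J → Set ℓ} → (∀ β → β < c → C β → C′ β) → (∀ β → β < c → C′ β → C β) →
          Prom α c C q → Prom α c C′ q

    module Threads (p* : J) (0<δ* : 0J < lenP p*) (promise : Promise) where
      open Promise promise

      δ* : J
      δ* = lenP p*

      -- At a member c of the set coded by a, the value a c is the row promised at c.
      C[_] : (J → J) → J → Set ℓ
      C[ a ] c = a c < c

      LimitOf : (J → Set ℓ) → J → Set ℓ
      LimitOf C γ = ∀ β → β < γ → Σ[ c ∈ J ] β ≤ c × c < γ × C c

      Agree : J → J → (J → J) → Set ℓ
      Agree q c h = c ≤ lenP q × (∀ β → β < c → hP q β ≡ h β)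

      -- Below δ* the function a is the identity, so members start at δ*. In `promised` the bound
      -- `c′ ≤ a c` puts the promised row beyond all earlier members, which makes the promised rows
      -- unbounded. The promise is made for all conditions that agree with h up to c, since the
      -- thread determines h below c but no particular code for it.
      record ValidR (δ : J) (h a : J → J) : Set (suc ℓ) where
        field
          above-base : δ* ≤ δ
          base       : ∀ β → β < δ* → h β ≡ hP p* β
          condition  : ValidP δ h
          baseᵃ      : ∀ β → β < δ* → a β ≡ β
          unbounded  : ∀ β → δ* ≤ β → β < δ → Σ[ c ∈ J ] β ≤ c × c < δ × C[ a ] c
          closed     : ∀ γ → γ < δ → LimJ γ → LimitOf C[ a ] γ → C[ a ] γ
          avoids     : ∀ c c′ → c < δ → c′ < δ → C[ a ] c → C[ a ] c′ → ¬ (h c ≡ c′)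
          promised   : ∀ c → c < δ → C[ a ] c → (LimJ c × LimitOf C[ a ] c) ⊎
            ((∀ c′ → c′ < c → C[ a ] c′ → c′ ≤ a c) × (∀ q → Agree q c h → Prom (a c) c C[ a ] q))
      open ValidR public

      C≥δ* : ∀ {δ h a} → ValidR δ h a → ∀ c → C[ a ] c → δ* ≤ c
      C≥δ* v c k = ≮⇒≥ λ l → <-irrefl (subst (_< c) (baseᵃ v c l) k)

      module _ {δ} {h a h′ a′ : J → J} (eh : ∀ β → β < δ → h β ≡ h′ β) (ea : ∀ β → β < δ → a β ≡ a′ β) where
        C-to : ∀ c → c < δ → C[ a ] c → C[ a′ ] c
        C-to c l k = subst (_< c) (ea c l) k
        C-from : ∀ c → c < δ → C[ a′ ] c → C[ a ] c
        C-from c l k = subst (_< c) (sym (ea c l)) k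

        limitOf-to : ∀ γ → γ ≤ δ → LimitOf C[ a ] γ → LimitOf C[ a′ ] γ
        limitOf-to γ l f β m = let c , b , n , k = f β m in c , b , n , C-to c (<-≤-trans n l) k

        limitOf-from : ∀ γ → γ ≤ δ → LimitOf C[ a′ ] γ → LimitOf C[ a ] γ
        limitOf-from γ l f β m = let c , b , n , k = f β m in c , b , n , C-from c (<-≤-trans n l) k

        promised-to : ∀ c → c < δ →
          (LimJ c × LimitOf C[ a ] c) ⊎ ((∀ c′ → c′ < c → C[ a ] c′ → c′ ≤ a c) × (∀ q → Agree q c h → Prom (a c) c C[ a ] q)) →
          (LimJ c × LimitOf C[ a′ ] c) ⊎ ((∀ c′ → c′ < c → C[ a′ ] c′ → c′ ≤ a′ c) × (∀ q → Agree q c h′ → Prom (a′ c) c C[ a′ ] q))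
        promised-to c l (inj₁ (lim , f)) = inj₁ (lim , limitOf-to c (inj₁ l) f)
        promised-to c l (inj₂ (f , g)) = inj₂ (
          (λ c′ m k → subst (c′ ≤_) (ea c l) (f c′ m (C-from c′ (<-trans m l) k))) ,
          λ q (o , e) → subst (λ α → Prom α c C[ a′ ] q) (ea c l)
            (prom-resp (λ β m → C-to β (<-trans m l)) (λ β m → C-from β (<-trans m l))
              (g q (o , λ β m → trans (e β m) (sym (eh β (<-trans m l)))))))

        validR-resp : ValidR δ h a → ValidR δ h′ a′
        validR-resp v = record
          { above-base = above-base v
          ; base = λ β l → trans (sym (eh β (<-≤-trans l (above-base v)))) (base v β l)
          ; condition = validP-resp eh (condition v)
          ; baseᵃ = λ β l → trans (sym (ea β (<-≤-trans l (above-base v)))) (baseᵃ v β l)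
          ; unbounded = λ β l m → let c , b , n , k = unbounded v β l m in c , b , n , C-to c n k
          ; closed = λ γ l lim f → C-to γ l (closed v γ l lim (limitOf-from γ (inj₁ l) f))
          ; avoids = λ c c′ l l′ k k′ e → avoids v c c′ l l′ (C-from c l k) (C-from c′ l′ k′) (trans (eh c l) e)
          ; promised = λ c l k → promised-to c l (promised v c l (C-from c l k)) }

      baseR : ValidR δ* (hP p*) (λ β → β)
      baseR = record
        { above-base = ≤-refl ; base = λ _ _ → refl ; condition = validP p*
        ; baseᵃ = λ _ _ → refl
        ; unbounded = λ β l m → ⊥-elim (≤⇒≯ l m)
        ; closed = λ γ l lim f → let c , _ , _ , k = f 0J (proj₁ lim) in ⊥-elim (<-irrefl k)
        ; avoids = λ c c′ l l′ k → ⊥-elim (<-irrefl k)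
        ; promised = λ c l k → ⊥-elim (<-irrefl k) }

      private
        Raw : Set (suc ℓ)
        Raw = Σ[ δ ∈ J ] Σ[ h ∈ (J → J) ] Σ[ a ∈ (J → J) ] ValidR δ h a

        decodeR : ∀ x → Dec (ValidR (length x) (firsts x) (seconds x)) → Raw
        decodeR x (yes v) = _ , _ , _ , v
        decodeR x (no _) = _ , _ , _ , baseR

        decodeR-yes : ∀ x d → ValidR (length x) (firsts x) (seconds x) → let δ , h , a , _ = decodeR x d in
          δ ≡ length x × (∀ β → h β ≡ firsts x β) × (∀ β → a β ≡ seconds x β)
        decodeR-yes x (yes _) _ = refl , (λ _ → refl) , (λ _ → refl)
        decodeR-yes x (no n) v = ⊥-elim (n v)

      opaque
        lenR : J → J
        lenR x = proj₁ (decodeR x (dec _))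

        hR aR : J → J → J
        hR x = proj₁ (proj₂ (decodeR x (dec _)))
        aR x = proj₁ (proj₂ (proj₂ (decodeR x (dec _))))

        validR : ∀ x → ValidR (lenR x) (hR x) (aR x)
        validR x = proj₂ (proj₂ (proj₂ (decodeR x (dec _))))

        mkR : ∀ δ h a → ValidR δ h a → Σ[ x ∈ J ] lenR x ≡ δ ×
          (∀ β → β < δ → hR x β ≡ h β) × (∀ β → β < δ → aR x β ≡ a β)
        mkR δ h a v =
          let x , e , e₁ , e₂ = encode₂ δ h a
              w = subst (λ δ → ValidR δ (firsts x) (seconds x)) (sym e)
                    (validR-resp (λ β l → sym (e₁ β l)) (λ β l → sym (e₂ β l)) v)
              d , d₁ , d₂ = decodeR-yes x (dec _) w
          in x , trans d e , (λ β l → trans (d₁ β) (e₁ β l)) , (λ β l → trans (d₂ β) (e₂ β l))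

      CR : J → J → Set ℓ
      CR x = C[ aR x ]

      infix 4 _≲ᵣ_
      record _≲ᵣ_ (x y : J) : Set ℓ where
        constructor extendsR
        field
          lenR≤  : lenR y ≤ lenR x
          agreeʰ : ∀ β → β < lenR y → hR x β ≡ hR y β
          agreeᵃ : ∀ β → β < lenR y → aR x β ≡ aR y β
      open _≲ᵣ_ public

      ≲ᵣ-refl : ∀ {x} → x ≲ᵣ x
      ≲ᵣ-refl = extendsR ≤-refl (λ _ _ → refl) (λ _ _ → refl)

      ≲ᵣ-trans : ∀ {x y z} → x ≲ᵣ y → y ≲ᵣ z → x ≲ᵣ z
      ≲ᵣ-trans (extendsR l e f) (extendsR l′ e′ f′) = extendsR (≤-trans l′ l)
        (λ β m → trans (e β (<-≤-trans m l′)) (e′ β m)) (λ β m → trans (f β (<-≤-trans m l′)) (f′ β m))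

      CR-≲ : ∀ {x y} → x ≲ᵣ y → ∀ {c} → c < lenR y → CR y c → CR x c
      CR-≲ l m k = subst (_< _) (sym (agreeᵃ l _ m)) k

      CR-≲⁻¹ : ∀ {x y} → x ≲ᵣ y → ∀ {c} → c < lenR y → CR x c → CR y c
      CR-≲⁻¹ l m k = subst (_< _) (agreeᵃ l _ m) k

      private
        top : Σ[ x ∈ J ] lenR x ≡ δ* × (∀ β → β < δ* → hR x β ≡ hP p* β) × (∀ β → β < δ* → aR x β ≡ β)
        top = mkR δ* (hP p*) (λ β → β) baseR

      topR : J
      topR = proj₁ top

      ≲-topR : ∀ x → x ≲ᵣ topR
      ≲-topR x = let t , e , e₁ , e₂ = top in extendsR (subst (_≤ lenR x) (sym e) (above-base (validR x)))
        (λ β l → let l′ = subst (β <_) e l in trans (base (validR x) β l′) (sym (e₁ β l′)))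
        (λ β l → let l′ = subst (β <_) e l in trans (baseᵃ (validR x) β l′) (sym (e₂ β l′)))

      ℝ : ForcingNotion ℓ
      ℝ = record
        { preorder = preorder-on-J ≲ᵣ-refl ≲ᵣ-trans
        ; 𝟙 = topR ; 𝟙-maximum = ≲-topR }

      private
        π′ : ∀ x → Σ[ p ∈ J ] lenP p ≡ lenR x × (∀ β → β < lenR x → hP p β ≡ hR x β)
        π′ x = mkP (lenR x) (hR x) (condition (validR x))

      opaque
        π : J → J
        π x = proj₁ (π′ x)

        lenP-π : ∀ x → lenP (π x) ≡ lenR x
        lenP-π x = proj₁ (proj₂ (π′ x))

        hP-π : ∀ {x β} → β < lenR x → hP (π x) β ≡ hR x β
        hP-π {x} {β} l = proj₂ (proj₂ (π′ x)) β l

      π-mono : ∀ {x y} → x ≲ᵣ y → π x ≲ₚ π y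
      π-mono {x} {y} (extendsR l e _) = extends (subst (_≤ _) (sym (lenP-π y)) (subst (_ ≤_) (sym (lenP-π x)) l))
        λ β m → let m′ = subst (β <_) (lenP-π y) m in
          trans (hP-π (<-≤-trans m′ l)) (trans (e β m′) (sym (hP-π m′)))

      π≲p* : ∀ x → π x ≲ₚ p*
      π≲p* x = extends (subst (δ* ≤_) (sym (lenP-π x)) (above-base (validR x)))
        λ β l → trans (hP-π (<-≤-trans l (above-base (validR x)))) (base (validR x) β l)

      -- Lower bounds

      module _ (E : J → Set ℓ) (e₀ : Σ J E)
        (directed : ∀ x y → E x → E y → Σ[ z ∈ J ] E z × z ≲ᵣ x × z ≲ᵣ y)
        (b : J) (bounded-by : ∀ x → E x → lenR x ≤ b) where

        private
          supremum : Σ[ δ ∈ J ] (∀ x → E x → lenR x ≤ δ) × (∀ y → (∀ x → E x → lenR x ≤ y) → δ ≤ y)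
          supremum = leastℓ (b , bounded-by)

          δ : J
          δ = proj₁ supremum

          compatible : ∀ {x y β} → E x → E y → β < lenR x → β < lenR y → hR x β ≡ hR y β × aR x β ≡ aR y β
          compatible {x} {y} {β} ex ey l m = let z , _ , k , k′ = directed x y ex ey in
            trans (sym (agreeʰ k β l)) (agreeʰ k′ β m) , trans (sym (agreeᵃ k β l)) (agreeᵃ k′ β m)

          module Attained (x : J) (ex : E x) (e : lenR x ≡ δ) where
            below : ∀ y → E y → x ≲ᵣ y
            below y ey = extendsR (subst (lenR y ≤_) (sym e) (proj₁ (proj₂ supremum) y ey))
              (λ β l → proj₁ (compatible ex ey (<-≤-trans l (subst (lenR y ≤_) (sym e) (proj₁ (proj₂ supremum) y ey))) l))
              (λ β l → proj₂ (compatible ex ey (<-≤-trans l (subst (lenR y ≤_) (sym e) (proj₁ (proj₂ supremum) y ey))) l))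

          module Limit (not : ∀ x → E x → lenR x < δ) where
            covers : ∀ β → β < δ → Σ[ x ∈ J ] E x × β < lenR x
            covers β l = by-contradictionℓ λ n → ≤⇒≯ (proj₂ (proj₂ supremum) β λ x ex → ≮⇒≥ λ k → n (x , ex , k)) l

            at : ∀ β → Dec (Σ[ x ∈ J ] E x × β < lenR x) → (J → J → J) → J
            at β (yes (x , _)) f = f x β
            at β (no _) f = β

            h a : J → J
            h β = at β (decℓ _) hR
            a β = at β (decℓ _) aR

            h-eq : ∀ {x β} → E x → β < lenR x → h β ≡ hR x β
            h-eq {x} {β} ex l = go (decℓ _)
              where
              go : (d : Dec (Σ[ x ∈ J ] E x × β < lenR x)) → at β d hR ≡ hR x β
              go (yes (y , ey , m)) = proj₁ (compatible ey ex m l)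
              go (no n) = ⊥-elim (n (x , ex , l))

            a-eq : ∀ {x β} → E x → β < lenR x → a β ≡ aR x β
            a-eq {x} {β} ex l = go (decℓ _)
              where
              go : (d : Dec (Σ[ x ∈ J ] E x × β < lenR x)) → at β d aR ≡ aR x β
              go (yes (y , ey , m)) = proj₂ (compatible ey ex m l)
              go (no n) = ⊥-elim (n (x , ex , l))

            via : ∀ {x} → E x → ValidR (lenR x) h a
            via {x} ex = validR-resp (λ β l → sym (h-eq ex l)) (λ β l → sym (a-eq ex l)) (validR x)

            δ*<δ : δ* < δ
            δ*<δ = ≤-<-trans (above-base (validR (proj₁ e₀))) (not _ (proj₂ e₀))

            C-unbounded : ∀ β → β < δ → Σ[ c ∈ J ] β ≤ c × c < δ × C[ a ] c
            C-unbounded β l = let β′ , m , m′ , k = maxBelow l δ*<δ ; x , ex , n = covers β′ k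
                                  c , o , o′ , q = unbounded (via ex) β′ m′ n in
              c , ≤-trans m o , <-trans o′ (not x ex) , q

            avoids′ : ∀ c c′ → c < δ → c′ < δ → C[ a ] c → C[ a ] c′ → ¬ (h c ≡ c′)
            avoids′ c c′ l l′ = let c″ , m , m′ , k = maxBelow l l′ ; x , ex , n = covers c″ k in
              avoids (via ex) c c′ (≤-<-trans m n) (≤-<-trans m′ n)

            closed′ : ∀ γ → γ < δ → LimJ γ → LimitOf C[ a ] γ → C[ a ] γ
            closed′ γ l = let x , ex , n = covers γ l in closed (via ex) γ n

            good′ : ∀ γ → γ ≤ δ → LimJ γ → Good h γ
            good′ γ (inj₁ l) lim = let x , ex , n = covers γ l in good (condition (via ex)) γ (inj₁ n) lim
            -- At the new length the union of the threads is itself the club that goodness asks for.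
            good′ γ (inj₂ refl) lim = C[ a ] , C-unbounded , closed′ , avoids′

            valid : ValidR δ h a
            valid = record
              { above-base = inj₁ δ*<δ
              ; base = base (via (proj₂ e₀))
              ; condition = record
                { regressive = λ β l → let x , ex , n = covers β l in regressive (condition (via ex)) β n
                ; good = good′ }
              ; baseᵃ = baseᵃ (via (proj₂ e₀))
              ; unbounded = λ β _ l → C-unbounded β l
              ; closed = closed′
              ; avoids = avoids′
              ; promised = λ c l → let x , ex , n = covers c l in promised (via ex) c n }

            bound : Σ[ x ∈ J ] lenR x ≡ δ × (∀ β → β < δ → hR x β ≡ h β) × (∀ β → β < δ → aR x β ≡ a β)
            bound = mkR δ h a valid

            result : Σ[ x ∈ J ] (∀ y → E y → x ≲ᵣ y) × (∀ β → β < lenR x → Σ[ y ∈ J ] E y × β < lenR y)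
            result = let x , e , e₁ , e₂ = bound in x ,
              (λ y ey → extendsR (subst (lenR y ≤_) (sym e) (inj₁ (not y ey)))
                (λ β l → trans (e₁ β (<-trans l (not y ey))) (h-eq ey l))
                (λ β l → trans (e₂ β (<-trans l (not y ey))) (a-eq ey l))) ,
              λ β l → covers β (subst (β <_) e l)

        opaque
          -- A condition that attains the supremum of the lengths is below all the others by
          -- directedness; if there is none, the union is a condition. The last clause keeps the
          -- bound no longer than necessary, so that lengths of limits can be computed.
          lower-bound : Σ[ x ∈ J ] (∀ y → E y → x ≲ᵣ y) × (∀ β → β < lenR x → Σ[ y ∈ J ] E y × β < lenR y)
          lower-bound with decℓ (Σ[ x ∈ J ] E x × lenR x ≡ δ)
          ... | yes (x , ex , e) = x , Attained.below x ex e , λ β l → x , ex , l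
          ... | no n = Limit.result λ x ex → [ (λ l → l) , (λ e → ⊥-elim (n (x , ex , e))) ]′ (proj₁ (proj₂ supremum) x ex)

      -- By regularity fewer than λ lengths have a bound below λ. The given injection into α is
      -- turned into a function on `J` to which `bounded` applies.
      directedClosed : DirectedClosed ℝ Λ
      directedClosed E (e₀ , directed) (α , α∈Λ , inj) =
          let x , f , _ = lower-bound E e₀ directed (proj₁ bd) (λ y ey → inj₁ (lens-bounded y ey)) in x , f
        where
        αJ : J
        αJ = proj₁ (idxΛ α∈Λ)
        embed : ∀ (β : V ℓ) → Injection (Subsetoid ℝ E) (Elements β) → Σ[ f ∈ (Σ J E → V ℓ) ] (∀ x → f x ∈ᵛ β) ×
          (∀ x y → f x ≈ᵛ f y → proj₁ x ≡ proj₁ y)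
        embed (sup A g) i = (λ x → g (Injection.to i x)) , (λ x → Injection.to i x , ≈-refl) , λ x y → Injection.injective i
        code : Σ J E → J
        code x = proj₁ (idxΛ (proj₁ Λ-ord α α∈Λ _ (proj₁ (proj₂ (embed α inj)) x)))
        code≈ : ∀ x → el (code x) ≈ᵛ proj₁ (embed α inj) x
        code≈ x = proj₂ (idxΛ (proj₁ Λ-ord α α∈Λ _ (proj₁ (proj₂ (embed α inj)) x)))
        code< : ∀ x → code x < αJ
        code< x = lt (∈ᵛ-respˡ (≈-sym (code≈ x)) (∈ᵛ-respʳ (≈-sym (proj₂ (idxΛ α∈Λ))) (proj₁ (proj₂ (embed α inj)) x)))
        lenOf : ∀ j → Dec (Σ[ x ∈ Σ J E ] code x ≡ j) → J
        lenOf j (yes ((x , _) , _)) = lenR x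
        lenOf j (no _) = 0J
        bd : Σ[ b ∈ J ] (∀ j → j < αJ → lenOf j (decℓ _) < b)
        bd = bounded αJ (λ j → lenOf j (decℓ _))
        lenOf-code : ∀ x d → lenOf (code x) d ≡ lenR (proj₁ x)
        lenOf-code x (yes (y , e)) = cong lenR (proj₂ (proj₂ (embed α inj)) y x
          (≈-trans (≈-sym (code≈ y)) (≈-trans (el-cong e) (code≈ x))))
        lenOf-code x (no n) = ⊥-elim (n (x , refl))
        lens-bounded : ∀ y → E y → lenR y < proj₁ bd
        lens-bounded y ey = subst (_< proj₁ bd) (lenOf-code (y , ey) (decℓ _)) (proj₂ bd (code (y , ey)) (code< (y , ey)))

      hasSize : HasSize ℝ Λ
      hasSize = go Λ refl
        where
        go : ∀ x → (e : x ≡ Λ) → HasSize ℝ x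
        go (sup A f) refl = record
          { to = λ j → proj₁ (el∈ j)
          ; cong = λ { refl → ≈-refl }
          ; bijective = (λ {i} {j} e → el≈⇒≡ (≈-trans (proj₂ (el∈ i)) (≈-trans e (≈-sym (proj₂ (el∈ j)))))) ,
              λ a → let j , e = idxΛ (a , ≈-refl) in
                j , λ { refl → ≈-trans (≈-sym (proj₂ (el∈ j))) e } }

      -- Chains

      opaque
        family-bound : ∀ i (f : J → J) → (Σ[ j ∈ J ] j < i) → (∀ j k → j < k → k < i → f k ≲ᵣ f j) →
          Σ[ x ∈ J ] (∀ j → j < i → x ≲ᵣ f j) × (∀ β → β < lenR x → Σ[ j ∈ J ] j < i × β < lenR (f j))
        family-bound i f (j₀ , l₀) desc =
          let b , bd = bounded i (λ j → lenR (f j))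
              x , h , k = lower-bound (λ x → Σ[ j ∈ J ] j < i × f j ≡ x) (f j₀ , j₀ , l₀ , refl) directed b
                (λ { _ (j , l , refl) → inj₁ (bd j l) })
          in x , (λ j l → h (f j) (j , l , refl)) , λ { β l → let y , (j , m , e) , n = k β l in
            j , m , subst (λ y → β < lenR y) (sym e) n }
          where
          directed : ∀ x y → (Σ[ j ∈ J ] j < i × f j ≡ x) → (Σ[ j ∈ J ] j < i × f j ≡ y) →
            Σ[ z ∈ J ] (Σ[ j ∈ J ] j < i × f j ≡ z) × z ≲ᵣ x × z ≲ᵣ y
          directed _ _ (j , l , refl) (k , m , refl) with cmp j k
          ... | inj₁ o = f k , (k , m , refl) , desc j k o m , ≲ᵣ-refl
          ... | inj₂ (inj₁ refl) = f k , (k , m , refl) , ≲ᵣ-refl , ≲ᵣ-refl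
          ... | inj₂ (inj₂ o) = f j , (j , l , refl) , ≲ᵣ-refl , desc k j o l

      opaque
        ω-chain : (s : ℕ → J) → (∀ n → s (sucℕ n) ≲ᵣ s n) →
          Σ[ x ∈ J ] (∀ n → x ≲ᵣ s n) × (∀ β → β < lenR x → Σ[ n ∈ ℕ ] β < lenR (s n))
        ω-chain s desc =
          let x , h , k = family-bound ωJ (onNum s) (0J , proj₁ ω-limit) desc′
          in x , (λ n → subst (x ≲ᵣ_) (onNum-num s n) (h (num n) (num<ω n))) , λ β l →
            let j , m , o = k β l ; n , e = <ω⇒num j m in
            n , subst (λ y → β < lenR y) (trans (cong (onNum s) (sym e)) (onNum-num s n)) o
          where
          mono : ∀ {m n} → m <ℕ n → s n ≲ᵣ s m
          mono here = desc _
          mono (there l) = ≲ᵣ-trans (desc _) (mono l)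
          desc′ : ∀ j k → j < k → k < ωJ → onNum s k ≲ᵣ onNum s j
          desc′ j k l m with <ω⇒num k m | <ω⇒num j (<-trans l m)
          ... | n , refl | n′ , refl = subst (_≲ᵣ onNum s (num n′)) (sym (onNum-num s n))
                (subst (s n ≲ᵣ_) (sym (onNum-num s n′)) (mono (num-<⁻¹ l)))
            where
            num-<⁻¹ : ∀ {m n} → num m < num n → m <ℕ n
            num-<⁻¹ {m} {n} l with cmpℕ m n
            ... | inj₁ k = k
            ... | inj₂ (inj₁ refl) = ⊥-elim (<-irrefl l)
            ... | inj₂ (inj₂ k) = ⊥-elim (<-irrefl (<-trans l (num-< k)))

      -- One-point extensions

      Member : J → J → Set ℓ
      Member x c = c < lenR x × CR x c

      -- The threads on which `π` behaves as a projection. If the members are cofinal in a limit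
      -- length, closure makes that length a member of every longer thread, but a stronger condition
      -- of ℙ may already send it to an old member. If there are no members, or the last ordinal of
      -- the domain is one, then h can be continued without creating a limit of members.
      Liftable : J → Set ℓ
      Liftable x = (∀ c → ¬ Member x c) ⊎ (Σ[ c ∈ J ] CR x c × lenR x ≡ sucJ c)

      LimitType : J → Set ℓ
      LimitType x = LimJ (lenR x) × (∀ β → β < lenR x → Σ[ c ∈ J ] β ≤ c × Member x c)

      record OnePoint (x q v α : J) : Set ℓ where
        field
          y      : J
          y≲x    : y ≲ᵣ x
          len-y  : lenR y ≡ sucJ (lenP q)
          h-old  : ∀ β → β < lenP q → hR y β ≡ hP q β
          h-new  : hR y (lenP q) ≡ v
          a-new  : aR y (lenP q) ≡ α
          C-new  : CR y (lenP q)
          C-old  : ∀ c → c < lenP q → CR y c → Member x c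

        lift-ok : Liftable y
        lift-ok = inj₂ (lenP q , C-new , len-y)

        π≲ : π y ≲ₚ q
        π≲ = extends (subst (lenP q ≤_) (sym (trans (lenP-π y) len-y)) (inj₁ (<suc _)))
          λ β l → trans (hP-π (subst (β <_) (sym len-y) (<-trans l (<suc _)))) (h-old β l)

      opaque
        -- Three things could go wrong. A limit of members in the gap below the new one is excluded
        -- by the hypothesis on x, a value v that is an old member by assumption, and an old member
        -- sent to the new one by regressivity, as members are positive.
        one-point : ∀ x q v α → q ≲ₚ π x → v < lenP q → ¬ Member x v → α < lenP q →
          (lenR x ≡ lenP q ⊎ Liftable x) →
          ((lenR x ≡ lenP q × LimitType x) ⊎ ((∀ c → Member x c → c ≤ α) × Prom α (lenP q) (Member x) q)) →
          OnePoint x q v α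
        one-point x q v α q≲ v< v∉ α< gap prom = record
            { y = y ; y≲x = extendsR (subst (lenR x ≤_) (sym len-y) (≤-trans len-x (inj₁ (<suc _))))
                (λ β l → trans (h-eq β (in-y l)) (h-x l)) (λ β l → trans (a-eq β (in-y l)) (a-x l))
            ; len-y = len-y
            ; h-old = λ β l → trans (h-eq β (<-trans l (<suc _))) (patch-below l)
            ; h-new = trans (h-eq c′ (<suc _)) (patch-above ≤-refl)
            ; a-new = trans (a-eq c′ (<suc _)) a-c′
            ; C-new = subst (_< c′) (sym (trans (a-eq c′ (<suc _)) a-c′)) α<
            ; C-old = λ c l k → a-old c l (subst (_< c) (a-eq c (<-trans l (<suc _))) k) }
          where
          c′ : J
          c′ = lenP q
          len-x : lenR x ≤ c′
          len-x = subst (_≤ c′) (lenP-π x) (len≤ q≲)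
          in-y : ∀ {β} → β < lenR x → β < sucJ c′
          in-y l = <-trans (<-≤-trans l len-x) (<suc _)
          h a : J → J
          h = patch c′ (hP q) (λ _ → v)
          -- The identity on the gap between x and `c′` makes `c′` the only new member.
          a = patch (lenR x) (aR x) (patch c′ (λ β → β) (λ _ → α))
          h-q : ∀ {β} → β < c′ → h β ≡ hP q β
          h-q = patch-below
          h-x : ∀ {β} → β < lenR x → h β ≡ hR x β
          h-x {β} l = trans (patch-below (<-≤-trans l len-x))
            (trans (agree q≲ β (subst (β <_) (sym (lenP-π x)) l)) (hP-π l))
          a-x : ∀ {β} → β < lenR x → a β ≡ aR x β
          a-x = patch-below
          a-gap : ∀ {β} → lenR x ≤ β → β < c′ → a β ≡ β
          a-gap l m = trans (patch-above l) (patch-below m)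
          a-c′ : a c′ ≡ α
          a-c′ = trans (patch-above len-x) (patch-above ≤-refl)
          a-old : ∀ c → c < c′ → C[ a ] c → Member x c
          a-old c l k with <⊎≥ c (lenR x)
          ... | inj₁ m = m , subst (_< c) (a-x m) k
          ... | inj₂ m = ⊥-elim (<-irrefl (subst (_< c) (a-gap m l) k))
          C-c′ : C[ a ] c′
          C-c′ = subst (_< c′) (sym a-c′) α<
          C-in : ∀ {c} → Member x c → C[ a ] c
          C-in {c} (l , k) = subst (_< c) (sym (a-x l)) k
          v-x : ValidR (lenR x) h a
          v-x = validR-resp (λ β l → sym (h-x l)) (λ β l → sym (a-x l)) (validR x)

          condition′ : ValidP (sucJ c′) h
          condition′ = record
            { regressive = λ β l p → [ (λ m → subst (_< β) (sym (h-q m)) (regressive (validP q) β m p)) ,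
                (λ { refl → subst (_< β) (sym (patch-above ≤-refl)) v< }) ]′ (<suc⇒≤ l)
            ; good = λ γ l lim → good-resp (λ β m → sym (h-q (<-≤-trans m (limit≤suc lim l))))
                (good (validP q) γ (limit≤suc lim l) lim) }

          no-limit : lenR x ≡ c′ ⊎ Liftable x → ∀ γ → lenR x ≤ γ → γ < c′ → LimJ γ → LimitOf C[ a ] γ → ⊥
          no-limit (inj₁ e) γ l m lim f = ≤⇒≯ l (subst (γ <_) (sym e) m)
          no-limit (inj₂ (inj₁ none)) γ l m lim f = let c , _ , n , k = f 0J (proj₁ lim) in none c (a-old c (<-trans n m) k)
          no-limit (inj₂ (inj₂ (c , k , e))) γ l m lim f =
            let c₁ , o , n , k₁ = f (sucJ c) (proj₂ lim c (<-≤-trans (subst (c <_) (sym e) (<suc c)) l))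
                p , _ = a-old c₁ (<-trans n m) k₁
            in ≤⇒≯ o (subst (c₁ <_) e p)

          closed′ : ∀ γ → γ < sucJ c′ → LimJ γ → LimitOf C[ a ] γ → C[ a ] γ
          closed′ γ l lim f with <suc⇒≤ l
          ... | inj₂ refl = C-c′
          ... | inj₁ m with <⊎≥ γ (lenR x)
          ...   | inj₁ n = closed v-x γ n lim f
          ...   | inj₂ n = ⊥-elim (no-limit gap γ n m lim f)

          h≢ : ∀ c → c < sucJ c′ → C[ a ] c → h c < c
          h≢ c l k = regressive condition′ c l (<-≤-trans 0<δ* (c≥ c l k))
            where
            c≥ : ∀ c → c < sucJ c′ → C[ a ] c → δ* ≤ c
            c≥ c l k with <suc⇒≤ l
            ... | inj₂ refl = ≤-trans (above-base (validR x)) len-x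
            ... | inj₁ m = C≥δ* (validR x) c (proj₂ (a-old c m k))

          avoids′ : ∀ c c₁ → c < sucJ c′ → c₁ < sucJ c′ → C[ a ] c → C[ a ] c₁ → ¬ (h c ≡ c₁)
          avoids′ c c₁ l l₁ k k₁ e with <suc⇒≤ l | <suc⇒≤ l₁
          ... | _ | inj₂ refl = ≤⇒≯ (<suc⇒≤ l) (subst (_< c) e (h≢ c l k))
          ... | inj₁ m | inj₁ m₁ = let n , o = a-old c m k ; n₁ , o₁ = a-old c₁ m₁ k₁ in
            avoids v-x c c₁ n n₁ k k₁ e
          ... | inj₂ refl | inj₁ m₁ = v∉ (subst (Member x) (trans (sym e) (patch-above ≤-refl)) (a-old c₁ m₁ k₁))

          promised′ : ∀ c → c < sucJ c′ → C[ a ] c → (LimJ c × LimitOf C[ a ] c) ⊎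
            ((∀ c₁ → c₁ < c → C[ a ] c₁ → c₁ ≤ a c) × (∀ q → Agree q c h → Prom (a c) c C[ a ] q))
          promised′ c l k with <suc⇒≤ l
          ... | inj₁ m = promised v-x c (proj₁ (a-old c m k)) k
          ... | inj₂ refl = new prom
            where
            new : (lenR x ≡ lenP q × LimitType x) ⊎ ((∀ c → Member x c → c ≤ α) × Prom α (lenP q) (Member x) q) →
              (LimJ c′ × LimitOf C[ a ] c′) ⊎ ((∀ c₁ → c₁ < c′ → C[ a ] c₁ → c₁ ≤ a c′) × (∀ q → Agree q c′ h → Prom (a c′) c′ C[ a ] q))
            new (inj₁ (e , lim′ , lim)) = inj₁ (subst LimJ e lim′ , λ β m → let c₁ , n , o , p = lim β (subst (β <_) (sym e) m) in
                    c₁ , n , <-≤-trans o len-x , C-in (o , p))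
            new (inj₂ (f , g)) = inj₂ ((λ c₁ m k₁ → subst (c₁ ≤_) (sym a-c′) (f c₁ (a-old c₁ m k₁))) ,
                    λ q₁ (o , e) → subst (λ α → Prom α c′ C[ a ] q₁) (sym a-c′)
                      (prom-resp (λ β m mb → C-in mb) (λ β m k₁ → a-old β m k₁)
                        (prom-mono (extends o λ β m → trans (e β m) (h-q m)) g)))

          valid : ValidR (sucJ c′) h a
          valid = record
            { above-base = ≤-trans (above-base v-x) (≤-trans len-x (inj₁ (<suc _)))
            ; base = base v-x
            ; condition = condition′
            ; baseᵃ = baseᵃ v-x
            ; unbounded = λ β _ l → c′ , <suc⇒≤ l , <suc _ , C-c′
            ; closed = closed′
            ; avoids = avoids′
            ; promised = promised′ }

          code : Σ[ y ∈ J ] lenR y ≡ sucJ c′ × (∀ β → β < sucJ c′ → hR y β ≡ h β) × (∀ β → β < sucJ c′ → aR y β ≡ a β)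
          code = mkR _ h a valid
          y : J
          y = proj₁ code
          len-y : lenR y ≡ sucJ c′
          len-y = proj₁ (proj₂ code)
          h-eq : ∀ β → β < sucJ c′ → hR y β ≡ h β
          h-eq = proj₁ (proj₂ (proj₂ code))
          a-eq : ∀ β → β < sucJ c′ → aR y β ≡ a β
          a-eq = proj₂ (proj₂ (proj₂ code))

      0<lenR : ∀ x → 0J < lenR x
      0<lenR x = <-≤-trans 0<δ* (above-base (validR x))

      0∉ : ∀ x → ¬ Member x 0J
      0∉ x (l , k) = ≮0 k

      opaque
        -- A limit of members carries no promise; the row value 0 merely marks it as a member.
        limit-point : ∀ x → LimitType x → ∀ v → v < lenR x → ¬ Member x v → OnePoint x (π x) v 0J
        limit-point x lim v l n = one-point x (π x) v 0J ≲ₚ-refl (subst (v <_) (sym (lenP-π x)) l) n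
          (subst (0J <_) (sym (lenP-π x)) (0<lenR x)) (inj₁ (sym (lenP-π x))) (inj₁ (sym (lenP-π x) , lim))

      members-cofinal : ∀ x → δ* < lenR x → ∀ β → β < lenR x → Σ[ c ∈ J ] β ≤ c × Member x c
      members-cofinal x δ*<len β l =
        let β′ , o , o′ , p = maxBelow l δ*<len
            c , b , m , k = unbounded (validR x) β′ o′ p
        in c , ≤-trans o b , m , k

      -- A thread that is not liftable has members, so they are cofinal in its length. That length
      -- is a limit, since the last ordinal below a successor would be a member.
      type : ∀ x → Liftable x ⊎ LimitType x
      type x with decℓ (Liftable x)
      ... | yes l = inj₁ l
      ... | no n = inj₂ ((0<lenR x , λ y l → suc-below y l (suc≤ l)) , cofinal)
        where
        cofinal : ∀ β → β < lenR x → Σ[ c ∈ J ] β ≤ c × Member x c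
        cofinal = let c₀ , m₀ , k₀ = by-contradictionℓ λ none → n (inj₁ λ c m → none (c , m)) in
          members-cofinal x (≤-<-trans (C≥δ* (validR x) c₀ k₀) m₀)
        suc-below : ∀ y → y < lenR x → sucJ y ≤ lenR x → sucJ y < lenR x
        suc-below y l (inj₁ m) = m
        suc-below y l (inj₂ e) = let c , m , m′ , k = cofinal y l in
          ⊥-elim (n (inj₂ (y , subst (CR x) (≤-antisym (<suc⇒≤ (subst (c <_) (sym e) m′)) m) k , sym e)))

      opaque
        liftable-dense : ∀ x → Σ[ y ∈ J ] y ≲ᵣ x × Liftable y
        liftable-dense x with type x
        ... | inj₁ l = x , ≲ᵣ-refl , l
        ... | inj₂ lim = let o = limit-point x lim 0J (0<lenR x) (0∉ x) in
          OnePoint.y o , OnePoint.y≲x o , OnePoint.lift-ok o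

      -- All that the projection property requires of a promise: some condition further down can
      -- promise a new row at its own length.
      Extendible : Set (suc ℓ)
      Extendible = ∀ q → q ≲ₚ p* → (C : J → Set ℓ) → (∀ c → C c → δ* ≤ c × c < lenP q) →
        Σ[ q′ ∈ J ] Σ[ α ∈ J ] q′ ≲ₚ q × lenP q ≤ α × α < lenP q′ × Prom α (lenP q′) C q′

      module Lifting (extendible : Extendible) where

        opaque
          -- The value given to h at the new member is 0, which is never a member itself.
          lift-point : ∀ {x q} → Liftable x → q ≲ₚ π x →
            Σ[ q′ ∈ J ] Σ[ α ∈ J ] q′ ≲ₚ q × lenP q ≤ α × OnePoint x q′ 0J α
          lift-point {x} {q} lf l =
            let q′ , α , m , a , a′ , pr = extendible q (≲ₚ-trans l (π≲p* x)) (Member x) (λ c (n , k) →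
                  C≥δ* (validR x) c k , <-≤-trans n (subst (_≤ lenP q) (lenP-π x) (len≤ l)))
            in q′ , α , m , a , one-point x q′ 0J α (≲ₚ-trans m l) (≤-<-trans (0≤ _) a′) (0∉ x) a′ (inj₂ lf)
                 (inj₂ ((λ c (n , k) → ≤-trans (inj₁ (<-≤-trans n (subst (_≤ lenP q) (lenP-π x) (len≤ l)))) a) , pr))

        opaque
          -- The projection property of `π` on liftable threads. It transfers density arguments from
          -- ℙ to ℝ, and its result is liftable again so that it can be iterated.
          lift-cond : ∀ {x q} → Liftable x → q ≲ₚ π x → Σ[ y ∈ J ] y ≲ᵣ x × Liftable y × π y ≲ₚ q × lenP q < lenR y
          lift-cond lf l = let q′ , α , m , a , o = lift-point lf l in
            OnePoint.y o , OnePoint.y≲x o , OnePoint.lift-ok o , ≲ₚ-trans (OnePoint.π≲ o) m ,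
            subst (_ <_) (sym (OnePoint.len-y o)) (≤-<-trans (len≤ m) (<suc _))

  -- Distributivity of ℙ and closure points

  module Distributivity where
    open SP using (Predicate; Mono; Clubˢ; club; Statˢ; AllJ)

    nonempty : ∀ q → Σ[ q′ ∈ J ] q′ ≲ₚ q × 0J < lenP q′
    nonempty q = let q′ , l , m = lengthen q (sucJ 0J) in q′ , l , <-≤-trans (<suc 0J) m

    open Threading

    trivial : Promise
    trivial = record { Prom = λ _ _ _ _ → Lift (suc ℓ) ⊤ ; prom-mono = λ _ _ → _ ; prom-resp = λ _ _ _ → _ }

    infix 4 _⊑_
    -- The second coordinate is an ordinal that grows along a tower and records how far the earlier
    -- stages have reached.
    _⊑_ : J × J → J × J → Set ℓ
    (q , γ) ⊑ (q′ , γ′) = q ≲ₚ q′ × γ′ ≤ γ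

    ⊑-refl : ∀ {x} → x ⊑ x
    ⊑-refl = ≲ₚ-refl , ≤-refl

    ⊑-trans : ∀ {x y z} → x ⊑ y → y ⊑ z → x ⊑ z
    ⊑-trans (l , m) (l′ , m′) = ≲ₚ-trans l l′ , ≤-trans m′ m

    open Chains (J × J) _⊑_ ⊑-refl ⊑-trans using (Tower; module Tower) public

    -- ℙ inherits its closure properties from the threads with the trivial promise.
    private
     module Trivial (p* : J) (0<δ : 0J < lenP p*) where
      open Threads p* 0<δ trivial

      extendible : Extendible
      extendible q l C h = let q′ , m , e , _ = append q 0J (λ p → p) in
        q′ , lenP q , m , ≤-refl , subst (lenP q <_) (sym e) (<suc _) , _

      open Lifting extendible

      module _ (Step : J → J × J → J × J → Set (suc ℓ))
        (Step-mono : ∀ {i x q q′ γ} → q′ ≲ₚ q → Step i x (q , γ) → Step i x (q′ , γ))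
        (Step-total : ∀ i q γ → q ≲ₚ p* → Σ[ q′ ∈ J ] Σ[ γ′ ∈ J ] q′ ≲ₚ q × γ ≤ γ′ × Step i (q , γ) (q′ , γ′))
        (Step-weaken : ∀ {i q q′ γ y} → q ≲ₚ q′ → Step i (q , γ) y → Step i (q′ , γ) y) where

        private
          _⊑ᵣ_ : J × J → J × J → Set ℓ
          (x , γ) ⊑ᵣ (x′ , γ′) = x ≲ᵣ x′ × γ′ ≤ γ

          module Ch = Chains (J × J) _⊑ᵣ_ (≲ᵣ-refl , ≤-refl) (λ (l , m) (l′ , m′) → ≲ᵣ-trans l l′ , ≤-trans m′ m)

          Π : J × J → J × J
          Π (x , γ) = π x , γ

          short-closed : Ch.ShortClosed
          short-closed i f e desc =
            let x , h , _ = family-bound i (λ j → proj₁ (f j)) e λ j k l m → proj₁ (desc j k l m)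
                γ , b = bounded i (λ j → proj₂ (f j))
            in (x , γ) , λ j l → h j l , inj₁ (b j l)

          total : ∀ i s → Σ[ s′ ∈ J × J ] s′ ⊑ᵣ s × Step i (Π s) (Π s′)
          total i (x , γ) =
            let x₁ , l₁ , lf = liftable-dense x
                q , γ′ , l , k , st = Step-total i (π x₁) γ (π≲p* x₁)
                x₂ , l₂ , _ , m , _ = lift-cond lf l
            in (x₂ , γ′) , (≲ᵣ-trans l₂ l₁ , k) , Step-weaken (π-mono l₁) (Step-mono m st)

          t : Ch.Tower (topR , 0J) (λ i x y → Step i (Π x) (Π y))
          t = Ch.tower short-closed (topR , 0J) (λ i x y → Step i (Π x) (Π y)) total

          module T = Ch.Tower t

        -- Each step is made in ℙ and then caught by a thread through `lift-cond`. The limits are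
        -- taken among threads, where they exist, and everything is projected.
        ℙ-tower : Tower (p* , 0J) Step
        ℙ-tower = record
          { L = λ i → Π (T.L i) ; G = λ i → Π (T.G i)
          ; L⊑x₀ = λ i → π≲p* _ , 0≤ _
          ; G⊑L = λ i → π-mono (proj₁ (T.G⊑L i)) , proj₂ (T.G⊑L i)
          ; L⊑G = λ l → π-mono (proj₁ (T.L⊑G l)) , proj₂ (T.L⊑G l)
          ; stepᵗ = T.stepᵗ }

      module _ (Step : J → J → J → Set ℓ) (Step-mono : ∀ {b q q′ b′} → q′ ≲ₚ q → Step b q b′ → Step b q′ b′)
        (Step-total : ∀ q → q ≲ₚ p* → ∀ b → Σ[ q′ ∈ J ] q′ ≲ₚ q × (Σ[ b′ ∈ J ] Step b q′ b′)) where
       private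
        opaque
          next : (x : Σ J Liftable) → Σ[ y ∈ Σ J Liftable ] proj₁ y ≲ᵣ proj₁ x × lenR (proj₁ x) < lenR (proj₁ y) ×
            (Σ[ b′ ∈ J ] Step (lenR (proj₁ x)) (π (proj₁ y)) b′ × b′ < lenR (proj₁ y))
          next (x , lf) =
            let q₁ , l₁ , b′ , st = Step-total (π x) (π≲p* x) (lenR x)
                q₂ , l₂ , m = lengthen q₁ b′
                y , n , lf′ , o , k = lift-cond lf (≲ₚ-trans l₂ l₁)
            in (y , lf′) , n , ≤-<-trans (subst (_≤ lenP q₂) (lenP-π x) (len≤ (≲ₚ-trans l₂ l₁))) k ,
               b′ , Step-mono (≲ₚ-trans o l₂) st , ≤-<-trans m k

        start : Σ J Liftable
        start = let x , _ , lf = liftable-dense topR in x , lf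

        s′ : ℕ → Σ J Liftable
        s′ zero = start
        s′ (sucℕ n) = proj₁ (next (s′ n))

        s : ℕ → J
        s n = proj₁ (s′ n)

        step-ok : ∀ n → Σ[ b′ ∈ J ] Step (lenR (s n)) (π (s (sucℕ n))) b′ × b′ < lenR (s (sucℕ n))
        step-ok n = proj₂ (proj₂ (proj₂ (next (s′ n))))

        inc : ∀ n → lenR (s n) < lenR (s (sucℕ n))
        inc n = proj₁ (proj₂ (proj₂ (next (s′ n))))

        chain : Σ[ x ∈ J ] (∀ n → x ≲ᵣ s n) × (∀ β → β < lenR x → Σ[ n ∈ ℕ ] β < lenR (s n))
        chain = ω-chain s λ n → proj₁ (proj₂ (next (s′ n)))

        r : J
        r = proj₁ chain

        r≲ : ∀ n → r ≲ᵣ s n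
        r≲ = proj₁ (proj₂ chain)

        covers : ∀ β → β < lenR r → Σ[ n ∈ ℕ ] β < lenR (s n)
        covers = proj₂ (proj₂ chain)

        inc′ : ∀ n → lenR (s n) < lenR r
        inc′ n = <-≤-trans (inc n) (lenR≤ (r≲ (sucℕ n)))

        lim-InS : LimJ (lenR r) × InS (lenR r)
        lim-InS = ω-sup-InS (λ n → lenR (s n)) inc (lenR r) inc′ λ y l → let n , m = covers y l in n , inj₁ m

       -- Steps alternate with lifts, so the lengths increase strictly to a point x of S. The
       -- condition has length exactly x, which leaves h(x) free; `piece-stationary` depends on
       -- this.
       ω-sequence : Σ[ q′ ∈ J ] Σ[ x ∈ J ] q′ ≲ₚ p* × lenP p* ≤ x × lenP q′ ≡ x × LimJ x × InS x ×
         (∀ b → b < x → Σ[ b₁ ∈ J ] Σ[ b′ ∈ J ] b ≤ b₁ × b′ < x × Step b₁ q′ b′)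
       ω-sequence = π r , lenR r , π≲p* r , above-base (validR r) , lenP-π r , proj₁ lim-InS , proj₂ lim-InS ,
         λ b l → let n , m = covers b l ; b′ , st , k = step-ok n in
           lenR (s n) , b′ , inj₁ m , <-trans k (inc′ (sucℕ n)) , Step-mono (π-mono (r≲ (sucℕ n))) st

    module _ (Step : J → J × J → J × J → Set (suc ℓ))
      (Step-mono : ∀ {i x q q′ γ} → q′ ≲ₚ q → Step i x (q , γ) → Step i x (q′ , γ))
      (Step-weaken : ∀ {i q q′ γ y} → q ≲ₚ q′ → Step i (q , γ) y → Step i (q′ , γ) y)
      (p : J) (Step-total : ∀ i q γ → q ≲ₚ p → Σ[ q′ ∈ J ] Σ[ γ′ ∈ J ] q′ ≲ₚ q × γ ≤ γ′ × Step i (q , γ) (q′ , γ′)) where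

      tower-below : ∀ q → q ≲ₚ p → Σ[ p* ∈ J ] p* ≲ₚ q × Tower (p* , 0J) Step
      tower-below q l = let p* , m , pos = nonempty q in
        p* , m , Trivial.ℙ-tower p* pos Step Step-mono (λ i r γ n → Step-total i r γ (≲ₚ-trans n (≲ₚ-trans m l))) Step-weaken

    module _ (a : J) (D : J → J → Set (suc ℓ)) (D-mono : ∀ {ξ q q′} → q′ ≲ₚ q → D ξ q → D ξ q′)
      (p : J) (D-dense : ∀ ξ → ξ < a → ∀ q → q ≲ₚ p → Σ[ q′ ∈ J ] q′ ≲ₚ q × D ξ q′) where

      -- In a tower that enters the ξth dense set at stage ξ, `L a` lies below all stages before a.
      distribute : ∀ q → q ≲ₚ p → Σ[ q′ ∈ J ] q′ ≲ₚ q × (∀ ξ → ξ < a → D ξ q′)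
      distribute q q≲p =
          let p* , m , t = tower-below Step (λ l f k → D-mono l (f k)) (λ _ f → f) p total q q≲p in
          proj₁ (Tower.L t a) , ≲ₚ-trans (proj₁ (Tower.L⊑x₀ t a)) m ,
          λ ξ l → D-mono (proj₁ (Tower.L⊑G t l)) (Tower.stepᵗ t ξ l)
        where
        Step : J → J × J → J × J → Set (suc ℓ)
        Step i _ (q , _) = i < a → D i q
        total : ∀ i q γ → q ≲ₚ p → Σ[ q′ ∈ J ] Σ[ γ′ ∈ J ] q′ ≲ₚ q × γ ≤ γ′ × Step i (q , γ) (q′ , γ′)
        total i q γ l with decℓ (i < a)
        ... | no n = q , γ , ≲ₚ-refl , ≤-refl , λ k → ⊥-elim (n k)
        ... | yes k = let q′ , m , d = D-dense i k q l in q′ , γ , m , ≤-refl , λ _ → d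

    distributeℓ : ∀ a (D : J → J → Set ℓ) → (∀ {ξ q q′} → q′ ≲ₚ q → D ξ q → D ξ q′) →
      ∀ p → (∀ ξ → ξ < a → ∀ q → q ≲ₚ p → Σ[ q′ ∈ J ] q′ ≲ₚ q × D ξ q′) →
      ∀ q → q ≲ₚ p → Σ[ q′ ∈ J ] q′ ≲ₚ q × (∀ ξ → ξ < a → D ξ q′)
    distributeℓ a D m p d q l = let q′ , n , h = distribute a (λ ξ q → Lift (suc ℓ) (D ξ q))
                                      (λ { n (lift k) → lift (m n k) }) p
                                      (λ ξ l q n → let q′ , o , k = d ξ l q n in q′ , o , lift k) q l in
      q′ , n , λ ξ k → lower (h ξ k)

    StepsTo : (J → J → J → Set ℓ) → J → J → J → Set ℓ
    StepsTo Step x q b = Σ[ b₁ ∈ J ] Σ[ b′ ∈ J ] b ≤ b₁ × b′ < x × Step b₁ q b′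

    module _ (Step : J → J → J → Set ℓ) (Step-mono : ∀ {b q q′ b′} → q′ ≲ₚ q → Step b q b′ → Step b q′ b′)
      (p : J) (Step-total : ∀ q → q ≲ₚ p → ∀ b → Σ[ q′ ∈ J ] q′ ≲ₚ q × (Σ[ b′ ∈ J ] Step b q′ b′)) where

      ω-closure : ∀ q → q ≲ₚ p → ∀ b₀ → Σ[ q′ ∈ J ] Σ[ x ∈ J ]
        q′ ≲ₚ q × b₀ < x × lenP q′ ≡ x × LimJ x × InS x × (∀ b → b < x → StepsTo Step x q′ b)
      ω-closure q q≲p b₀ =
        let p* , p*≲q , le = lengthen q (sucJ b₀)
            q′ , x , l , m , k = Trivial.ω-sequence p* (<-≤-trans (≤-<-trans (0≤ b₀) (<suc b₀)) le) Step Step-mono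
              (λ r n → Step-total r (≲ₚ-trans n (≲ₚ-trans p*≲q q≲p)))
        in q′ , x , ≲ₚ-trans l p*≲q , <-≤-trans (<-≤-trans (<suc b₀) le) m , k

      -- The limit points of the relation Step form a club in the extension, which a stationary set meets.
      stationary-closure : {T : Predicate} → Mono T → Statˢ T AllJ p →
        Σ[ q ∈ J ] Σ[ x ∈ J ] q ≲ₚ p × T x q × LimJ x × x < lenP q × (∀ b → b < x → StepsTo Step x q b)
      stationary-closure {T} T-mono st =
        let q , l , x , _ , (lim , h) , t = st U U-mono p ≲ₚ-refl (club unb cls)
            -- `U` says only that steps below x can be found densely often; distributivity over b <
            -- x makes a single condition decide all of them.
            q₁ , l₁ , h₁ = distributeℓ x (λ b q → StepsTo Step x q b)
              (λ { m (b₁ , b′ , k , k′ , s) → b₁ , b′ , k , k′ , Step-mono m s }) q (λ b k q m → h b k q m) q ≲ₚ-refl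
            q₂ , l₂ , k = lengthen q₁ (sucJ x)
        in q₂ , x , ≲ₚ-trans l₂ (≲ₚ-trans l₁ l) , T-mono x (≲ₚ-trans l₂ l₁) t , lim , <-≤-trans (<suc x) k ,
           λ b m → let b₁ , b′ , o , o′ , s = h₁ b m in b₁ , b′ , o , o′ , Step-mono l₂ s
        where
        U : Predicate
        U x q = LimJ x × (∀ b → b < x → ∀ q′ → q′ ≲ₚ q → Σ[ q″ ∈ J ] q″ ≲ₚ q′ × StepsTo Step x q″ b)
        U-mono : Mono U
        U-mono x l (lim , h) = lim , λ b m q′ n → h b m q′ (≲ₚ-trans n l)
        unb : ∀ β → AllJ β → ∀ q → q ≲ₚ p → Σ[ r ∈ J ] r ≲ₚ q × (Σ[ η ∈ J ] AllJ η × β ≤ η × U η r)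
        unb β _ q l = let q′ , x , m , k , _ , lim , _ , h = ω-closure q l β in
          q′ , m , x , _ , inj₁ k , lim , λ b n q″ o → q″ , ≲ₚ-refl ,
            let b₁ , b′ , k₁ , k₂ , s = h b n in b₁ , b′ , k₁ , k₂ , Step-mono o s
        cls : ∀ δ → AllJ δ → LimJ δ → ∀ q → q ≲ₚ p →
          (∀ β → β < δ → ∀ r → r ≲ₚ q → Σ[ s ∈ J ] s ≲ₚ r × (Σ[ η ∈ J ] η < δ × β ≤ η × U η s)) → U δ q
        cls δ _ lim q l f = lim , λ b m q′ n →
          let s , o , η , η<δ , k , (_ , h) = f (sucJ b) (proj₂ lim b m) q′ n
              q″ , o′ , b₁ , b′ , k₁ , k₂ , st′ = h b (<-≤-trans (<suc b) k) s ≲ₚ-refl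
          in q″ , ≲ₚ-trans o′ o , b₁ , b′ , k₁ , <-trans k₂ η<δ , st′

  -- Preservation of cofinalities

  module Preservation where
    open Distributivity
    open SP

    opaque
      -- By distributivity one condition decides all of the fewer than λ values, and the decided map
      -- lies in the ground model.
      decided-by-length : ∀ {f ε γ q} → ε ∈ᵛ Λ → CofinalGraph f ε γ q → CofinalMap ε γ
      decided-by-length {f} {ε} {γ} {q} ε∈Λ g =
          (λ i → proj₁ (val i)) , λ β → let r , m , i , j , k , o = cofinal β q′ q′≲ q′ ≲ₚ-refl in
            i , subst (λ j → el β ≤ᵛ el j) (single i j (proj₁ (val i)) r (≲-trans m q′≲) k (∈-mono m (proj₂ (val i)))) o
        where
        open CofinalGraph g
        a : J
        a = proj₁ (idxΛ ε∈Λ)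
        D : J → J → Set ℓ
        D ξ q = ∀ (i : Ix ε) → el i ≈ᵛ el ξ → Σ[ j ∈ Ix γ ] q ⊩ opair ⌜ el i ⌝ ⌜ el j ⌝ ∈ f
        D-dense : ∀ ξ → ξ < a → ∀ q₁ → q₁ ≲ₚ q → Σ[ q₂ ∈ J ] q₂ ≲ₚ q₁ × D ξ q₂
        D-dense ξ l q₁ m =
          let i , e = idx (∈ᵛ-respʳ (proj₂ (idxΛ ε∈Λ)) (un< l)) ; q₂ , n , j , k = total i q₁ m q₁ ≲ₚ-refl in
          q₂ , n , λ i′ e′ → j , subst (λ i → q₂ ⊩ opair ⌜ el i ⌝ ⌜ el j ⌝ ∈ f) (el-injective {ε} (≈-trans e (≈-sym e′))) k
        decided : Σ[ q′ ∈ J ] q′ ≲ₚ q × (∀ ξ → ξ < a → D ξ q′)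
        decided = distributeℓ a D (λ m d i e → proj₁ (d i e) , ∈-mono m (proj₂ (d i e))) q D-dense q ≲ₚ-refl
        q′ : J
        q′ = proj₁ decided
        q′≲ : q′ ≲ₚ q
        q′≲ = proj₁ (proj₂ decided)
        val : (i : Ix ε) → Σ[ j ∈ Ix γ ] q′ ⊩ opair ⌜ el i ⌝ ⌜ el j ⌝ ∈ f
        val i = let ξ , e = idxΛ (proj₁ Λ-ord ε ε∈Λ (el i) (el∈ i)) in
          proj₂ (proj₂ decided) ξ (lt (∈ᵛ-respˡ (≈-sym e) (∈ᵛ-respʳ (≈-sym (proj₂ (idxΛ ε∈Λ))) (el∈ i)))) i (≈-sym e)

    private
      not-cofinal : ∀ {ε γ} → ¬ CofinalMap ε γ → (F : Ix ε → Ix γ) → Σ[ β ∈ Ix γ ] (∀ i → ¬ (el β ≤ᵛ el (F i)))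
      not-cofinal n F = by-contradictionℓ λ k → n (F , λ β → by-contradictionℓ λ o → k (β , λ i l → o (i , l)))

      -- Counting conditions: the values decided by one condition r are bounded in γ because no
      -- ground-model map from ε is cofinal, and the λ many bounds so obtained are bounded because
      -- no map from λ is.
      decided-by-size : ∀ {f ε γ q} → Ord γ → Ix ε → CofinalGraph f ε γ q →
        ¬ CofinalMap ε γ → ¬ CofinalMap Λ γ → ⊥
      decided-by-size {f} {ε} {γ} {q} oγ i₀ g nε nΛ =
          let β* , β*-top = not-cofinal nΛ bound-of
              r , r≲q , i , j , k , o = cofinal β* q ≲ₚ-refl q ≲ₚ-refl
          in finish β* r i j (β*-top r) (subst (λ j → ¬ (el (bound-of r) ≤ᵛ el j)) (F-eq r i j r≲q k (decℓ _))
               (proj₂ (not-cofinal nε (F r)) i)) o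
        where
        open CofinalGraph g
        j₀ : Ix γ
        j₀ = proj₁ (proj₂ (proj₂ (total i₀ q ≲ₚ-refl q ≲ₚ-refl)))
        Decides : J → Ix ε → Set ℓ
        Decides r i = Σ[ j ∈ Ix γ ] r ≲ₚ q × r ⊩ opair ⌜ el i ⌝ ⌜ el j ⌝ ∈ f
        pick : ∀ r i → Dec (Decides r i) → Ix γ
        pick r i (yes (j , _)) = j
        pick r i (no _) = j₀
        F : J → Ix ε → Ix γ
        F r i = pick r i (decℓ _)
        bound-of : J → Ix γ
        bound-of r = proj₁ (not-cofinal nε (F r))
        F-eq : ∀ r i j → r ≲ₚ q → r ⊩ opair ⌜ el i ⌝ ⌜ el j ⌝ ∈ f → (d : Dec (Decides r i)) → pick r i d ≡ j
        F-eq r i j l k (yes (j′ , l′ , k′)) = single i j′ j r l k′ k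
        F-eq r i j l k (no n) = ⊥-elim (n (j , l , k))
        finish : ∀ β* r (i : Ix ε) j → ¬ (el β* ≤ᵛ el (bound-of r)) → ¬ (el (bound-of r) ≤ᵛ el j) → el β* ≤ᵛ el j → ⊥
        finish β* r i j n m o with trichotomy (Ord-∈ oγ (el∈ β*)) (Ord-∈ oγ (el∈ (bound-of r)))
        ... | inj₁ l = n (inj₁ l)
        ... | inj₂ (inj₁ e) = n (inj₂ e)
        ... | inj₂ (inj₂ l) with o
        ...   | inj₁ l′ = m (inj₁ (Ord-trans (Ord-∈ oγ (el∈ j)) l l′))
        ...   | inj₂ e = m (inj₁ (∈ᵛ-respʳ e l))

    hcm-respˡ : ∀ {α α′ γ p} → p ⊩ α ≐ α′ → E.HasCofinalMap α γ p → E.HasCofinalMap α′ γ p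
    hcm-respˡ e h q₀ l₀ = let q , l , f , (on , into) , c = h q₀ l₀ in
      q , l , f , (un-funOn (functionOn-resp ≐-refl (≐-mono (≲-trans l l₀) e) (funOn on)) , into) , c

    -- Domains below λ are covered by distributivity, the others by the size of ℙ.
    no-shorter : ∀ {δ γ ε p} → G.IsCof δ γ → ε ∈ᵛ δ → E.HasCofinalMap ⌜ ε ⌝ ⌜ γ ⌝ p → ⊥
    no-shorter {δ} {γ} {ε} {p} (oγ′ , oδ′ , _ , none) ε∈δ h with hcm-elim h p ≲-refl
    ... | q , _ , f , g = cases (trichotomy (Ord-∈ oδ ε∈δ) Λ-ord)
      where
      oγ : Ord γ
      oγ = ordinal oγ′
      oδ : Ord δ
      oδ = ordinal oδ′
      none′ : ∀ ε → ε ∈ᵛ δ → ¬ CofinalMap ε γ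
      none′ ε l c = lower (none ε (lift l) (cofinalMap⁻¹ c))
      cases : Trichotomy ε Λ → ⊥
      cases (inj₁ l) = none′ ε ε∈δ (decided-by-length l g)
      cases (inj₂ (inj₁ e)) = decided-by-size oγ (proj₁ (idx (∈ᵛ-respʳ (≈-sym e) (el∈ 0J)))) g
        (none′ ε ε∈δ) (none′ Λ (∈ᵛ-respˡ e ε∈δ))
      cases (inj₂ (inj₂ l)) = decided-by-size oγ (proj₁ (idx l)) g
        (none′ ε ε∈δ) (none′ Λ (Ord-trans oδ l ε∈δ))

    cofinalityPreserving : CofinalityPreserving ℙ
    cofinalityPreserving γ δ c@(oγ , oδ , h , none) p =
      ordinal⌜⌝ (ordinal oγ) , ordinal⌜⌝ (ordinal oδ) , hcm-intro (cofinalMap h) ≐-refl ≐-refl ,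
      λ ε q l k r m h′ → ⊥-lift (
        let s , n , ε′ , o , e = ∈-⌜⌝ {y = δ} (∈-mono m (mem (lower k))) r ≲-refl
        in no-shorter c o (hcm-respˡ e (dense-mono n h′)))

  -- Failure of sDSR(1) for the sets S_α

  module GenericSequence where
    open Distributivity
    open Preservation
    open SP

    ordinal-resp : ∀ {x y p} → p ⊩ x ≐ y → E.Ordinal x p → E.Ordinal y p
    ordinal-resp e (t , u) = transitive-resp e t ,
      λ z q l h → u z q l (lift (un-mem (∈-respʳ (≐-sym (≐-mono l e)) (mem (lower h)))))

    isCof-respʳ : ∀ {δ γ γ′ p} → p ⊩ γ ≐ γ′ → E.IsCof δ γ p → E.IsCof δ γ′ p
    isCof-respʳ e (oγ , oδ , h , n) = ordinal-resp e oγ , oδ , hcm-resp e h ,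
      λ ε q l k r m h′ → n ε q l k r m (hcm-resp (≐-sym (≐-mono (≲-trans m l) e)) h′)

    -- No ordinal below λ acquires cofinality ω, because a cofinal map from ω is decided by a single
    -- condition.
    isSω-forced : ∀ p → E.IsSω ⌜ S ⌝ ⌜ Λ ⌝ p
    isSω-forced p x =
      (λ q l h → let d = members (mem (lower h)) in
        lift (un-mem (∈-local (dense-map d λ { r m (j , _ , e) → ∈-respˡ (≐-sym e) ord∈Λ }))) ,
        limit-local (dense-map d λ { r m (j , s , e) → limit-resp (≐-sym e) (limit-ord (proj₁ (InS⇒ s))) }) ,
        dense-map d λ { r m (j , s , e) → ord ωJ , omega-forced , isCof-respʳ (≐-sym e)
          (cofinalityPreserving (el j) (el ωJ) (limit-isCof (proj₁ (InS⇒ s)) (proj₂ (InS⇒ s))) r) }) ,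
      λ q l (h , lim , c) → lift (un-mem (∈-local (dense (∈-Λ (mem (lower h))) λ { r m (j , e) →
        dense-map (dense-mono m c) λ { s n (w , ow , _ , _ , hc , _) →
          ∈-respˡ (≐-sym (≐-mono n e)) (⌜⌝-∈ (InS⇐ (limit-ord⁻¹ e (limit-mono m lim))
            (cofJ (countable (hcm-respˡ (omega-unique ow) (hcm-resp (≐-mono n e) hc)))))) } })))
      where
      members : ∀ {q} → q ⊩ x ∈ ⌜ S ⌝ → Dense q (λ r → Σ[ j ∈ J ] InS j × r ⊩ x ≐ ord j)
      members h = dense-map (∈-⌜⌝ h) λ { r m (y , k , e) → let j , e′ , s = S⊆Λ k in
        j , s , ≐-trans e (⌜⌝-≈ (≈-sym e′)) }
      countable : ∀ {j s} → E.HasCofinalMap (ord ωJ) (ord j) s → CofinalMap (el ωJ) (el j)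
      countable {s = s} h = let _ , _ , _ , g = hcm-elim h s ≲ₚ-refl in decided-by-length (el∈ ωJ) g

    -- S_α = {β ∈ S : h(β) = α}
    Piece : J → Predicate
    Piece α x q = InS x × x < lenP q × hP q x ≡ α

    piece-mono : ∀ {α} → Mono (Piece α)
    piece-mono x l (s , m , e) = s , <-≤-trans m (len≤ l) , trans (agree l x m) e

    -- Closing off under entering `U` from α on gives a point x of the club in S, for a condition of
    -- length exactly x. As α < x, the value α may be appended at x.
    piece-stationary : ∀ α p → Statˢ (Piece α) AllJ p
    piece-stationary α p U U-mono q q≲p (club unb cls) =
      let q₁ , x , l , α<x , e , lim , s , h = ω-closure Step (λ { m (η , a , b , u) → η , a , b , U-mono η m u }) q
              (λ q₁ l b → let r , m , η , _ , a , u = unb b _ q₁ l in r , m , η , η , a , ≤-refl , u) q ≲ₚ-refl α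
          u : U x q₁
          u = cls x _ lim q₁ l λ β k r m → r , ≲ₚ-refl ,
            let b₁ , b′ , a , b , η , c , d , u = h β k in η , ≤-<-trans d b , ≤-trans a c , U-mono η m u
          q₂ , m , e₁ , e₂ = append q₁ α (λ _ → subst (α <_) (sym e) α<x)
      in q₂ , ≲ₚ-trans m l , x , _ , U-mono x m u , s , subst (x <_) (sym e₁) (subst (_< sucJ (lenP q₁)) e (<suc _)) ,
         subst (λ x → hP q₂ x ≡ α) e e₂
      where
      Step : J → J → J → Set ℓ
      Step b q b′ = Σ[ η ∈ J ] b ≤ η × η ≤ b′ × U η q

    private
      row : J → Name ℙ
      row α = graphN {Lift ℓ ⊤} (λ _ → ord 0J) (λ _ → sub (Piece α)) (λ _ → 𝟙)

      seq : Name ℙ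
      seq = graphN {J} ord row (λ _ → 𝟙)

      seq-on : ∀ {p} → FunOn seq ⌜ Λ ⌝ p
      seq-on = graphN-functionOn (λ α _ _ _ → ord∈Λ)
        (λ x q l h → dense-map (∈-Λ h) λ { r m (j , e) → j , 𝟙-maximum r , e })
        λ a a′ q l _ _ e → subst (λ a′ → q ⊩ row a ≐ row a′) (ord-≡ e) ≐-refl

      row-on : ∀ {α p} → FunOn (row α) (ord 1J) p
      row-on = graphN-functionOn (λ _ _ _ _ → ord-< (<suc 0J))
        (λ x q l h → dense-map (∈-ord h) λ { r m (j , k , e) → _ , 𝟙-maximum r ,
          subst (λ j → r ⊩ x ≐ ord j) (≤-antisym (<suc⇒≤ k) (0≤ j)) e })
        λ _ _ _ _ _ _ _ → ≐-refl

      one-forced : ∀ {p} → E.IsOne (ord 1J) p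
      one-forced y =
        (λ q l h z r m k → ⊥-lift (
          let s , n , j , j<1 , e = ∈-ord (∈-mono m (mem (lower h))) r ≲ₚ-refl
              _ , _ , i , i<j , _ = ∈-ord (∈-respʳ e (∈-mono n (mem (lower k)))) s ≲ₚ-refl
          in ≤⇒≯ (≤-trans (<suc⇒≤ j<1) (0≤ i)) i<j)) ,
        λ q l em → lift (un-mem (∈-respˡ (extensionality
          (λ z r m k → ⊥-elim (let _ , _ , i , i<0 , _ = ∈-ord k r ≲ₚ-refl in ≮0 i<0))
          (λ z r m k → ⊥-elim (lower (em z r m (lift (un-mem k)))))) (ord-< {0J} {1J} (<suc 0J))))

      stationary-resp : ∀ {T T′ γ p} → p ⊩ T ≐ T′ → E.Stationary T γ p → E.Stationary T′ γ p
      stationary-resp e st C q l c = dense-map (st C q l c) λ { r m (x , h , k) →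
        x , h , lift (un-mem (∈-respʳ (≐-mono (≲ₚ-trans m l) e) (mem (lower k)))) }

      piece-subset : ∀ {α p} z q → q ≲ₚ p → q ⊩ z ∈ sub (Piece α) → q ⊩ z ∈ ⌜ S ⌝
      piece-subset {α} z q l h = ∈-local (dense-map (sub-elim (piece-mono {α}) h) λ { r m (j , (s , _) , e) →
        ∈-respˡ (≐-sym e) (⌜⌝-∈ s) })

      row-entry : ∀ a {i T s} → s ⊩ opair i T ∈ row a → s ⊩ T ≐ sub (Piece a)
      row-entry a k = ≐-local (dense-map (graphN-elim k) λ { r m (_ , _ , _ , e) → e })

      piece-ok : ∀ a {T s} → s ⊩ T ≐ sub (Piece a) → E._⊆̇_ T ⌜ S ⌝ s × E.Stationary T ⌜ Λ ⌝ s
      piece-ok a {T} {s} e =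
        (λ z q l h → lift (un-mem (piece-subset {a} {s} z q l (∈-respʳ (≐-mono l e) (mem (lower h)))))) ,
        stationary-resp (≐-sym e) (statˢ⁻¹ bound-Λ (stat-weaken (λ x q l t → sub-intro t) (piece-stationary a s)))

      seq-row : ∀ {α N p} → p ⊩ opair α N ∈ seq → Dense p (λ q → Σ[ a ∈ J ] q ⊩ N ≐ row a)
      seq-row h = dense-map (graphN-elim h) λ { r m (a , _ , _ , e) → a , e }

      at-most-one : ∀ {p} → E.AtMostOne (ord 1J) p
      at-most-one = now λ s _ → ord 1J , one-forced , un-le (ord-≤ ≤-refl)

      seq-matrix : ∀ {p} → E.Matrix E.AtMostOne ⌜ Λ ⌝ ⌜ S ⌝ seq p
      seq-matrix {p} = un-funOn {seq} {⌜ Λ ⌝} {p} seq-on , λ α N q l h q₁ l₁ →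
        let r , m , a , e = seq-row (maps⇒ {seq} {α} {N} h) q₁ l₁ in
        r , m , ord 1J , at-most-one {r} , un-funOn {N} {ord 1J} {r} (functionOn-resp (≐-sym e) ≐-refl (row-on {a})) ,
        λ i T s n k → piece-ok a {T} {s} (row-entry a {i} {T} {s} (∈-respʳ (≐-mono n e) (maps⇒ {N} {i} {T} k)))

      seq-entry : ∀ α {p} → E.Entry seq (ord α) (ord 0J) (sub (Piece α)) p
      seq-entry α q l = q , ≲ₚ-refl , row α ,
        maps⇐ {seq} {ord α} {row α} (graphN-intro α (𝟙-maximum q) ≐-refl ≐-refl) ,
        maps⇐ {row α} {ord 0J} {sub (Piece α)} (graphN-intro _ (𝟙-maximum q) ≐-refl ≐-refl)

      -- A condition of length at least g carries a club C witnessing goodness at g. A stationary F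
      -- would contain some α in C, and S_α some x in C with h(x) = α, which goodness rules out.
      not-reflecting : ∀ {γ g F p} → p ⊩ γ ≐ ord g → Uncountable g → E.Stationary F γ p →
        (∀ α q → q ≲ₚ p → q ⊩ ord α ∈ F → E.Stationary (sub (Piece α)) γ q) → ⊥
      not-reflecting {γ} {g} {F} {p} e u stF all =
        let r , l , g≤ = lengthen p g
            C , unb , cls , avoid = good (validP r) g g≤ (uncountable-limit u)
            U : Predicate
            U x _ = C x × x < g
            cl : ∀ {q} → Clubˢ U (_< g) q
            cl = club (λ β b q m → q , ≲ₚ-refl , let c , o , n , k = unb β b in c , n , o , k , n)
              λ δ d lim q m f → cls δ d lim (λ β k → let _ , _ , η , o , o′ , (c , _) = f β k q ≲ₚ-refl in η , o′ , o , c) , d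
            bd = bound-ord e
            s , m , α , α<g , (Cα , _) , α∈F = statˢ bd stF U (λ _ _ k → k) r l cl
            t , n , x , x<g , (Cx , _) , x∈ = statˢ (bound-mono (≲ₚ-trans m l) bd)
              (all α s (≲ₚ-trans m l) α∈F) U (λ _ _ k → k) s ≲ₚ-refl cl
            v , o , _ , _ , hx = sub-elim′ (piece-mono {α}) x∈ t ≲ₚ-refl
        in avoid x α x<g α<g Cx Cα (trans (sym (agree (≲ₚ-trans o (≲ₚ-trans n m)) x (<-≤-trans x<g g≤))) hx)

    sDSR1-fails : ∀ p → (E.¬̇ E.sDSR1 ⌜ Λ ⌝ ⌜ S ⌝) p
    sDSR1-fails p q l h = ⊥-lift (
      let r , m , γ , γ∈Λ , uc , dF = h seq q ≲ₚ-refl seq-matrix q ≲ₚ-refl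
          s , n , g , e = ∈-Λ (mem (lower γ∈Λ)) r ≲ₚ-refl
          t , o , F , F⊆γ , stF , all = dF s n
      in not-reflecting (≐-mono o e) (uncountable-elim (≐-mono o e) λ v k → uc v (≲ₚ-trans k (≲ₚ-trans o n))) stF
           λ α v k α∈F → proj₂ (all (ord α) v k (lift (un-mem α∈F)) (ord 0J) (sub (Piece α)) v ≲ₚ-refl (seq-entry α)))

  -- Pressing down in the extension by ℙ

  module PressingDown where
    open Distributivity
    open SP using (Predicate; Mono; Clubˢ; unb; cls; club-mono; Statˢ; AllJ)

    module _ (a : J) (D : J → J → J → Set (suc ℓ)) (D-mono : ∀ {ξ q q′ b} → q′ ≲ₚ q → D ξ q b → D ξ q′ b)
      (D-up : ∀ {ξ q b b′} → b ≤ b′ → D ξ q b → D ξ q b′) where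

      -- Distributivity decides the individual bounds; regularity of λ replaces them by one.
      distribute-bounded : ∀ p → (∀ ξ → ξ < a → ∀ q → q ≲ₚ p → Σ[ q′ ∈ J ] Σ[ b ∈ J ] q′ ≲ₚ q × D ξ q′ b) →
        ∀ q → q ≲ₚ p → Σ[ q′ ∈ J ] Σ[ b ∈ J ] q′ ≲ₚ q × (∀ ξ → ξ < a → D ξ q′ b)
      distribute-bounded p dense q l =
          let b , bd = bounded a F in q′ , b , q′≲q , λ ξ k → D-up (inj₁ (bd ξ k)) (F-ok ξ k (decℓ _))
        where
        d : Σ[ q′ ∈ J ] q′ ≲ₚ q × (∀ ξ → ξ < a → Σ[ b ∈ J ] D ξ q′ b)
        d = distribute a (λ ξ q → Σ[ b ∈ J ] D ξ q b) (λ m (b , k) → b , D-mono m k) p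
              (λ ξ k q m → let q′ , b , n , h = dense ξ k q m in q′ , n , b , h) q l
        q′ : J
        q′ = proj₁ d
        q′≲q : q′ ≲ₚ q
        q′≲q = proj₁ (proj₂ d)
        at : ∀ ξ → Dec (ξ < a) → J
        at ξ c = ifBelow c (λ k → proj₁ (proj₂ (proj₂ d) ξ k)) 0J
        F : J → J
        F ξ = at ξ (decℓ _)
        F-ok : ∀ ξ → ξ < a → (c : Dec (ξ < a)) → D ξ q′ (at ξ c)
        F-ok ξ k (yes k′) = proj₂ (proj₂ (proj₂ d) ξ k′)
        F-ok ξ k (no n) = ⊥-elim (n k)

    record NonStat (T : Predicate) (q : J) : Set (suc ℓ) where
      constructor nonStat
      field
        U      : Predicate
        U-mono : Mono U
        U-club : Clubˢ U AllJ q
        misses : ∀ r → r ≲ₚ q → ∀ x → U x r → ¬ T x r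

    nonStat-mono : ∀ {T q q′} → q′ ≲ₚ q → NonStat T q → NonStat T q′
    nonStat-mono l (nonStat U m c n) = nonStat U m (club-mono l c) λ r k → n r (≲ₚ-trans k l)

    ¬stat : ∀ {T q} → ¬ Statˢ T AllJ q → Σ[ q′ ∈ J ] q′ ≲ₚ q × NonStat T q′
    ¬stat h = by-contradiction λ n → h λ U m q l c → by-contradictionℓ λ k → n (q , l , nonStat U m c
      λ r o x u t → k (r , o , x , _ , u , t))

    private
      Below : Predicate → J → Predicate
      Below T η x r = T x r × x < lenP r × hP r x < η

    module _ (T : Predicate) (T-mono : Mono T) (T-limit : ∀ x q → T x q → LimJ x) (p : J) (stat : Statˢ T AllJ p) where

      private
       -- Since the conditions are coded by ordinals, the clubs witnessing nonstationarity can be chosen for each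
       -- pair (η, q₀) separately, and the diagonal intersection is taken over all pairs below x whose witness is
       -- decided by the generic filter: no mixing of names is required.
       module Diagonal (none : ∀ q → q ≲ₚ p → ∀ η → ¬ Statˢ (Below T η) AllJ q) where
        restrict : ∀ q → Dec (q ≲ₚ p) → Σ[ q′ ∈ J ] q′ ≲ₚ p × (q ≲ₚ p → q′ ≲ₚ q)
        restrict q (yes l) = q , l , λ _ → ≲ₚ-refl
        restrict q (no n) = p , ≲ₚ-refl , λ l → ⊥-elim (n l)

        opaque
          witness : ∀ η q → Σ[ q′ ∈ J ] (q ≲ₚ p → q′ ≲ₚ q) × NonStat (Below T η) q′
          witness η q = let q₁ , l , f = restrict q (decℓ _) ; q₂ , m , w = ¬stat (none q₁ l η) in
            q₂ , (λ k → ≲ₚ-trans m (f k)) , w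

        Ψ : J → J → J
        Ψ η q = proj₁ (witness η q)

        ns : ∀ η q → NonStat (Below T η) (Ψ η q)
        ns η q = proj₂ (proj₂ (witness η q))

        open NonStat

        Decided : J → J → J → J → J → Set ℓ
        Decided b η q₀ q b′ = (q ≲ₚ Ψ η q₀ × (Σ[ c ∈ J ] b ≤ c × c ≤ b′ × U (ns η q₀) c q)) ⊎ (∀ r → r ≲ₚ q → ¬ (r ≲ₚ Ψ η q₀))

        decided-mono : ∀ {b η q₀ q q′ b′} → q′ ≲ₚ q → Decided b η q₀ q b′ → Decided b η q₀ q′ b′
        decided-mono {η = η} {q₀} l (inj₁ (k , c , m , n , u)) = inj₁ (≲ₚ-trans l k , c , m , n , U-mono (ns η q₀) c l u)
        decided-mono l (inj₂ n) = inj₂ λ r k → n r (≲ₚ-trans k l)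

        decided-up : ∀ {b η q₀ q b′ b″} → b′ ≤ b″ → Decided b η q₀ q b′ → Decided b η q₀ q b″
        decided-up l (inj₁ (k , c , m , n , u)) = inj₁ (k , c , m , ≤-trans n l , u)
        decided-up l (inj₂ n) = inj₂ n

        decide : ∀ b η q₀ q → Σ[ q′ ∈ J ] Σ[ b′ ∈ J ] q′ ≲ₚ q × Decided b η q₀ q′ b′
        decide b η q₀ q with decℓ (Σ[ r ∈ J ] r ≲ₚ q × r ≲ₚ Ψ η q₀)
        ... | no n = q , 0J , ≲ₚ-refl , inj₂ λ r l k → n (r , l , k)
        ... | yes (r , l , k) = let s , m , c , _ , o , u = unb (U-club (ns η q₀)) b _ r k in
          s , c , ≲ₚ-trans m l , inj₁ (≲ₚ-trans m k , c , o , ≤-refl , u)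

        -- The second clause puts a witness for η, with index below the closure point, into the
        -- generic filter; the first makes the closure point a limit of the club of that witness.
        Stage : J → J → J → J → Set ℓ
        Stage b η q b′ = (∀ q₀ → q₀ < b → Decided b η q₀ q b′) × (Σ[ q₀ ∈ J ] q₀ ≤ b′ × q ≲ₚ Ψ η q₀)

        stage-mono : ∀ {b η q q′ b′} → q′ ≲ₚ q → Stage b η q b′ → Stage b η q′ b′
        stage-mono l (f , q₀ , k , m) = (λ q₀ n → decided-mono l (f q₀ n)) , q₀ , k , ≲ₚ-trans l m

        stage-up : ∀ {b η q b′ b″} → b′ ≤ b″ → Stage b η q b′ → Stage b η q b″
        stage-up l (f , q₀ , k , m) = (λ q₀ n → decided-up l (f q₀ n)) , q₀ , ≤-trans k l , m

        stage : ∀ b η q → q ≲ₚ p → Σ[ q′ ∈ J ] Σ[ b′ ∈ J ] q′ ≲ₚ q × Stage b η q′ b′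
        stage b η q l =
          let q₁ , b₁ , l₁ , f = distribute-bounded b (λ q₀ q b′ → Lift (suc ℓ) (Decided b η q₀ q b′))
                (λ { m (lift d) → lift (decided-mono m d) }) (λ { m (lift d) → lift (decided-up m d) })
                p (λ q₀ _ q _ → let q′ , b′ , m , d = decide b η q₀ q in q′ , b′ , m , lift d) q l
              q₂ = Ψ η q₁
              l₂ = proj₁ (proj₂ (witness η q₁)) (≲ₚ-trans l₁ l)
              b₂ , m , n = max b₁ q₁
          in q₂ , b₂ , ≲ₚ-trans l₂ l₁ , (λ q₀ k → decided-up m (decided-mono l₂ (lower (f q₀ k)))) , q₁ , n , ≲ₚ-refl

        Step : J → J → J → Set ℓ
        Step b q b′ = ∀ η → η < b → Stage b η q b′

        total : ∀ q → q ≲ₚ p → ∀ b → Σ[ q′ ∈ J ] q′ ≲ₚ q × (Σ[ b′ ∈ J ] Step b q′ b′)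
        total q l b =
          let q′ , b′ , m , f = distribute-bounded b (λ η q b′ → Lift (suc ℓ) (Stage b η q b′))
                (λ { m (lift d) → lift (stage-mono m d) }) (λ { m (lift d) → lift (stage-up m d) })
                p (λ η _ q k → let q′ , b′ , m , d = stage b η q k in q′ , b′ , m , lift d) q l
          in q′ , m , b′ , λ η k → lower (f η k)

        resolve : ∀ {b η q₀ q b′} → q ≲ₚ Ψ η q₀ → Decided b η q₀ q b′ →
          Σ[ c ∈ J ] b ≤ c × c ≤ b′ × U (ns η q₀) c q
        resolve k (inj₁ (_ , d)) = d
        resolve {q = q} k (inj₂ never) = ⊥-elim (never q ≲ₚ-refl k)

        module Point (q x : J) (q≲p : q ≲ₚ p) (t : T x q) (x<len : x < lenP q)
          (steps : ∀ b → b < x → StepsTo Step x q b) where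
          lim : LimJ x
          lim = T-limit x q t
          -- Regressivity and x being a limit give h(x) < η < x, so the witnesses for this η have
          -- been treated below x.
          η : J
          η = sucJ (hP q x)
          η<x : η < x
          η<x = proj₂ lim _ (regressive (validP q) x x<len (proj₁ lim))
          at : Σ[ q₀ ∈ J ] q₀ < x × q ≲ₚ Ψ η q₀
          at = let b₁ , b′ , l , m , st = steps (sucJ η) (proj₂ lim η η<x)
                   _ , q₀ , k , n = st η (<-≤-trans (<suc η) l)
               in q₀ , ≤-<-trans k m , n
          point : ∀ q₀ → q₀ < x → q ≲ₚ Ψ η q₀ → ∀ β → β < x → Σ[ c ∈ J ] β ≤ c × c < x × U (ns η q₀) c q
          point q₀ l k β m =
            let y₀ , β≤ , q₀≤ , y₀<x = maxBelow m l
                y , y₀≤ , η≤ , y<x = maxBelow y₀<x η<x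
                b₁ , b′ , o , o′ , st = steps (sucJ y) (proj₂ lim y y<x)
                y<b₁ = <-≤-trans (<suc y) o
                c , n , n′ , u = resolve k (proj₁ (st η (≤-<-trans η≤ y<b₁)) q₀ (≤-<-trans (≤-trans q₀≤ y₀≤) y<b₁))
            in c , ≤-trans (≤-trans β≤ y₀≤) (≤-trans (inj₁ y<b₁) n) , ≤-<-trans n′ o′ , u
          finish : (w : Σ[ q₀ ∈ J ] q₀ < x × q ≲ₚ Ψ η q₀) → ⊥
          finish (q₀ , l , k) = misses (ns η q₀) q k x (cls (U-club (ns η q₀)) x _ lim q k λ β m r n →
              let c , o , o′ , u = point q₀ l k β m in r , ≲ₚ-refl , c , o′ , o , U-mono (ns η q₀) c n u)
              (t , x<len , <suc _)

        contradiction : ⊥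
        contradiction =
          let q , x , q≲p , t , lim , x<len , steps = stationary-closure Step (λ m f η k → stage-mono m (f η k)) p total T-mono stat
          in Point.finish q x q≲p t x<len steps (Point.at q x q≲p t x<len steps)

      -- If every bound η failed, a closure point x in T would belong to the club that misses the
      -- part of T where h < h(x) + 1, although x lies in that part. A bound for h, instead of a
      -- constant value, is what the promise refers to.
      fodor : Σ[ q ∈ J ] q ≲ₚ p × (Σ[ η ∈ J ] Statˢ (λ x r → T x r × x < lenP r × hP r x < η) AllJ q)
      fodor = by-contradiction λ n → Diagonal.contradiction λ q l η st → n (q , l , η , st)

    -- Steps that visit both clubs make a closure point a limit of each, without a name for the
    -- intersection.
    two-clubs : ∀ {T p} → Mono T → Statˢ T AllJ p → ∀ {U U′} → Mono U → Mono U′ → Clubˢ U AllJ p → Clubˢ U′ AllJ p →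
      Σ[ q ∈ J ] Σ[ x ∈ J ] q ≲ₚ p × T x q × x < lenP q × U x q × U′ x q
    two-clubs {T} {p} T-mono st {U} {U′} m m′ c c′ =
      let q , x , l , t , lim , k , h = stationary-closure Step
            (λ { n ((η , a , b , u) , (η′ , a′ , b′ , u′)) → (η , a , b , m η n u) , (η′ , a′ , b′ , m′ η′ n u′) })
            p total T-mono st
      in q , x , l , t , k ,
         cls c x _ lim q l (λ β n r o → let b₁ , b′ , e , f , ((η , i , j , u) , _) = h β n in
           r , ≲ₚ-refl , η , ≤-<-trans j f , ≤-trans e i , m η o u) ,
         cls c′ x _ lim q l (λ β n r o → let b₁ , b′ , e , f , (_ , (η , i , j , u)) = h β n in
           r , ≲ₚ-refl , η , ≤-<-trans j f , ≤-trans e i , m′ η o u)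
      where
      Step : J → J → J → Set ℓ
      Step b q b′ = (Σ[ η ∈ J ] b ≤ η × η ≤ b′ × U η q) × (Σ[ η ∈ J ] b ≤ η × η ≤ b′ × U′ η q)
      total : ∀ q → q ≲ₚ p → ∀ b → Σ[ q′ ∈ J ] q′ ≲ₚ q × (Σ[ b′ ∈ J ] Step b q′ b′)
      total q l b =
        let r , n , η , _ , o , u = unb c b _ q l ; s , n′ , η′ , _ , o′ , u′ = unb c′ b _ r (≲ₚ-trans n l)
            k , a , a′ = max η η′
        in s , ≲ₚ-trans n′ n , k , (η , o , a , m η n′ u) , (η′ , o′ , a′ , u′)

  -- Matrices in the extension by ℙ and rows that survive

  module Matrices where
    open Distributivity
    open PressingDown
    open GenericSequence
    open Threading using (Promise; module Threads)
    open Preservation using (cofinalityPreserving)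
    open SP

    <κ : ∀ {i} → i < κJ → el i ∈ᵛ κ
    <κ l = ∈ᵛ-respʳ κJ≈κ (un< l)

    <κ⁻¹ : ∀ {x} → x ∈ᵛ κ → Σ[ i ∈ J ] i < κJ × el i ≈ᵛ x
    <κ⁻¹ {x} k = let i , e = idx (∈ᵛ-respʳ (≈-sym κJ≈κ) k) ; j , e′ , l = lift-ix {κJ} i in j , l , ≈-trans e′ e

    Indestructible : Set (suc ℓ)
    Indestructible = (P : ForcingNotion ℓ) → DirectedClosed P Λ → HasSize P Λ →
      Forced P (Language.uDSR< (extension P) (check P κ) (check P Λ) (check P S))

    record IsMatrix (M : Name ℙ) (p : J) : Set (suc ℓ) where
      field
        M-on : FunOn M ⌜ Λ ⌝ p
        row  : ∀ α N q → q ≲ₚ p → q ⊩ opair α N ∈ M → Dense q λ r → Σ[ j ∈ Name ℙ ]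
          r ⊩ j ∈ ⌜ κ ⌝ × FunOn N j r × (∀ i T s → s ≲ₚ r → s ⊩ opair i T ∈ N →
            (∀ z t → t ≲ₚ s → t ⊩ z ∈ T → t ⊩ z ∈ ⌜ S ⌝) × Statˢ ⟦ T ⟧ AllJ s)

    isMatrix : ∀ {M p} → E.Matrix (λ j → j E.∈̇ ⌜ κ ⌝) ⌜ Λ ⌝ ⌜ S ⌝ M p → IsMatrix M p
    isMatrix {M} {p} (on , rows) = record
      { M-on = funOn on
      ; row = λ α N q l k q₁ l₁ →
          let r , m , j , j∈κ , f , ent = rows α N q l (maps⇐ {M} {α} {N} {q} k) q₁ l₁ in
          r , m , j , mem (lower j∈κ) , funOn f , λ i T s n k′ →
            let sub′ , st = ent i T s n (maps⇐ {N} {i} {T} {s} k′) in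
            (λ z t o h → mem (lower (sub′ z t o (lift (un-mem h))))) , statˢ bound-Λ st }

    module MatrixName {M : Name ℙ} {p₀ : J} (matrix : IsMatrix M p₀) where
      open IsMatrix matrix

      record EntryAt (α i T : Name ℙ) (q : J) : Set (suc ℓ) where
        constructor entryAt
        field un-entry : Dense q λ r → Σ[ N ∈ Name ℙ ] r ⊩ opair α N ∈ M × r ⊩ opair i T ∈ N
      open EntryAt public

      record Row (α j : J) (q : J) : Set (suc ℓ) where
        field
          N       : Name ℙ
          j₀      : J
          -- A row without entries is given the single entry S.
          j-j₀    : (0J < j₀ × j ≡ j₀) ⊎ (j₀ ≡ 0J × j ≡ 1J)
          j<κ     : j < κJ
          below   : q ≲ₚ p₀
          N-row   : q ⊩ opair (ord α) N ∈ M
          N-on    : FunOn N (ord j₀) q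
          entries : ∀ i T s → s ≲ₚ q → s ⊩ opair i T ∈ N →
            (∀ z t → t ≲ₚ s → t ⊩ z ∈ T → t ⊩ z ∈ ⌜ S ⌝) × Statˢ ⟦ T ⟧ AllJ s

        j₀≤j : j₀ ≤ j
        j₀≤j = [ (λ (_ , e) → inj₂ (sym e)) , (λ (e , _) → subst (_≤ j) (sym e) (0≤ j)) ]′ j-j₀

        0<j : 0J < j
        0<j = [ (λ (l , e) → subst (0J <_) (sym e) l) , (λ (_ , e) → subst (0J <_) (sym e) (<suc 0J)) ]′ j-j₀

      row-mono : ∀ {α j q q′} → q′ ≲ₚ q → Row α j q → Row α j q′
      row-mono l R = record { N = N ; j₀ = j₀ ; j-j₀ = j-j₀ ; j<κ = j<κ ; below = ≲ₚ-trans l below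
        ; N-row = ∈-mono l N-row ; N-on = functionOn-mono l N-on ; entries = λ i T s m → entries i T s (≲ₚ-trans m l) }
        where open Row R

      row-exists : ∀ α q → q ≲ₚ p₀ → Σ[ r ∈ J ] r ≲ₚ q × (Σ[ j ∈ J ] Row α j r)
      row-exists α q l =
        let q₁ , l₁ , N , k = functionOn-total (functionOn-mono l M-on) (ord∈Λ {α}) q ≲ₚ-refl
            q₂ , l₂ , j , j∈κ , on , ent = row (ord α) N q₁ (≲ₚ-trans l₁ l) k q₁ ≲ₚ-refl
            q₃ , l₃ , x , x∈κ , e = ∈-⌜⌝ j∈κ q₂ ≲ₚ-refl
            j₀ , j₀<κ , e′ = <κ⁻¹ x∈κ
            l₂₃ = ≲ₚ-trans l₃ l₂
            j₁ , jj , c = nonzero j₀<κ (0≤ j₀)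
        in q₃ , ≲ₚ-trans l₂₃ l₁ , j₁ , record
          { N = N ; j₀ = j₀ ; j-j₀ = jj ; j<κ = c
          ; below = ≲ₚ-trans l₂₃ (≲ₚ-trans l₁ l) ; N-row = ∈-mono l₂₃ k
          ; N-on = functionOn-resp ≐-refl (≐-trans e (⌜⌝-≈ (≈-sym e′))) (functionOn-mono l₃ on)
          ; entries = λ i T s m → ent i T s (≲ₚ-trans m l₃) }

        where
        nonzero : ∀ {j₀} → j₀ < κJ → 0J ≤ j₀ → Σ[ j ∈ J ] ((0J < j₀ × j ≡ j₀) ⊎ (j₀ ≡ 0J × j ≡ 1J)) × j < κJ
        nonzero {j₀} l (inj₁ m) = j₀ , inj₁ (m , refl) , l
        nonzero l (inj₂ e) = 1J , inj₂ (sym e , refl) , 1<κJ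

      -- β ∈ T_{α,i}, where absent entries are read as S.
      Tr : J → J → Predicate
      Tr α i β q = InS β × Small (∀ r → r ≲ₚ q → ∀ T → EntryAt (ord α) (ord i) T r → r ⊩ ord β ∈ T)

      Tr-mono : ∀ {α i} → Mono (Tr α i)
      Tr-mono x l (s , h) = s , small λ r m → large h r (≲ₚ-trans m l)

      Tr-limit : ∀ {α i} x q → Tr α i x q → LimJ x
      Tr-limit x q (s , _) = proj₁ (InS⇒ s)

      module _ {α j q} (R : Row α j q) where
        open Row R

        row-unique : ∀ {N′ r} → r ≲ₚ q → r ⊩ opair (ord α) N′ ∈ M → r ⊩ N′ ≐ N
        row-unique m k = functional (functionOn-mono (≲ₚ-trans m below) M-on) k (∈-mono m N-row)

        entry-in-row : ∀ {i T r} → r ≲ₚ q → EntryAt (ord α) i T r → r ⊩ opair i T ∈ N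
        entry-in-row m (entryAt d) = ∈-local (dense-map d λ { s n (N′ , k , k′) →
          ∈-respʳ (row-unique (≲ₚ-trans n m) k) k′ })

        entry-index : ∀ {i T r} → r ≲ₚ q → EntryAt (ord α) i T r → Dense r λ s → Σ[ i₀ ∈ J ] i₀ < j × s ⊩ i ≐ ord i₀
        entry-index m en = dense-map (∈-ord (functionOn-dom (functionOn-mono m N-on) (entry-in-row m en))) λ
          { s n (i₀ , l , e) → i₀ , <-≤-trans l j₀≤j , e }

        entry-Tr : ∀ {i T r} → r ≲ₚ q → r ⊩ opair (ord i) T ∈ N → ∀ x s → s ≲ₚ r → s ⊩ ord x ∈ T → Tr α i x s
        entry-Tr m k x s n h = ⌜⌝-∈⁻¹ (proj₁ (entries _ _ _ m k) _ s n h) , small λ t o T′ en →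
          ∈-respʳ (functional (functionOn-mono (≲ₚ-trans o (≲ₚ-trans n m)) N-on) (∈-mono (≲ₚ-trans o n) k)
            (entry-in-row (≲ₚ-trans o (≲ₚ-trans n m)) en)) (∈-mono o h)

        Tr-stationary : ∀ i → Statˢ (Tr α i) AllJ q
        Tr-stationary i with decℓ (i < j₀)
        ... | yes l = λ U U-mono q′ m c →
          let r , n , T , k = functionOn-total (functionOn-mono m N-on) (ord-< l) q′ ≲ₚ-refl
              s , o , x , _ , u , t = proj₂ (entries _ _ r (≲ₚ-trans n m) k) U U-mono r ≲ₚ-refl (club-mono n c)
          in s , ≲ₚ-trans o n , x , _ , u , entry-Tr (≲ₚ-trans n m) k x s o t
        -- An absent entry is read as S, which contains the stationary set S₀.
        ... | no ¬l = stat-weaken (λ x r m (s , _) → s , small λ t o T en → ⊥-elim (¬l (absent (≲ₚ-trans o m) en)))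
              (piece-stationary 0J q)
          where
          absent : ∀ {T t} → t ≲ₚ q → EntryAt (ord α) (ord i) T t → i < j₀
          absent m en = ord-<⁻¹ (functionOn-dom (functionOn-mono m N-on) (entry-in-row m en))

      row-length-unique : ∀ {α j j′ q} → Row α j q → Row α j′ q → j ≡ j′
      row-length-unique {α} {j} {j′} {q} R R′ = go (≤-antisym (half R R′) (half R′ R)) (Row.j-j₀ R) (Row.j-j₀ R′)
        where
        half : ∀ {j j′} (R : Row α j q) (R′ : Row α j′ q) → Row.j₀ R ≤ Row.j₀ R′
        half R R′ = ≮⇒≥ λ l →
          let r , m , T , k = functionOn-total (Row.N-on R) (ord-< l) q ≲ₚ-refl
          in <-irrefl (ord-<⁻¹ (functionOn-dom (functionOn-mono m (Row.N-on R′))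
               (∈-respʳ (row-unique R′ m (∈-mono m (Row.N-row R))) k)))
        go : ∀ {i i′} → i ≡ i′ → (0J < i × j ≡ i) ⊎ (i ≡ 0J × j ≡ 1J) → (0J < i′ × j′ ≡ i′) ⊎ (i′ ≡ 0J × j′ ≡ 1J) → j ≡ j′
        go refl (inj₁ (_ , e)) (inj₁ (_ , e′)) = trans e (sym e′)
        go refl (inj₂ (_ , e)) (inj₂ (_ , e′)) = trans e (sym e′)
        go refl (inj₁ (l , _)) (inj₂ (refl , _)) = ⊥-elim (<-irrefl l)
        go refl (inj₂ (refl , _)) (inj₁ (l , _)) = ⊥-elim (<-irrefl l)

      Outside : J → J → Predicate
      Outside a b β q = β < lenP q × ¬ (a ≤ hP q β × hP q β < b)

      outside-mono : ∀ {a b} → Mono (Outside a b)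
      outside-mono {a} {b} x l (m , n) = <-≤-trans m (len≤ l) ,
        λ (k , k′) → n (subst (a ≤_) (agree l x m) k , subst (_< b) (agree l x m) k′)

      _∩_ : Predicate → Predicate → Predicate
      (T ∩ T′) x q = T x q × T′ x q

      ∩-mono : ∀ {T T′} → Mono T → Mono T′ → Mono (T ∩ T′)
      ∩-mono m m′ x l (t , t′) = m x l t , m′ x l t′

      record GoodRow (α a b q : J) : Set (suc ℓ) where
        constructor goodRow
        field
          j   : J
          row : Row α j q
          stat : ∀ i → i < j → Statˢ (Tr α i ∩ Outside a b) AllJ q

      -- The promise: all the sets of row α stay stationary outside of the h-preimages of C below c and of [c, λ).
      Prot : J → J → (J → Set ℓ) → J → Set (suc ℓ)
      Prot α c C q = Σ[ j ∈ J ] Row α j q ×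
        (∀ i → i < j → Statˢ (λ x r → Tr α i x r × x < lenP r × hP r x < c × ¬ C (hP r x)) AllJ q)

      prot-mono : ∀ {α c C q q′} → q′ ≲ₚ q → Prot α c C q → Prot α c C q′
      prot-mono l (j , R , f) = j , row-mono l R , λ i k → stat-mono l (f i k)

      prot-resp : ∀ {α c q} {C C′ : J → Set ℓ} → (∀ β → β < c → C β → C′ β) → (∀ β → β < c → C′ β → C β) →
        Prot α c C q → Prot α c C′ q
      prot-resp f g (j , R , h) = j , R , λ i k → stat-weaken (λ x r l (t , m , n , o) → t , m , n , λ k′ → o (g _ n k′)) (h i k)

      -- If no γ works, there are κ disjoint intervals for each of which all large rows are bad.  In a row above all the
      -- bounds, two intervals are bad because of the same entry T, as the row has fewer than κ entries; then h maps
      -- almost all of T into two disjoint intervals.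
      module Intervals (p : J) (p≲p₀ : p ≲ₚ p₀)
        (none : ∀ p* → p* ≲ₚ p → ∀ γ → Σ[ q ∈ J ] q ≲ₚ p* × (Σ[ y ∈ J ] Σ[ α₀ ∈ J ]
          (∀ q′ → q′ ≲ₚ q → ∀ α → α₀ ≤ α → ¬ GoodRow α γ y q′))) where

        Step : J → J × J → J × J → Set (suc ℓ)
        Step _ (_ , γ) (q , γ′) = Σ[ y ∈ J ] Σ[ α₀ ∈ J ] y ≤ γ′ × α₀ ≤ γ′ ×
          (∀ q′ → q′ ≲ₚ q → ∀ α → α₀ ≤ α → ¬ GoodRow α γ y q′)

        total : ∀ i q γ → q ≲ₚ p → Σ[ q′ ∈ J ] Σ[ γ′ ∈ J ] q′ ≲ₚ q × γ ≤ γ′ × Step i (q , γ) (q′ , γ′)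
        total _ q γ l =
          let q′ , m , y , α₀ , n = none q l γ
              γ₁ , a , b = max γ y
              γ₂ , c , d = max γ₁ α₀
          in q′ , γ₂ , m , ≤-trans a c , y , α₀ , ≤-trans b c , d , n

        opaque
          towerᵢ : Σ[ p* ∈ J ] p* ≲ₚ p × Tower (p* , 0J) Step
          towerᵢ = tower-below Step (λ { l (y , α₀ , a , b , n) → y , α₀ , a , b , λ q′ m → n q′ (≲ₚ-trans m l) })
            (λ _ st → st) p total p ≲ₚ-refl

        open Tower (proj₂ (proj₂ towerᵢ))

        -- The ordinal recorded after κ stages has passed all the thresholds α₀, so this row is bad
        -- for each of the κ intervals.
        α* : J
        α* = proj₂ (L κJ)

        opaque
          row-at : Σ[ r ∈ J ] r ≲ₚ proj₁ (L κJ) × (Σ[ j ∈ J ] Row α* j r)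
          row-at = row-exists α* (proj₁ (L κJ)) (≲ₚ-trans (proj₁ (L⊑x₀ κJ)) (≲ₚ-trans (proj₁ (proj₂ towerᵢ)) p≲p₀))

        q₁ : J
        q₁ = proj₁ row-at

        q₁≲ : q₁ ≲ₚ proj₁ (L κJ)
        q₁≲ = proj₁ (proj₂ row-at)

        theRow : Σ[ j ∈ J ] Row α* j q₁
        theRow = proj₂ (proj₂ row-at)

        j : J
        j = proj₁ theRow

        -- Stage ξ concerns the interval from `lo ξ` to `hi ξ`. The ordinal recorded by the tower
        -- passes `hi ξ` before any later stage begins, so the intervals are disjoint.
        lo hi : J → J
        lo ξ = proj₂ (L ξ)
        hi ξ = proj₁ (stepᵗ ξ)

        not-good : ∀ ξ → ξ < κJ → ∀ q′ → q′ ≲ₚ q₁ → ¬ GoodRow α* (lo ξ) (hi ξ) q′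
        not-good ξ l q′ m = let _ , α₀ , _ , a , n = stepᵗ ξ ; k , k′ = L⊑G l in
          n q′ (≲ₚ-trans m (≲ₚ-trans q₁≲ k)) α* (≤-trans a k′)

        Bad : J → J → J → Set (suc ℓ)
        Bad ξ i q = NonStat (Tr α* i ∩ Outside (lo ξ) (hi ξ)) q

        bad-index : ∀ ξ → ξ < κJ → ∀ q → q ≲ₚ q₁ → Σ[ q′ ∈ J ] q′ ≲ₚ q × (Σ[ i ∈ J ] Lift (suc ℓ) (i < j) × Bad ξ i q′)
        bad-index ξ l q m =
          let i , h = ¬∀⇒∃ℓ {B = λ i → i < j → Statˢ (Tr α* i ∩ Outside (lo ξ) (hi ξ)) AllJ q}
                        (λ f → not-good ξ l q m (goodRow j (row-mono m (proj₂ theRow)) f))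
              i<j = by-contradictionℓ {i < j} λ n → h λ k → ⊥-elim (n k)
              q′ , n , w = ¬stat (λ st → h λ _ → st)
          in q′ , n , i , lift i<j , w

        opaque
          decided : Σ[ q ∈ J ] q ≲ₚ q₁ × (∀ ξ → ξ < κJ → Σ[ i ∈ J ] Lift (suc ℓ) (i < j) × Bad ξ i q)
          decided = distribute κJ (λ ξ q → Σ[ i ∈ J ] Lift (suc ℓ) (i < j) × Bad ξ i q)
            (λ l (i , k , w) → i , k , nonStat-mono l w) q₁ bad-index q₁ ≲ₚ-refl

        q₂ : J
        q₂ = proj₁ decided

        F : J → J
        F ξ = ifBelow (decℓ (ξ < κJ)) (λ l → proj₁ (proj₂ (proj₂ decided) ξ l)) 0J

        F-ok : ∀ ξ → ξ < κJ → F ξ < j × Bad ξ (F ξ) q₂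
        F-ok ξ l = go (decℓ (ξ < κJ))
          where
          go : (d : Dec (ξ < κJ)) → let i = ifBelow d (λ l → proj₁ (proj₂ (proj₂ decided) ξ l)) 0J in i < j × Bad ξ i q₂
          go (yes k) = let _ , lift m , w = proj₂ (proj₂ decided) ξ k in m , w
          go (no n) = ⊥-elim (n l)

        clash : ∀ ξ ξ′ → ξ < ξ′ → ∀ i → Bad ξ i q₂ → Bad ξ′ i q₂ → ⊥
        clash ξ ξ′ l i (nonStat U m c n) (nonStat U′ m′ c′ n′) =
          let q , x , k , tr , x<len , u , u′ = two-clubs (Tr-mono {α*} {i})
                (stat-mono (proj₁ (proj₂ decided)) (Tr-stationary (proj₂ theRow) i)) m m′ c c′
              in₁ : ¬ ¬ (lo ξ ≤ hP q x × hP q x < hi ξ)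
              in₁ = λ o → n q k x u (tr , x<len , o)
              in₂ : ¬ ¬ (lo ξ′ ≤ hP q x × hP q x < hi ξ′)
              in₂ = λ o → n′ q k x u′ (tr , x<len , o)
          in in₁ λ (_ , a) → in₂ λ (b , _) → ≤⇒≯ (≤-trans (≤-trans (proj₁ (proj₂ (proj₂ (stepᵗ ξ)))) (proj₂ (L⊑G l))) b) a

        contradiction : ⊥
        contradiction = case pigeonhole (Row.j<κ (proj₂ theRow)) F (λ ξ l → proj₁ (F-ok ξ l)) of λ { (ξ , ξ′ , l , l′ , e) →
          clash ξ ξ′ l (F ξ) (proj₂ (F-ok ξ (<-trans l l′))) (subst (λ i → Bad ξ′ i q₂) (sym e) (proj₂ (F-ok ξ′ l′))) }

      -- γ is fixed before y: the thread will start above γ, whereas y bounds the members it has at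
      -- some later time.
      ManyGood : J → J → Set (suc ℓ)
      ManyGood p* γ = ∀ q → q ≲ₚ p* → ∀ y α₀ → Σ[ q′ ∈ J ] q′ ≲ₚ q × (Σ[ α ∈ J ] α₀ ≤ α × GoodRow α γ y q′)

      many-good : ∀ p → p ≲ₚ p₀ → Σ[ p* ∈ J ] p* ≲ₚ p × (Σ[ γ ∈ J ] ManyGood p* γ)
      many-good p l = by-contradiction λ n → Intervals.contradiction p l λ p* m γ → by-contradiction λ k →
        n (p* , m , γ , λ q o y α₀ → by-contradiction λ k′ → k (q , o , y , α₀ , λ q′ o′ α a g → k′ (q′ , o′ , α , a , g)))

      private
        BoundedBy : J → J → J → J → J → Predicate
        BoundedBy γ y α i η x r = (Tr α i ∩ Outside γ y) x r × x < lenP r × hP r x < η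

      -- Pressing down is applied to each entry; the row has fewer than κ entries, so one bound η
      -- serves them all.
      press-row : ∀ {γ y α q} → GoodRow α γ y q →
        Σ[ q′ ∈ J ] Σ[ η ∈ J ] q′ ≲ₚ q × (Σ[ j ∈ J ] Row α j q′ × (∀ i → i < j → Statˢ (BoundedBy γ y α i η) AllJ q′))
      press-row {γ} {y} {α} {q} (goodRow j R st) =
        let q′ , η , l , f = bounds in q′ , η , l , j , row-mono l R , f
        where
        pressed : ∀ i → i < j → ∀ q₁ → q₁ ≲ₚ q → Σ[ q′ ∈ J ] Σ[ η ∈ J ] q′ ≲ₚ q₁ × Statˢ (BoundedBy γ y α i η) AllJ q′
        pressed i k q₁ m =
          let q′ , n , η , h = fodor (Tr α i ∩ Outside γ y) (∩-mono (Tr-mono {α} {i}) (outside-mono {γ} {y}))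
                (λ x r t → Tr-limit {α} {i} x r (proj₁ t)) q₁ (stat-mono m (st i k))
          in q′ , η , n , h
        opaque
          bounds : Σ[ q′ ∈ J ] Σ[ η ∈ J ] q′ ≲ₚ q × (∀ i → i < j → Statˢ (BoundedBy γ y α i η) AllJ q′)
          bounds = distribute-bounded j (λ i q η → Statˢ (BoundedBy γ y α i η) AllJ q) (λ m → stat-mono m)
            (λ m → stat-weaken λ x r _ (t , k , n) → t , k , <-≤-trans n m) q pressed q ≲ₚ-refl

      -- C is contained in the interval from γ to the length of q. A row good for this interval is
      -- pressed below some η, and lengthening past η and α yields a length at which the promise can
      -- be made.
      protectable : ∀ {p* γ} → p* ≲ₚ p₀ → γ ≤ lenP p* → ManyGood p* γ →
        ∀ q → q ≲ₚ p* → (C : J → Set ℓ) → (∀ c → C c → lenP p* ≤ c × c < lenP q) →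
        Σ[ q′ ∈ J ] Σ[ α ∈ J ] q′ ≲ₚ q × lenP q ≤ α × α < lenP q′ × Prot α (lenP q′) C q′
      protectable {p*} {γ} p*≲ γ≤ mg q l C C⊆ = extend (mg q l (lenP q) (lenP q))
        where
        protects : ∀ {α i η c q₃} → η ≤ c → Statˢ (BoundedBy γ (lenP q) α i η) AllJ q₃ →
          Statˢ (λ x r → Tr α i x r × x < lenP r × hP r x < c × ¬ C (hP r x)) AllJ q₃
        protects η≤c = stat-weaken λ { x r _ ((t , (o , out)) , _ , n) → t , o , <-≤-trans n η≤c ,
          λ k → out (≤-trans γ≤ (proj₁ (C⊆ _ k)) , proj₂ (C⊆ _ k)) }
        extend : Σ[ q₁ ∈ J ] q₁ ≲ₚ q × (Σ[ α ∈ J ] lenP q ≤ α × GoodRow α γ (lenP q) q₁) →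
          Σ[ q′ ∈ J ] Σ[ α ∈ J ] q′ ≲ₚ q × lenP q ≤ α × α < lenP q′ × Prot α (lenP q′) C q′
        extend (q₁ , l₁ , α , a , good) with press-row good
        ... | q₂ , η , l₂ , j , R , f with max η (sucJ α)
        ...   | b , b₁ , b₂ with lengthen q₂ b
        ...     | q₃ , l₃ , m = q₃ , α , ≲ₚ-trans l₃ (≲ₚ-trans l₂ l₁) , a , <-≤-trans (<suc α) (≤-trans b₂ m) ,
                    j , row-mono l₃ R , λ i k → protects {α} {i} (≤-trans b₁ m) (stat-mono l₃ (f i k))

      -- Threads that protect rows, and the matrix passed to uDSR*

      module Thread (p* : J) (p*≲p₀ : p* ≲ₚ p₀) (0<δ* : 0J < lenP p*) (γ : J) (γ≤ : γ ≤ lenP p*) (mg : ManyGood p* γ) where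

        protecting : Promise
        protecting = record { Prom = Prot ; prom-mono = λ {α} {c} {C} → prot-mono {α} {c} {C} ; prom-resp = λ {α} {c} {q} {C} {C′} → prot-resp {α} {c} {q} {C} {C′} }

        open Threads p* 0<δ* protecting public

        opaque
          extendible : Extendible
          extendible = protectable p*≲p₀ γ≤ mg

        open Lifting extendible public

        member-≲ : ∀ {x y c} → x ≲ᵣ y → Member y c → Member x c
        member-≲ l (m , k) = <-≤-trans m (lenR≤ l) , CR-≲ l m k

        opaque
          member-above : ∀ x b → Σ[ y ∈ J ] y ≲ᵣ x × Liftable y × (Σ[ c ∈ J ] b ≤ c × Member y c)
          member-above x b =
            let x₁ , l₁ , lf = liftable-dense x
                q , l , m = lengthen (π x₁) b
                q′ , α , n , _ , o = lift-point lf l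
                open OnePoint o
            in y , ≲ᵣ-trans y≲x l₁ , lift-ok , lenP q′ , ≤-trans m (len≤ n) ,
               subst (lenP q′ <_) (sym len-y) (<suc _) , C-new

        -- The row α replaces the row β: c₀ is the first member of the generic club above β, c the next one,
        -- and α is the row promised at c.
        record Selected (β α x : J) : Set ℓ where
          field
            c₀ c     : J
            c₀-in    : CR x c₀
            c-in     : Member x c
            c₀<c     : c₀ < c
            β≤c₀     : β ≤ c₀
            c₀-first : ∀ d → d < c₀ → CR x d → d < β
            c-next   : ∀ d → d < c → CR x d → d ≤ c₀
            α≡       : α ≡ aR x c
        open Selected

        selected-mono : ∀ {β α x x′} → x′ ≲ᵣ x → Selected β α x → Selected β α x′
        selected-mono {x = x} l s = record
          { c₀ = c₀ s ; c = c s
          ; c₀-in = CR-≲ l c₀<len (c₀-in s)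
          ; c-in = member-≲ l (c-in s)
          ; c₀<c = c₀<c s ; β≤c₀ = β≤c₀ s
          ; c₀-first = λ d m k → c₀-first s d m (CR-≲⁻¹ l (<-trans m c₀<len) k)
          ; c-next = λ d m k → c-next s d m (CR-≲⁻¹ l (<-trans m (proj₁ (c-in s))) k)
          ; α≡ = trans (α≡ s) (sym (agreeᵃ l (c s) (proj₁ (c-in s)))) }
          where
          c₀<len : c₀ s < lenR x
          c₀<len = <-trans (c₀<c s) (proj₁ (c-in s))

        selected-unique : ∀ {β α α′ x} → Selected β α x → Selected β α′ x → α ≡ α′
        selected-unique {β} {x = x} s s′ = trans (α≡ s) (trans (cong (aR x) cc) (sym (α≡ s′)))
          where
          c₀≥ : ∀ {α α′} (s : Selected β α x) (s′ : Selected β α′ x) → c₀ s ≤ c₀ s′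
          c₀≥ s s′ = ≮⇒≥ λ l → ≤⇒≯ (β≤c₀ s′) (c₀-first s (c₀ s′) l (c₀-in s′))
          c₀≡ : c₀ s ≡ c₀ s′
          c₀≡ = ≤-antisym (c₀≥ s s′) (c₀≥ s′ s)
          c≥ : ∀ {α α′} (s : Selected β α x) (s′ : Selected β α′ x) → c₀ s ≡ c₀ s′ → c s ≤ c s′
          c≥ s s′ e = ≮⇒≥ λ l → ≤⇒≯ (c-next s (c s′) l (proj₂ (c-in s′))) (subst (_< c s′) (sym e) (c₀<c s′))
          cc : c s ≡ c s′
          cc = ≤-antisym (c≥ s s′ c₀≡) (c≥ s′ s (sym c₀≡))

        opaque
          selected-dense : ∀ β x → Σ[ y ∈ J ] y ≲ᵣ x × Liftable y × (Σ[ α ∈ J ] Selected β α y)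
          selected-dense β x =
            let y , l , _ , d , b , m = member-above x β
                c₀ , (o , k) , least₀ = leastℓ {λ c → β ≤ c × Member y c} (d , b , m)
                z , l′ , lf , d′ , b′ , m′ = member-above y (sucJ c₀)
                c , (o′ , k′) , least₁ = leastℓ {λ c → c₀ < c × Member z c} (d′ , <-≤-trans (<suc c₀) b′ , m′)
            in z , ≲ᵣ-trans l′ l , lf , aR z c , record
              { c₀ = c₀ ; c = c ; c₀-in = CR-≲ l′ (proj₁ k) (proj₂ k) ; c-in = k′ ; c₀<c = o′ ; β≤c₀ = o
              ; c₀-first = λ e n i → ≰⇒> λ β≤e → ≤⇒≯ (least₀ e (β≤e , <-trans n (proj₁ k) , CR-≲⁻¹ l′ (<-trans n (proj₁ k)) i)) n
              ; c-next = λ e n i → ≮⇒≥ λ c₀<e → ≤⇒≯ (least₁ e (c₀<e , <-trans n (proj₁ k′) , i)) n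
              ; α≡ = refl }
            where
            ≰⇒> : ∀ {a b} → ¬ (a ≤ b) → b < a
            ≰⇒> {a} {b} n with <⊎≥ b a
            ... | inj₁ l = l
            ... | inj₂ l = ⊥-elim (n l)

        opaque
          -- No member lies strictly between c₀ and c, so c is not a limit of members and the second
          -- alternative of `promised` holds at it.
          promise-kept : ∀ {β α x} (s : Selected β α x) → c₀ s ≤ α × Prot α (c s) (CR x) (π x)
          promise-kept {β} {α} {x} s = go (promised (validR x) (c s) (proj₁ (c-in s)) (proj₂ (c-in s)))
            where
            go : (LimJ (c s) × LimitOf (CR x) (c s)) ⊎ ((∀ c′ → c′ < c s → CR x c′ → c′ ≤ aR x (c s)) ×
              (∀ q → Agree q (c s) (hR x) → Prot (aR x (c s)) (c s) (CR x) q)) → c₀ s ≤ α × Prot α (c s) (CR x) (π x)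
            go (inj₁ (lim , f)) = let d , m , n , k = f (sucJ (c₀ s)) (proj₂ lim _ (c₀<c s)) in
              ⊥-elim (≤⇒≯ (c-next s d n k) (<-≤-trans (<suc _) m))
            go (inj₂ (f , g)) = subst (c₀ s ≤_) (sym (α≡ s)) (f (c₀ s) (c₀<c s) (c₀-in s)) ,
              subst (λ α → Prot α (c s) (CR x) (π x)) (sym (α≡ s))
                (g (π x) (subst (c s ≤_) (sym (lenP-π x)) (inj₁ (proj₁ (c-in s))) ,
                  λ β m → hP-π (<-trans m (proj₁ (c-in s)))))

        module SR = Semantics ℝ

        -- The sets of the selected rows, shrunk to the generic club.
        Tt : J → J → Predicate
        Tt β i x r = Σ[ α ∈ J ] Selected β α r × Tr α i x (π r) × Member r x

        Tt-mono : ∀ {β i} → SR.Mono (Tt β i)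
        Tt-mono {i = i} x l (α , s , t , m) = α , selected-mono l s , Tr-mono {α} {i} x (π-mono l) t , member-≲ l m

        -- An ω-chain of threads enters U again and again while all projections stay weaker than a
        -- single condition q of ℙ that decides h at the closure point x. Since h(x) is below c and
        -- off the thread, x can be added as a member, and U contains x because it is closed.
        module Preserve {β α r : J} (s : Selected β α r) (i : J)
          (st : Statˢ (λ x q → Tr α i x q × x < lenP q × hP q x < c s × ¬ CR r (hP q x)) AllJ (π r))
          (U : Predicate) (U-mono : SR.Mono U) (r₀ : J) (r₀≲r : r₀ ≲ᵣ r) (U-club : SR.Clubˢ U AllJ r₀) where

          start : Σ[ x ∈ J ] x ≲ᵣ r₀ × Liftable x × (Σ[ c ∈ J ] 0J ≤ c × Member x c)
          start = member-above r₀ 0J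

          r₁ : J
          r₁ = proj₁ start

          r₁≲r₀ : r₁ ≲ᵣ r₀
          r₁≲r₀ = proj₁ (proj₂ start)

          -- The set of all conditions below r₁ may be too large to close off under, but the conditions are ordinals, and
          -- it suffices to treat those below b at stage b.
          Eligible : J → Set ℓ
          Eligible ν = ν ≲ᵣ r₁ × Liftable ν

          record Next (b ν q b′ ν′ : J) : Set ℓ where
            field
              ν′≤  : ν′ ≤ b′
              ν′≲ν : ν′ ≲ᵣ ν
              lf   : Liftable ν′
              q≲   : q ≲ₚ π ν′
              b≤len : b ≤ lenR ν′
              len≤b′ : lenR ν′ ≤ b′
              e    : J
              b≤e  : b ≤ e
              e≤b′ : e ≤ b′
              Ue   : U e ν′

          Decided : J → J → J → J → Set ℓ
          Decided b ν q b′ = (Σ[ ν′ ∈ J ] Next b ν q b′ ν′) ⊎ (Eligible ν → ∀ q′ → q′ ≲ₚ q → ¬ (q′ ≲ₚ π ν))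

          decided-mono : ∀ {b ν q q′ b′} → q′ ≲ₚ q → Decided b ν q b′ → Decided b ν q′ b′
          decided-mono l (inj₁ (ν′ , n)) = inj₁ (ν′ , record { Next n ; q≲ = ≲ₚ-trans l (Next.q≲ n) })
          decided-mono l (inj₂ n) = inj₂ λ el q k → n el q (≲ₚ-trans k l)

          decided-up : ∀ {b ν q b′ b″} → b′ ≤ b″ → Decided b ν q b′ → Decided b ν q b″
          decided-up l (inj₁ (ν′ , n)) = inj₁ (ν′ , record { Next n ; ν′≤ = ≤-trans (Next.ν′≤ n) l
            ; len≤b′ = ≤-trans (Next.len≤b′ n) l ; e≤b′ = ≤-trans (Next.e≤b′ n) l })
          decided-up l (inj₂ n) = inj₂ n

          decide : ∀ b ν q → Σ[ q′ ∈ J ] Σ[ b′ ∈ J ] q′ ≲ₚ q × Decided b ν q′ b′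
          decide b ν q with decℓ (Eligible ν × (Σ[ q′ ∈ J ] q′ ≲ₚ q × q′ ≲ₚ π ν))
          ... | no n = q , 0J , ≲ₚ-refl , inj₂ λ el q′ l k → n (el , q′ , l , k)
          ... | yes ((ν≲ , lf) , q₁ , l , k) =
            let q₂ , l₂ , m = lengthen q₁ b
                ν₁ , n₁ , lf₁ , o₁ , m₁ = lift-cond lf (≲ₚ-trans l₂ k)
                ν₂ , n₂ , e , _ , b≤e , Ue = SR.unb U-club b _ ν₁ (≲ᵣ-trans n₁ (≲ᵣ-trans ν≲ r₁≲r₀))
                ν₃ , n₃ , lf₃ = liftable-dense ν₂
                b₁ , x₁ , x₂ = max ν₃ (lenR ν₃)
                b₂ , y₁ , y₂ = max b₁ e
            in π ν₃ , b₂ , ≲ₚ-trans (π-mono (≲ᵣ-trans n₃ n₂)) (≲ₚ-trans o₁ (≲ₚ-trans l₂ l)) , inj₁ (ν₃ , record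
              { ν′≤ = ≤-trans x₁ y₁ ; ν′≲ν = ≲ᵣ-trans n₃ (≲ᵣ-trans n₂ n₁) ; lf = lf₃ ; q≲ = ≲ₚ-refl
              ; b≤len = ≤-trans (≤-trans m (inj₁ m₁)) (lenR≤ (≲ᵣ-trans n₃ n₂)) ; len≤b′ = ≤-trans x₂ y₁
              ; e = e ; b≤e = b≤e ; e≤b′ = y₂ ; Ue = U-mono e n₃ Ue })

          -- Stage b treats only conditions with code below b. The clause `r₁ ≤ b′` puts `r₁` below
          -- every closure point, so that the ω-chain can begin with it.
          Step : J → J → J → Set ℓ
          Step b q b′ = r₁ ≤ b′ × (∀ ν → ν < b → Decided b ν q b′)

          total : ∀ q → q ≲ₚ π r₁ → ∀ b → Σ[ q′ ∈ J ] q′ ≲ₚ q × (Σ[ b′ ∈ J ] Step b q′ b′)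
          total q l b =
            let q′ , b′ , m , f = distribute-bounded b (λ ν q b′ → Lift (suc ℓ) (Decided b ν q b′))
                  (λ { m (lift d) → lift (decided-mono m d) }) (λ { m (lift d) → lift (decided-up m d) })
                  (π r₁) (λ ν _ q k → let q′ , b′ , m , d = decide b ν q in q′ , b′ , m , lift d) q l
                b″ , x , y = max r₁ b′
            in q′ , m , b″ , x , λ ν k → decided-up y (lower (f ν k))

          T₀ : Predicate
          T₀ x q = Tr α i x q × x < lenP q × hP q x < c s × ¬ CR r (hP q x)

          T₀-mono : Mono T₀
          T₀-mono x l (t , m , n , o) = Tr-mono {α} {i} x l t , <-≤-trans m (len≤ l) ,
            subst (_< c s) (sym (agree l x m)) n , λ k → o (subst (CR r) (agree l x m) k)

          module At (q x : J) (q≲r₁ : q ≲ₚ π r₁) (t : T₀ x q) (lim : LimJ x) (steps : ∀ b → b < x → StepsTo Step x q b) where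

            x<len : x < lenP q
            x<len = proj₁ (proj₂ t)

            r₁<x : r₁ < x
            r₁<x = let _ , b′ , _ , l , (k , _) = steps 0J (proj₁ lim) in ≤-<-trans k l

            resolve : ∀ {b ν b′} → Eligible ν → q ≲ₚ π ν → Decided b ν q b′ → Σ[ ν′ ∈ J ] Next b ν q b′ ν′
            resolve el k (inj₁ d) = d
            resolve el k (inj₂ n) = ⊥-elim (n el q ≲ₚ-refl k)

            State : Set ℓ
            State = Σ[ ν ∈ J ] ν < x × Eligible ν × q ≲ₚ π ν

            record After (b₀ : J) (ν ν′ : J) : Set ℓ where
              field
                ≲ν    : ν′ ≲ᵣ ν
                b₀≤len : b₀ ≤ lenR ν′
                len<x : lenR ν′ < x
                e     : J
                b₀≤e  : b₀ ≤ e
                e<x   : e < x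
                Ue    : U e ν′

            opaque
              advance : ∀ b₀ → b₀ < x → (σ : State) → Σ[ σ′ ∈ State ] After b₀ (proj₁ σ) (proj₁ σ′)
              advance b₀ l (ν , ν<x , el , k) =
                let b , b₀≤b , ν≤b , b<x = maxBelow l ν<x
                    b₁ , b′ , o , o′ , (_ , f) = steps (sucJ b) (proj₂ lim b b<x)
                    b<b₁ = <-≤-trans (<suc b) o
                    ν′ , n = resolve el k (f ν (≤-<-trans ν≤b b<b₁))
                    b₀≤b₁ = ≤-trans b₀≤b (inj₁ b<b₁)
                in (ν′ , ≤-<-trans (Next.ν′≤ n) o′ , (≲ᵣ-trans (Next.ν′≲ν n) (proj₁ el) , Next.lf n) , Next.q≲ n) , record
                  { ≲ν = Next.ν′≲ν n ; b₀≤len = ≤-trans b₀≤b₁ (Next.b≤len n) ; len<x = ≤-<-trans (Next.len≤b′ n) o′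
                  ; e = Next.e n ; b₀≤e = ≤-trans b₀≤b₁ (Next.b≤e n) ; e<x = ≤-<-trans (Next.e≤b′ n) o′ ; Ue = Next.Ue n }

            cof : CofJ ωJ x
            cof = proj₂ (InS⇒ (proj₁ (proj₁ t)))

            g : ℕ → J
            g n = sucJ (proj₁ cof (num n))

            g<x : ∀ n → g n < x
            g<x n = proj₂ lim _ (proj₁ (proj₂ cof) (num n) (num<ω n))

            g-cofinal : ∀ y → y < x → Σ[ n ∈ ℕ ] y < g n
            g-cofinal y l = let j , m , k = proj₂ (proj₂ cof) y l ; n , e = <ω⇒num j m in
              n , ≤⇒<suc (subst (λ j → y ≤ proj₁ cof j) (sym e) k)

            σ : ℕ → State
            σ zero = r₁ , r₁<x , (≲ᵣ-refl , proj₁ (proj₂ (proj₂ start))) , q≲r₁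
            σ (sucℕ n) = proj₁ (advance (g n) (g<x n) (σ n))

            ν : ℕ → J
            ν n = proj₁ (σ n)

            after : ∀ n → After (g n) (ν n) (ν (sucℕ n))
            after n = proj₂ (advance (g n) (g<x n) (σ n))

            limit : Σ[ y ∈ J ] (∀ n → y ≲ᵣ ν n) × (∀ β → β < lenR y → Σ[ n ∈ ℕ ] β < lenR (ν n))
            limit = ω-chain ν λ n → After.≲ν (after n)

            rω : J
            rω = proj₁ limit

            rω≲ : ∀ n → rω ≲ᵣ ν n
            rω≲ = proj₁ (proj₂ limit)

            len<x : ∀ n → lenR (ν n) < x
            len<x n = ≤-<-trans (lenR≤ (After.≲ν (after n))) (After.len<x (after n))

            -- The lengths pass all `g n`, which are cofinal in x, while each of them stays below x.
            len-rω : lenR rω ≡ x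
            len-rω = ≤-antisym
              (≮⇒≥ λ l → let n , m = proj₂ (proj₂ limit) x l in <-irrefl (<-trans m (len<x n)))
              (≮⇒≥ λ l → let n , m = g-cofinal _ l in
                ≤⇒≯ (≤-trans (After.b₀≤len (after n)) (lenR≤ (rω≲ (sucℕ n)))) m)

            q≲rω : ∀ β → β < x → hP q β ≡ hR rω β
            q≲rω β l = let n , m = proj₂ (proj₂ limit) β (subst (β <_) (sym len-rω) l) in
              trans (agree (proj₂ (proj₂ (proj₂ (σ n)))) β (subst (β <_) (sym (lenP-π (ν n))) m))
                (trans (hP-π m) (sym (agreeʰ (rω≲ n) β m)))

            rω≲r : rω ≲ᵣ r
            rω≲r = ≲ᵣ-trans (rω≲ 0) (≲ᵣ-trans r₁≲r₀ r₀≲r)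

            limit-type : LimitType rω
            limit-type = subst LimJ (sym len-rω) lim ,
              members-cofinal rω (≤-<-trans (above-base (validR r₁)) (<-≤-trans (len<x 0) (inj₂ (sym len-rω))))

            v : J
            v = hP q x

            v<x : v < x
            v<x = regressive (validP q) x x<len (proj₁ lim)

            -- h(x) is below c, where `rω` has the same members as r, and it is not a member of r.
            v∉ : ¬ Member rω v
            v∉ (_ , k) = let _ , _ , v<c , n = t in n (CR-≲⁻¹ rω≲r (<-trans v<c (proj₁ (c-in s))) k)

            point : OnePoint rω (π rω) v 0J
            point = limit-point rω limit-type v (subst (v <_) (sym len-rω) v<x) v∉

            module Pt = OnePoint point

            len-π : lenP (π rω) ≡ x
            len-π = trans (lenP-π rω) len-rω

            -- q is longer than x and agrees with the new thread up to and including x, since the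
            -- value used there is the one q itself assigns.
            q≲πy : q ≲ₚ π Pt.y
            q≲πy = extends (subst (_≤ lenP q) (sym len-πy) (suc≤ x<len)) same
              where
              len-πy : lenP (π Pt.y) ≡ sucJ x
              len-πy = trans (lenP-π Pt.y) (trans Pt.len-y (cong sucJ len-π))
              same : ∀ β → β < lenP (π Pt.y) → hP q β ≡ hP (π Pt.y) β
              same β l = trans (cases (<suc⇒≤ (subst (β <_) len-πy l)))
                  (sym (hP-π (subst (β <_) (lenP-π Pt.y) l)))
                where
                cases : β ≤ x → hP q β ≡ hR Pt.y β
                cases (inj₁ m) = trans (q≲rω β m) (sym (agreeʰ Pt.y≲x β (subst (β <_) (sym len-rω) m)))
                cases (inj₂ e) = trans (cong (hP q) e) (trans (sym Pt.h-new) (cong (hR Pt.y) (trans len-π (sym e))))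

            -- That x belongs to the entry is known only at q, so the thread is prolonged until its
            -- projection is below q.
            final : Σ[ z ∈ J ] z ≲ᵣ Pt.y × Liftable z × π z ≲ₚ q × lenP q < lenR z
            final = lift-cond Pt.lift-ok q≲πy

            z : J
            z = proj₁ final

            z≲y : z ≲ᵣ Pt.y
            z≲y = proj₁ (proj₂ final)

            z≲r₀ : z ≲ᵣ r₀
            z≲r₀ = ≲ᵣ-trans z≲y (≲ᵣ-trans Pt.y≲x (≲ᵣ-trans (rω≲ 0) r₁≲r₀))

            near : ∀ n → U (After.e (after n)) z
            near n = U-mono _ (≲ᵣ-trans z≲y (≲ᵣ-trans Pt.y≲x (rω≲ (sucℕ n)))) (After.Ue (after n))

            U-cofinal : ∀ b → b < x → Σ[ η ∈ J ] η < x × b ≤ η × U η z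
            U-cofinal b l = let n , m = g-cofinal b l in
              After.e (after n) , After.e<x (after n) , ≤-trans (inj₁ m) (After.b₀≤e (after n)) , near n

            U-x : U x z
            U-x = SR.cls U-club x _ lim z z≲r₀ λ b l w w≲z → let η , η<x , b≤η , u = U-cofinal b l in
              w , ≲ᵣ-refl , η , η<x , b≤η , U-mono η w≲z u

            x-in : Member z x
            x-in = member-≲ z≲y (subst (Member Pt.y) len-π (subst (lenP (π rω) <_) (sym Pt.len-y) (<suc _) , Pt.C-new))

            result : Σ[ z ∈ J ] z ≲ᵣ r₀ × (Σ[ x ∈ J ] AllJ x × U x z × Tt β i x z)
            result = z , z≲r₀ , x , _ , U-x , α , selected-mono (≲ᵣ-trans z≲r₀ r₀≲r) s ,
              Tr-mono {α} {i} x (proj₁ (proj₂ (proj₂ (proj₂ final)))) (proj₁ t) , x-in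

          result : Σ[ z ∈ J ] z ≲ᵣ r₀ × (Σ[ x ∈ J ] AllJ x × U x z × Tt β i x z)
          result =
            let q , x , q≲ , t , lim , _ , steps = stationary-closure Step
                  (λ { m (k , f) → k , λ ν l → decided-mono m (f ν l) }) (π r₁) total T₀-mono
                  (stat-mono (π-mono (≲ᵣ-trans r₁≲r₀ r₀≲r)) st)
            in At.result q x q≲ t lim steps

        preserved : ∀ {β α j r} → Selected β α r → Row α j (π r) → ∀ i → i < j → SR.Statˢ (Tt β i) AllJ r
        preserved {α = α} {j} {r} s R i i<j U U-mono r₀ l c =
          let j′ , R′ , st = proj₂ (promise-kept s) in
          Preserve.result s i (st i (subst (i <_) (row-length-unique R R′) i<j)) U U-mono r₀ l c

        -- `Small` keeps this at level ℓ, so that it can index the entries of a name.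
        HasIndex : J → J → J → Set ℓ
        HasIndex β i r = Σ[ α ∈ J ] Selected β α r × Small (Σ[ j ∈ J ] Row α j (π r) × i < j)

        hasIndex-mono : ∀ {β i r r′} → r′ ≲ᵣ r → HasIndex β i r → HasIndex β i r′
        hasIndex-mono l (α , s , k) = α , selected-mono l s ,
          small (let j , R , m = large k in j , row-mono (π-mono l) R , m)

        hasIndex-below : ∀ {β α i j r} → Selected β α r → Row α j (π r) → HasIndex β i r → i < j
        hasIndex-below {i = i} {r = r} s R (α′ , s′ , k) = let j′ , R′ , m = large k in
          subst (i <_) (row-length-unique (subst (λ α → Row α j′ (π r)) (selected-unique s′ s) R′) R) m

        hasIndex-stationary : ∀ {β i r} → HasIndex β i r → SR.Statˢ (Tt β i) AllJ r
        hasIndex-stationary {i = i} (α , s , k) = let j , R , m = large k in preserved s R i m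

        opaque
          row-ready : ∀ β r → Σ[ r′ ∈ J ] r′ ≲ᵣ r × Liftable r′ ×
            (Σ[ α ∈ J ] Σ[ j ∈ J ] Selected β α r′ × Row α j (π r′))
          row-ready β r =
            let r₁ , l₁ , lf , α , s = selected-dense β r
                q , m , j , R = row-exists α (π r₁) (≲ₚ-trans (π≲p* r₁) p*≲p₀)
                r₂ , l₂ , lf₂ , n , _ = lift-cond lf m
            in r₂ , ≲ᵣ-trans l₂ l₁ , lf₂ , α , j , selected-mono l₂ s , row-mono n R

        -- The length of the selected row depends on the generic thread; an entry is therefore
        -- placed under each condition that decides it to exist.
        RowN : J → Name ℝ
        RowN β = SR.graphN {Σ[ i ∈ J ] Σ[ r ∈ J ] HasIndex β i r} (λ a → SR.ord (proj₁ a))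
          (λ a → SR.sub (Tt β (proj₁ a))) (λ a → proj₁ (proj₂ a))

        MatrixN : Name ℝ
        MatrixN = SR.graphN {J} SR.ord RowN (λ _ → topR)

        rowN-on : ∀ {β α j r} → Selected β α r → Row α j (π r) → SR.FunOn (RowN β) (SR.ord j) r
        rowN-on {β} {α} {j} {r} s R = SR.graphN-functionOn
          (λ { (i , r′ , h) q l m → SR.ord-< (hasIndex-below (selected-mono l s) (row-mono (π-mono l) R) (hasIndex-mono m h)) })
          (λ x q l h → SR.dense-map (SR.∈-ord h) λ { t m (i , i<j , e) →
            (i , q , α , selected-mono l s , small (j , row-mono (π-mono l) R , i<j)) , m , e })
          λ { (i , _) (i′ , _) q l _ _ e → subst (λ i′ → q SR.⊩ SR.sub (Tt β i) ≐ SR.sub (Tt β i′)) (SR.ord-≡ e) SR.≐-refl }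

        rowN-entry : ∀ {β x T r} → r SR.⊩ SR.opair x T ∈ RowN β →
          SR.Dense r λ s → Σ[ i ∈ J ] HasIndex β i s × s SR.⊩ T ≐ SR.sub (Tt β i)
        rowN-entry h = SR.dense-map (SR.graphN-elim h) λ { s m ((i , r , k) , l , _ , e) → i , hasIndex-mono l k , e }

        matrixN-row : ∀ {A N r} → r SR.⊩ SR.opair A N ∈ MatrixN → SR.Dense r λ s → Σ[ β ∈ J ] s SR.⊩ N ≐ RowN β
        matrixN-row h = SR.dense-map (SR.graphN-elim h) λ { s m (β , _ , _ , e) → β , e }

        matrixN-on : ∀ {r} → SR.FunOn MatrixN SR.⌜ Λ ⌝ r
        matrixN-on = SR.graphN-functionOn (λ _ _ _ _ → SR.ord∈Λ)
          (λ x q l h → SR.dense-map (SR.∈-Λ h) λ { r m (j , e) → j , ≲-topR r , e })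
          λ β β′ q l _ _ e → subst (λ β′ → q SR.⊩ RowN β ≐ RowN β′) (SR.ord-≡ e) SR.≐-refl

        entry-subset : ∀ {β x T r} → r SR.⊩ SR.opair x T ∈ RowN β → ∀ z q → q ≲ᵣ r → q SR.⊩ z ∈ T → q SR.⊩ z ∈ SR.⌜ S ⌝
        entry-subset h z q l k = SR.∈-local (SR.dense (rowN-entry (SR.∈-mono l h)) λ { s m (i , _ , e) →
          SR.dense-map (SR.sub-elim (Tt-mono {i = i}) (SR.∈-respʳ e (SR.∈-mono m k))) λ
            { t n (x , (_ , _ , (x∈S , _) , _) , e′) → SR.∈-respˡ (SR.≐-sym e′) (SR.⌜⌝-∈ x∈S) } })

        entry-stationary : ∀ {β x T r} → r SR.⊩ SR.opair x T ∈ RowN β → SR.Statˢ SR.⟦ T ⟧ AllJ r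
        entry-stationary h U U-mono q l c =
          let s , m , i , k , e = rowN-entry (SR.∈-mono l h) q ≲ᵣ-refl
              t , n , y , b , u , tt′ = hasIndex-stationary k U U-mono s ≲ᵣ-refl (SR.club-mono m c)
          in t , ≲ᵣ-trans n m , y , b , u , SR.∈-respʳ (SR.≐-sym (SR.≐-mono n e)) (SR.sub-intro tt′)

        entry-ok : ∀ {β x T r} → r SR.⊩ SR.opair x T ∈ RowN β → SR.E._⊆̇_ T SR.⌜ S ⌝ r × SR.E.Stationary T SR.⌜ Λ ⌝ r
        entry-ok {β} {x} {T} {r} h = (λ z q l k → lift (SR.un-mem (entry-subset h z q l (SR.mem (lower k))))) ,
          SR.statˢ⁻¹ {T} {SR.⌜ Λ ⌝} {AllJ} {r} SR.bound-Λ (entry-stationary h)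

        matrixN-ok : SR.E.Matrix (λ j → j SR.E.∈̇ SR.⌜ κ ⌝) SR.⌜ Λ ⌝ SR.⌜ S ⌝ MatrixN topR
        matrixN-ok = SR.un-funOn {MatrixN} {SR.⌜ Λ ⌝} {topR} matrixN-on , λ A N q l h q₁ l₁ →
          let r₁ , m₁ , β , e = matrixN-row (SR.maps⇒ {MatrixN} {A} {N} {q} h) q₁ l₁
              r₂ , m₂ , _ , α , j , s , R = row-ready β r₁
          in r₂ , ≲ᵣ-trans m₂ m₁ , SR.ord j , lift (SR.un-mem (SR.⌜⌝-∈ (<κ (Row.j<κ R)))) ,
             SR.un-funOn {N} {SR.ord j} {r₂} (SR.functionOn-resp (SR.≐-sym (SR.≐-mono m₂ e)) SR.≐-refl (rowN-on s R)) ,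
             λ i T t n k → entry-ok {β} {i} {T} {t} (SR.∈-respʳ (SR.≐-mono (≲ᵣ-trans n m₂) e) (SR.maps⇒ {N} {i} {T} {t} k))

        record Reflected : Set (suc ℓ) where
          field
            r           : J
            g           : J
            uncountable : Uncountable g
            F           : Name ℝ
            F-unbounded : ∀ b → b < g → ∀ q → q ≲ᵣ r → Σ[ q′ ∈ J ] q′ ≲ᵣ q × (Σ[ β ∈ J ] β < g × b ≤ β × q′ SR.⊩ SR.ord β ∈ F)
            reflects    : ∀ β q → q ≲ᵣ r → q SR.⊩ SR.ord β ∈ F → ∀ i → HasIndex β i q → SR.Statˢ (Tt β i) (_< g) q

        rowN-formula : ∀ {β i q} → HasIndex β i q → SR.E.Entry MatrixN (SR.ord β) (SR.ord i) (SR.sub (Tt β i)) q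
        rowN-formula {β} {i} {q} h t l = t , ≲ᵣ-refl , RowN β ,
          SR.maps⇐ {MatrixN} {SR.ord β} {RowN β} {t} (SR.graphN-intro β (≲-topR t) SR.≐-refl SR.≐-refl) ,
          SR.maps⇐ {RowN β} {SR.ord i} {SR.sub (Tt β i)} {t} (SR.graphN-intro (i , q , h) l SR.≐-refl SR.≐-refl)

        reflected : Forced ℝ (SR.E.uDSR< SR.⌜ κ ⌝ SR.⌜ Λ ⌝ SR.⌜ S ⌝) → Reflected
        reflected forced =
          let r₁ , _ , G , G∈Λ , uc , dF = forced topR MatrixN topR ≲ᵣ-refl matrixN-ok topR ≲ᵣ-refl
              r₂ , m₂ , g , e = SR.∈-Λ (SR.mem (lower G∈Λ)) r₁ ≲ᵣ-refl
              r₃ , m₃ , F , _ , unbF , all = dF r₂ m₂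
              e₃ = SR.≐-mono m₃ e
          in record
            { r = r₃ ; g = g ; uncountable = SR.uncountable-elim e λ t l → uc t (≲ᵣ-trans l m₂) ; F = F
            ; F-unbounded = λ b b<g q l → SR.unbounded-elim (SR.bound-ord e₃) unbF b b<g q l q ≲ᵣ-refl
            ; reflects = λ β q l k i h → SR.stat-dense (λ x t n u → SR.sub-elim′ (Tt-mono {i = i}) u)
                (SR.statˢ (SR.bound-ord (SR.≐-mono l e₃))
                  (proj₂ (all (SR.ord β) q l (lift (SR.un-mem k)) (SR.ord i) (SR.sub (Tt β i)) q ≲ᵣ-refl (rowN-formula h)))) }

        -- Reflection brought back from ℝ to ℙ

        module PullBack (reflection : Reflected) where
          open Reflected reflection

          g-limit : LimJ g
          g-limit = uncountable-limit uncountable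

          r* : J
          r* = proj₁ (liftable-dense r)

          r*≲r : r* ≲ᵣ r
          r*≲r = proj₁ (proj₂ (liftable-dense r))

          r*-liftable : Liftable r*
          r*-liftable = proj₂ (proj₂ (liftable-dense r))

          -- F is given only in the extension by ℝ. The set for the extension by ℙ is defined
          -- outright as the set of all reflecting rows below g, so only its unboundedness has to be
          -- brought back.
          Reflecting : Predicate
          Reflecting α q = α < g × Small (∀ i T q′ → q′ ≲ₚ q → EntryAt (SP.ord α) i T q′ → Statˢ SP.⟦ T ⟧ (_< g) q′)

          reflecting-mono : Mono Reflecting
          reflecting-mono α l (m , h) = m , small λ i T q′ k → large h i T q′ (≲ₚ-trans k l)

          tail : ∀ b → b < g → ∀ {x} → SR.Clubˢ (λ y _ → b ≤ y) (_< g) x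
          tail b b<g = SR.club
            (λ β β<g q _ → let c , m , n , k = maxBelow b<g β<g in q , ≲ᵣ-refl , c , k , n , m)
            λ δ _ lim q _ f → let _ , _ , η , η<δ , _ , k = f 0J (proj₁ lim) q ≲ᵣ-refl in ≤-trans k (inj₁ η<δ)

          -- Reflection of an entry makes g a limit of the thread; this is why every row needs an entry.
          next-member : ∀ {β i x} → x ≲ᵣ r → x SR.⊩ SR.ord β ∈ F → HasIndex β i x → ∀ b → b < g →
            Σ[ y ∈ J ] y ≲ᵣ x × (Σ[ c ∈ J ] b ≤ c × c < g × Member y c)
          next-member {β} {i} l k h b b<g =
            let y , m , c , c<g , b≤c , (_ , _ , _ , mem′) = reflects β _ l k i h (λ y _ → b ≤ y) (λ _ _ u → u) _ ≲ᵣ-refl (tail b b<g)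
            in y , m , c , b≤c , c<g , mem′

          -- A club of the extension by ℙ, read in the extension by ℝ. Asking for U only densely
          -- leaves room to pass to a liftable thread; below its projection every condition of ℙ is
          -- caught by a thread, as the test of closure in ℙ requires.
          module Lifted (U : Predicate) (U-mono : Mono U) {q} (U-club : Clubˢ U (_< g) q) where
            U′ : Predicate
            U′ y x = ∀ x′ → x′ ≲ᵣ x → Σ[ x″ ∈ J ] x″ ≲ᵣ x′ × U y (π x″)

            U′-mono : SR.Mono U′
            U′-mono y l h x′ m = h x′ (≲ᵣ-trans m l)

            U′-club : ∀ {x} → π x ≲ₚ q → SR.Clubˢ U′ (_< g) x
            U′-club {x} πx≲q = SR.club
              (λ β β<g y l →
                let y₁ , l₁ , lf = liftable-dense y
                    q₁ , m₁ , η , η<g , β≤η , u = unb U-club β β<g (π y₁) (≲ₚ-trans (π-mono (≲ᵣ-trans l₁ l)) πx≲q)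
                    y₂ , l₂ , _ , m₂ , _ = lift-cond lf m₁
                in y₂ , ≲ᵣ-trans l₂ l₁ , η , η<g , β≤η , λ w n → w , ≲ᵣ-refl , U-mono η (≲ₚ-trans (π-mono n) m₂) u)
              λ δ δ<g lim y l f y′ l′ →
                let y₁ , l₁ , lf = liftable-dense y′
                    at : ∀ β → β < δ → ∀ q₁ → q₁ ≲ₚ π y₁ → Σ[ s ∈ J ] s ≲ₚ q₁ × (Σ[ η ∈ J ] η < δ × β ≤ η × U η s)
                    at = λ β β<δ q₁ m₁ →
                      let w , n , _ , o , _ = lift-cond lf m₁
                          s , n₁ , η , η<δ , β≤η , h = f β β<δ w (≲ᵣ-trans n (≲ᵣ-trans l₁ l′))
                          s′ , n₂ , u = h s ≲ᵣ-refl
                      in π s′ , ≲ₚ-trans (π-mono (≲ᵣ-trans n₂ n₁)) o , η , η<δ , β≤η , u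
                in y₁ , l₁ , cls U-club δ δ<g lim (π y₁) (≲ₚ-trans (π-mono (≲ᵣ-trans l₁ (≲ᵣ-trans l′ l))) πx≲q) at

          entryAt-mono : ∀ {α i T q q′} → q′ ≲ₚ q → EntryAt α i T q → EntryAt α i T q′
          entryAt-mono l (entryAt d) = entryAt (SP.dense-mono l d)

          entryAt-index : ∀ {α i i′ T q} → q SP.⊩ i ≐ i′ → EntryAt α i T q → EntryAt α i′ T q
          entryAt-index e (entryAt d) = entryAt (SP.dense-map d λ { r l (N , k , k′) →
            N , k , SP.∈-respˡ (SP.opair-cong (SP.≐-mono l e) SP.≐-refl) k′ })

          entryAt-row : ∀ {α α′ i T q} → q SP.⊩ α ≐ α′ → EntryAt α i T q → EntryAt α′ i T q
          entryAt-row e (entryAt d) = entryAt (SP.dense-map d λ { r l (N , k , k′) →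
            N , SP.∈-respˡ (SP.opair-cong (SP.≐-mono l e) SP.≐-refl) k , k′ })

          -- The given club is lifted to ℝ, where the shrunken entry meets it. The point found
          -- belongs to the original entry as well, and both facts are facts about the projection of
          -- the thread.
          row-reflects : ∀ {α β j x} → x ≲ᵣ r → Liftable x → x SR.⊩ SR.ord β ∈ F → Selected β α x → Row α j (π x) →
            ∀ i T q → q ≲ₚ π x → EntryAt (SP.ord α) i T q → Statˢ SP.⟦ T ⟧ (_< g) q
          row-reflects {α} {β} {j} {x} l lf k s R i T q m en U U-mono q₁ m₁ c =
            case entry-index R (≲ₚ-trans m₁ m) (entryAt-mono m₁ en) q₁ ≲ₚ-refl of λ { (q₂ , m₂ , i₀ , i₀<j , e) →
            case lift-cond lf (≲ₚ-trans m₂ (≲ₚ-trans m₁ m)) of λ { (x₁ , l₁ , _ , n₁ , _) →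
            case reflects β x₁ (≲ᵣ-trans l₁ l) (SR.∈-mono l₁ k) i₀ (α , selected-mono l₁ s , small (j , row-mono (π-mono l₁) R , i₀<j))
                   (U′ c) (U′-mono {c}) x₁ ≲ᵣ-refl (U′-club c (≲ₚ-trans n₁ m₂)) of λ { (x₂ , l₂ , y , y<g , u′ , (α′ , s′ , tr , _)) →
            case u′ x₂ ≲ᵣ-refl of λ { (x₃ , l₃ , u) →
              π x₃ , ≲ₚ-trans (π-mono (≲ᵣ-trans l₃ l₂)) (≲ₚ-trans n₁ m₂) , y , y<g , u ,
              large (proj₂ (Tr-mono {α} {i₀} y (π-mono l₃)
                (subst (λ α → Tr α i₀ y (π x₂)) (selected-unique s′ (selected-mono (≲ᵣ-trans l₂ l₁) s)) tr))) (π x₃) ≲ₚ-refl T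
                (entryAt-index (SP.≐-mono (≲ₚ-trans (π-mono (≲ᵣ-trans l₃ l₂)) n₁) e)
                  (entryAt-mono (≲ₚ-trans (≲ₚ-trans (π-mono (≲ᵣ-trans l₃ l₂)) n₁) (≲ₚ-trans m₂ m₁)) en)) } } } }
            where
            U′ : Clubˢ U (_< g) q₁ → Predicate
            U′ c = Lifted.U′ U U-mono c
            U′-mono : ∀ {c} → SR.Mono (U′ c)
            U′-mono {c} = Lifted.U′-mono U U-mono c
            U′-club : ∀ c {x} → π x ≲ₚ q₁ → SR.Clubˢ (U′ c) (_< g) x
            U′-club c = Lifted.U′-club U U-mono c

          -- The thread has two members y₁ < y₂ between β and g. By minimality c₀ ≤ y₁ and c ≤ y₂,
          -- so that α < c ≤ y₂ < g.
          window : ∀ {α β j x₃} → x₃ ≲ᵣ r → x₃ SR.⊩ SR.ord β ∈ F → β < g → Selected β α x₃ → Row α j (π x₃) →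
            Σ[ x ∈ J ] x ≲ᵣ x₃ × Liftable x × α < g
          window {α} {β} {j} {x₃} x₃≲r k β<g s R =
            case next-member x₃≲r k h₃ β β<g of λ { (x₄ , l₄ , y₁ , β≤y₁ , y₁<g , in₁) →
            case next-member (≲ᵣ-trans l₄ x₃≲r) (SR.∈-mono l₄ k) (hasIndex-mono l₄ h₃) (sucJ y₁) (proj₂ g-limit y₁ y₁<g) of λ
              { (x₅ , l₅ , y₂ , y₁<y₂ , y₂<g , (_ , in₂)) →
            case liftable-dense x₅ of λ { (x₆ , l₆ , lf₆) →
              x₆ , ≲ᵣ-trans l₆ (≲ᵣ-trans l₅ l₄) , lf₆ ,
              small-index (selected-mono (≲ᵣ-trans l₅ l₄) s) β≤y₁ (proj₂ (member-≲ l₅ in₁)) y₁<y₂ y₂<g in₂ } } }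
            where
            h₃ : HasIndex β 0J x₃
            h₃ = α , s , small (j , R , Row.0<j R)
            small-index : ∀ {x₅ y₁ y₂} (s₅ : Selected β α x₅) → β ≤ y₁ → CR x₅ y₁ →
              sucJ y₁ ≤ y₂ → y₂ < g → CR x₅ y₂ → α < g
            small-index {y₁ = y₁} {y₂} s₅ β≤y₁ in₁ y₁<y₂ y₂<g in₂ =
              <-≤-trans (subst (_< Selected.c s₅) (sym (Selected.α≡ s₅)) (proj₂ (Selected.c-in s₅))) (≤-trans c≤y₂ (inj₁ y₂<g))
              where
              c₀≤y₁ : Selected.c₀ s₅ ≤ y₁
              c₀≤y₁ = ≮⇒≥ λ o → ≤⇒≯ β≤y₁ (Selected.c₀-first s₅ y₁ o in₁)
              c≤y₂ : Selected.c s₅ ≤ y₂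
              c≤y₂ = ≮⇒≥ λ o → ≤⇒≯ (≤-trans (Selected.c-next s₅ y₂ o in₂) c₀≤y₁) (<-≤-trans (<suc y₁) y₁<y₂)

          reflecting-unbounded : ∀ b → b < g → ∀ q → q ≲ₚ π r* →
            Σ[ q′ ∈ J ] q′ ≲ₚ q × (Σ[ α ∈ J ] α < g × b ≤ α × Reflecting α q′)
          reflecting-unbounded b b<g q l =
            case lift-cond r*-liftable l of λ { (x₁ , l₁ , _ , m₁ , _) →
            case F-unbounded b b<g x₁ (≲ᵣ-trans l₁ r*≲r) of λ { (x₂ , l₂ , β , β<g , b≤β , k) →
            case row-ready β x₂ of λ { (x₃ , l₃ , _ , α , j , s , R) →
            case window (≲ᵣ-trans l₃ (≲ᵣ-trans l₂ (≲ᵣ-trans l₁ r*≲r))) (SR.∈-mono l₃ k) β<g s R of λ { (x₆ , l₆ , lf₆ , α<g) →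
              π x₆ , ≲ₚ-trans (π-mono (≲ᵣ-trans l₆ (≲ᵣ-trans l₃ l₂))) m₁ , α , α<g ,
              -- b ≤ β ≤ c₀ ≤ α, because the row promised at c is not below the previous member.
              ≤-trans b≤β (≤-trans (Selected.β≤c₀ s) (proj₁ (promise-kept s))) , α<g ,
              small λ i T q′ → row-reflects (≲ᵣ-trans l₆ (≲ᵣ-trans l₃ (≲ᵣ-trans l₂ (≲ᵣ-trans l₁ r*≲r)))) lf₆
                (SR.∈-mono (≲ᵣ-trans l₆ l₃) k) (selected-mono l₆ s) (row-mono (π-mono l₆) R) i T q′ } } } }

          F* : Name ℙ
          F* = SP.sub Reflecting

          F*⊆g : ∀ {q} → SP.E._⊆̇_ F* (SP.ord g) q
          F*⊆g z q l h = lift (SP.un-mem (SP.∈-local (SP.dense-map (SP.sub-elim reflecting-mono (SP.mem (lower h))) λ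
            { r m (α , (α<g , _) , e) → SP.∈-respˡ (SP.≐-sym e) (SP.ord-< α<g) })))

          F*-unbounded : ∀ {q} → q ≲ₚ π r* → SP.E.Unbounded F* (SP.ord g) q
          F*-unbounded {q} l = SP.unbounded-intro {F*} {SP.ord g} {_< g} {q} (SP.bound-ord SP.≐-refl) λ b b<g q m t n →
            let q′ , o , α , α<g , b≤α , k = reflecting-unbounded b b<g t (≲ₚ-trans n (≲ₚ-trans m l)) in
            q′ , o , α , α<g , b≤α , SP.sub-intro k

          F*-reflects : ∀ {A i T q} → q SP.⊩ A ∈ F* → EntryAt A i T q → Statˢ SP.⟦ T ⟧ (_< g) q
          F*-reflects {i = i} {T} h en U U-mono q l c =
            let q₁ , m , α , (_ , k) , e = SP.sub-elim reflecting-mono (SP.∈-mono l h) q ≲ₚ-refl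
                q₂ , n , x = large k i T q₁ ≲ₚ-refl (entryAt-row e (entryAt-mono (≲ₚ-trans m l) en))
                               U U-mono q₁ ≲ₚ-refl (club-mono m c)
            in q₂ , ≲ₚ-trans n m , x

          entry-formula : ∀ {A i T q} → SP.E.Entry M A i T q → EntryAt A i T q
          entry-formula {A} {i} {T} h = entryAt λ q l → let r , m , N , k , k′ = h q l in
            r , m , N , SP.maps⇒ {M} {A} {N} {r} k , SP.maps⇒ {N} {i} {T} {r} k′

          F*-formula : ∀ {q} A i T → q SP.⊩ A ∈ F* → SP.E.Entry M A i T q → SP.E._reflectsAt_ T (SP.ord g) q
          F*-formula {q} A i T h en = SP.uncountable-intro cofinalityPreserving {g} {q} uncountable ,
            SP.statˢ⁻¹ {T} {SP.ord g} {_< g} {q} (SP.bound-ord SP.≐-refl) (F*-reflects h (entry-formula {A} {i} {T} {q} en))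

        conclusion : Indestructible → Σ[ p′ ∈ J ] p′ ≲ₚ p* × (Σ[ g ∈ J ] Uncountable g × (Σ[ F ∈ Name ℙ ]
          (∀ q → SP.E._⊆̇_ F (SP.ord g) q) × (∀ q → q ≲ₚ p′ → SP.E.Unbounded F (SP.ord g) q) ×
          (∀ A i T q → q SP.⊩ A ∈ F → SP.E.Entry M A i T q → SP.E._reflectsAt_ T (SP.ord g) q)))
        conclusion star = π r* , π≲p* r* , g , uncountable , F* , (λ q → F*⊆g {q}) , (λ q → F*-unbounded {q}) ,
            λ A i T q → F*-formula {q} A i T
          where
          reflection : Reflected
          reflection = reflected (star ℝ directedClosed hasSize)
          open Reflected reflection
          open PullBack reflection

    uDSR-forced : Indestructible → ∀ p → SP.E.uDSR< SP.⌜ κ ⌝ SP.⌜ Λ ⌝ SP.⌜ S ⌝ p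
    uDSR-forced star p M p₀ p₀≲p mat q q≲p₀ = let p′ , l , g , u , F , F⊆g , F-unb , F-refl = below in
        p′ , ≲ₚ-trans l p₂≲q , SP.ord g , lift (SP.un-mem (SP.ord∈Λ {g})) ,
        SP.uncountable-intro cofinalityPreserving {g} {p′} u ,
        λ q₂ m₂ → q₂ , ≲ₚ-refl , F , F⊆g q₂ , F-unb q₂ m₂ ,
          λ A q₃ m₃ h i T q₄ m₄ en → F-refl A i T q₄ (SP.∈-mono m₄ (SP.mem (lower h))) en
      where
      matrix : IsMatrix M p₀
      matrix = isMatrix {M} {p₀} mat
      many : Σ[ p* ∈ J ] p* ≲ₚ q × (Σ[ γ ∈ J ] MatrixName.ManyGood matrix p* γ)
      many = MatrixName.many-good matrix q q≲p₀
      γ b p₂ : J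
      γ = proj₁ (proj₂ (proj₂ many))
      -- Length at least γ keeps the members of the thread in the range where `ManyGood` applies;
      -- length at least 1 keeps them positive, where h is regressive.
      b = proj₁ (max γ 1J)
      p₂ = proj₁ (lengthen (proj₁ many) b)
      p₂≲p₁ : p₂ ≲ₚ proj₁ many
      p₂≲p₁ = proj₁ (proj₂ (lengthen (proj₁ many) b))
      b≤p₂ : b ≤ lenP p₂
      b≤p₂ = proj₂ (proj₂ (lengthen (proj₁ many) b))
      p₂≲q : p₂ ≲ₚ q
      p₂≲q = ≲ₚ-trans p₂≲p₁ (proj₁ (proj₂ many))
      below = MatrixName.Thread.conclusion matrix p₂ (≲ₚ-trans p₂≲q q≲p₀)
        (<-≤-trans (<suc 0J) (≤-trans (proj₂ (proj₂ (max γ 1J))) b≤p₂)) γ (≤-trans (proj₁ (proj₂ (max γ 1J))) b≤p₂)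
        (λ r l → proj₂ (proj₂ (proj₂ many)) r (≲ₚ-trans l p₂≲p₁)) star

theorem3p11 : ∀ {ℓ : Level} → ExcludedMiddle (suc ℓ) → WellOrderingPrinciple ℓ →
    (Λ κ S : V ℓ) →
    let module G = Language (ground ℓ) in
    G.RegularCardinal Λ → G.WeakPowerIsSelf Λ → G.AtLeastℵ₂ Λ →
    G.Cardinal κ → G.GreaterThanOne κ → κ ∈ᵛ Λ →
    G.IsSω S Λ → uDSR*< κ Λ S →
    Σ[ P ∈ ForcingNotion ℓ ] CofinalityPreserving P ×
      (let open Language (extension P) in
       Forced P (∃̇[ S′ ] (IsSω S′ (check P Λ)
         ∧̇ uDSR< (check P κ) (check P Λ) S′
         ∧̇ ¬̇ sDSR1 (check P Λ) S′)))
theorem3p11 {ℓ} em wop Λ κ S regular weakPower atLeastℵ₂ cardinal-κ 1<κ κ∈Λ isSω (_ , star) =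
    ℙ em wop setting , Preservation.cofinalityPreserving em wop setting , λ p q l →
      q , ≲ₚ-refl em wop setting , check (ℙ em wop setting) S ,
      GenericSequence.isSω-forced em wop setting q , Matrices.uDSR-forced em wop setting star q ,
      GenericSequence.sDSR1-fails em wop setting q
  where
  open Development
  setting : Setting Λ κ S
  setting = record { regular = regular ; weakPower = weakPower ; atLeastℵ₂ = atLeastℵ₂
    ; cardinal-κ = cardinal-κ ; 1<κ = 1<κ ; κ∈Λ = κ∈Λ ; isSω = isSω }
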